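{- Let $M=p_1^{n_1}M_1$, where $p_1$ is prime, $n_1\in\mathbb{N}$, $M_1\in\mathbb{N}$ and $p_1\nmid M_1$. Assume that for every $M'\mid M_1$, in every tiling $A'\oplus B'=\mathbb{Z}_{M'}$ both $A'$ and $B'$ satisfy (T2), and assume that $$p_1>D(M_1).$$ Then in any tiling $A\oplus B=\mathbb{Z}_M$, both $A$ and $B$ satisfy (T2).
   Context: For $N\in\mathbb{N}$, $D(N)=N/\prod_{p\mid N,\ p \text{ prime}}p$. For $A,B\subset\mathbb{Z}_N$, $A\oplus B=\mathbb{Z}_N$ (a tiling) means that every element of $\mathbb{Z}_N$ has a unique representation $a+b$ with $a\in A$, $b\in B$. A set $A\subset\mathbb{Z}_N$ is identified with a subset of $\{0,1,\dots,N-1\}$ and has mask polynomial $A(X)=\sum_{a\in A}X^a$; $\Phi_s$ denotes the $s$-th cyclotomic polynomial. Let $S_A$ be the set of prime powers $p^\alpha$ ($\alpha\ge1$) such that $\Phi_{p^\alpha}(X)\mid A(X)$. $A$ satisfies (T2) if whenever $s_1,\dots,s_k\in S_A$ are powers of distinct primes, $\Phi_{s_1\cdots s_k}(X)$ divides $A(X)$. -}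

module Defs where

open import Data.Nat using (ℕ; zero; suc; _+_; _*_; _∸_; _^_; _<_; _≤_; NonZero; nonZero)
open import Data.Nat.Properties using (m*n≢0)
open import Data.Nat.Divisibility using (_∣_; _∣?_)
open import Data.Nat.DivMod using (_/_; _%_)
open import Data.Nat.Primality using (Prime; prime?)
open import Data.Integer as ℤ using (ℤ; 0ℤ; 1ℤ; -1ℤ) renaming (_+_ to _+ℤ_; _*_ to _*ℤ_; _-_ to _-ℤ_; -_ to -ℤ_)
open import Data.List using (List; []; _∷_; map; foldr; reverse; length; filter; upTo; replicate; _++_)
open import Data.Nat.ListAction using (product)
open import Data.List.Relation.Unary.All using (All)
open import Data.List.Relation.Unary.Unique.Propositional using (Unique)
open import Data.Vec using (Vec; toList)
open import Data.Fin using (Fin; toℕ)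
open import Data.Fin.Subset using (Subset; _∈_)
open import Data.Product using (Σ; _×_; _,_; ∃; proj₁)
open import Data.Bool using (Bool; true; false; if_then_else_)
open import Relation.Nullary using (¬_; yes; no)
open import Relation.Nullary.Decidable using (_×-dec_)
open import Relation.Binary.PropositionalEquality using (_≡_; _≢_)

-- Polynomials with integer coefficients, as coefficient lists in
-- ascending order of degree (trailing zeros allowed).

Poly : Set
Poly = List ℤ

coeff : Poly → ℕ → ℤ
coeff []       _       = 0ℤ
coeff (c ∷ _)  zero    = c
coeff (_ ∷ cs) (suc i) = coeff cs i

infix 4 _≈P_
_≈P_ : Poly → Poly → Set
P ≈P Q = ∀ i → coeff P i ≡ coeff Q i

infixl 6 _+P_
_+P_ : Poly → Poly → Poly
[]       +P q        = q
(c ∷ p)  +P []       = c ∷ p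
(c ∷ p)  +P (d ∷ q)  = (c +ℤ d) ∷ (p +P q)

infixl 7 _*P_
_*P_ : Poly → Poly → Poly
[]      *P q = []
(c ∷ p) *P q = map (c *ℤ_) q +P (0ℤ ∷ (p *P q))

infix 4 _∣P_
_∣P_ : Poly → Poly → Set
D ∣P A = ∃ λ Q → A ≈P (D *P Q)

private
  subFront : List ℤ → List ℤ → List ℤ
  subFront xs       []       = xs
  subFront []       (y ∷ ys) = (-ℤ y) ∷ subFront [] ys
  subFront (x ∷ xs) (y ∷ ys) = (x -ℤ y) ∷ subFront xs ys

  -- descending-order long division by (1 ∷ bt); n = number of quotient coefficients
  divD : ℕ → List ℤ → List ℤ → List ℤ
  divD zero    _        _  = []
  divD (suc n) []       bt = []
  divD (suc n) (c ∷ as) bt = c ∷ divD n (subFront as (map (c *ℤ_) bt)) bt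

  dropZeros : List ℤ → List ℤ
  dropZeros []           = []
  dropZeros (ℤ.+ 0 ∷ cs) = dropZeros cs
  dropZeros (c ∷ cs)     = c ∷ cs

divMonic : Poly → Poly → Poly
divMonic a b with dropZeros (reverse b)
... | []      = []
... | _ ∷ bt  = let ad = dropZeros (reverse a) in
                reverse (divD (length ad ∸ length bt) ad bt)

xn-1 : ℕ → Poly
xn-1 zero    = []
xn-1 (suc n) = -1ℤ ∷ (replicate n 0ℤ ++ (1ℤ ∷ []))

properDivisors : ℕ → List ℕ
properDivisors n = filter (λ d → d ∣? n) (filter (λ d → 1 Data.Nat.≤? d) (upTo n))

-- cyclotomic polynomials via X^n - 1 = ∏_{d ∣ n} Φ_d(X); fuel argument
cycF : ℕ → ℕ → Poly
cycF zero    n = 1ℤ ∷ []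
cycF (suc f) n = divMonic (xn-1 n) (foldr _*P_ (1ℤ ∷ []) (map (cycF f) (properDivisors n)))

-- Φ n is the n-th cyclotomic polynomial for n ≥ 1
Φ : ℕ → Poly
Φ n = cycF n n

mask : ∀ {N} → Subset N → Poly
mask A = map (λ b → if b then 1ℤ else 0ℤ) (toList A)

Tiling : (N : ℕ) .{{_ : NonZero N}} → Subset N → Subset N → Set
Tiling N A B =
  ∀ (x : Fin N) →
    (∃ λ (a : Fin N) → ∃ λ (b : Fin N) → a ∈ A × b ∈ B × (toℕ a + toℕ b) % N ≡ toℕ x)
  × (∀ (a b a' b' : Fin N) → a ∈ A → b ∈ B → a' ∈ A → b' ∈ B →
       (toℕ a + toℕ b) % N ≡ toℕ x → (toℕ a' + toℕ b') % N ≡ toℕ x →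
       a ≡ a' × b ≡ b')

T2 : ∀ {N} → Subset N → Set
T2 A =
  ∀ (ps : List (ℕ × ℕ)) → ps ≢ [] →
    Unique (map proj₁ ps) →
    All (λ { (p , α) → Prime p × 1 ≤ α × (Φ (p ^ α) ∣P mask A) }) ps →
    Φ (product (map (λ { (p , α) → p ^ α }) ps)) ∣P mask A

primeDivisors : ℕ → List ℕ
primeDivisors n = filter (λ p → prime? p ×-dec (p ∣? n)) (upTo (suc n))

rad : ℕ → ℕ
rad n = product (primeDivisors n)

private
  prodNZ : (xs : List ℕ) → All (λ p → Prime p) xs → NonZero (product xs)
  prodNZ []       _ = nonZero
  prodNZ (x ∷ xs) (Data.List.Relation.Unary.All._∷_ px pxs) =
    m*n≢0 x (product xs) {{primeNZ px}} {{prodNZ xs pxs}}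
    where
      primeNZ : ∀ {p} → Prime p → NonZero p
      primeNZ {suc p} _ = nonZero
      primeNZ {zero} pr = ⊥-elim′ pr
        where
          open import Data.Nat.Primality using (¬prime[0])
          open import Data.Empty using (⊥-elim)
          ⊥-elim′ : Prime 0 → NonZero 0
          ⊥-elim′ q = ⊥-elim (¬prime[0] q)

  allPrime : ∀ n → All (λ p → Prime p) (primeDivisors n)
  allPrime n = All.map proj₁ (all-filter (λ p → prime? p ×-dec (p ∣? n)) (upTo (suc n)))
    where
      import Data.List.Relation.Unary.All as All
      open import Data.List.Relation.Unary.All.Properties using (all-filter)

rad-nonZero : ∀ n → NonZero (rad n)
rad-nonZero n = prodNZ (primeDivisors n) (allPrime n)

D : ℕ → ℕ
D n = _/_ n (rad n) {{rad-nonZero n}}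

{-# OPTIONS --safe #-}
-- Φ_{p^k} divides A(X) exactly when each class of A modulo p^(k-1) is equidistributed over the
-- classes modulo p^k, and for s = ∏ p^α exactly when the iterated differences of the class counts of A
-- modulo s vanish in all directions h_p with s ∣ p h_p.  After this translation only counting is left.
--
-- Since A(X)^r ≡ A(X^r) mod r, a tiling A ⊕ B gives a tiling rA ⊕ B for r coprime to |A| (Tijdeman).
-- Summing the dilations over the units r modulo p^k, p^k ∣ M, one finds that A or B satisfies the
-- condition at p^k, and |A||B| = M then leaves no room for a second one.
--
-- Induction on M = p^n M₁.  If a prime q ∣ M₁ does not divide |A|, then qA ⊕ B is a tiling, so A tiles
-- modulo M/q with each slice of B modulo q, and (T2) lifts from M/q.  If every prime of M₁ divides both
-- |A| and |B|, let Φ_{p^n} divide B, say.  Counting prime powers, a class of A modulo p^(n-1) has at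
-- most M₁ / rad M₁ = D(M₁) < p elements.  In a fibre z + (M/p)Z, whose points are a_j + b_j, dilations
-- by units ≡ 1 modulo M₁ show that the residues modulo p^n vary only among the a_j or only among the
-- b_j; the first would put p elements of A into one class modulo p^(n-1).  Hence A tiles modulo M/p with
-- every subset of B that picks one layer modulo p^n in each class modulo p^(n-1), and (T2) lifts from
-- M/p: at level p^n because exchanging a single layer of such a subset preserves its conditions.
module Submission where

open import Defs

-- Both reductions rest on one mechanism. `A` tiles modulo a smaller `N` with each of several pieces
-- of `B`, and `B` is the disjoint union of these pieces. A condition at a prime power that holds
-- for `B` fails for `A`, so the dichotomy modulo `N` hands it to every piece; (T2) modulo `N` then
-- makes the cuboids of the pieces vanish, and cuboids are additive. The obstacle is the top power
-- of p in M, which does not divide M/p: the pieces modulo M/p carry no condition there, and only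
-- the freedom in choosing them helps. For this reason slabs are cut out by an arbitrary labelling
-- of layers and not only by base p digits. No roots of unity occur. That the roots of Φ_n have
-- exact order n is replaced by the divisibility of (X^n - 1)/(X^g - 1) by Φ_n for proper divisors g
-- of n. Coprimality over the rationals becomes an identity in Z[X] with a nonzero integer value,
-- and this integer can be cancelled because the divisors are monic. Since `Φ` is defined by long
-- division, exactness of that division has to come before every other fact about it.

module Tilings where

  open import Algebra.Bundles using (CommutativeRing)
  open import Data.Bool.Base using (Bool; true; false; if_then_else_)
  open import Data.Empty using (⊥; ⊥-elim)
  open import Data.Fin.Base as Fin using (Fin; toℕ; fromℕ; fromℕ<)
  open import Data.Fin.Properties using (toℕ<n; toℕ-fromℕ; toℕ-fromℕ<; toℕ-injective)
  open import Data.Fin.Subset using (Subset) renaming (_∈_ to _∈ˢ_)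
  open import Data.Integer.Base as ℤ
    using (ℤ; +_; -[1+_]; +[1+_]; 0ℤ; 1ℤ; -1ℤ; _+_; _-_; _*_; -_; _≤_; _<_; +≤+; ≢-nonZero)
  open import Data.Integer.DivMod using (_%ℕ_; _/ℕ_; n%ℕd<d; a≡a%ℕn+[a/ℕn]*n)
  open import Data.Integer.Divisibility.Signed as ℤD
    using (divides; _∣?_; ∣-refl; ∣⇒∣ᵤ; ∣ᵤ⇒∣; ∣-trans; ∣m∣n⇒∣m+n; ∣m∣n⇒∣m-n; ∣m⇒∣-m; ∣m⇒∣m*n; ∣n⇒∣m*n)
  import Data.Integer.Properties as ℤP
  open import Data.Integer.Tactic.RingSolver using (solve-∀)
  open import Data.List.Base
    using (List; []; _∷_; [_]; map; filter; foldl; foldr; length; replicate; reverse; take; upTo; _++_; initLast; _∷ʳ′_)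
  open import Data.List.Membership.Propositional using (_∈_)
  open import Data.List.Membership.Propositional.Properties using (∈-filter⁻; ∈-filter⁺; ∈-map⁺; ∈-upTo⁺; ∈-upTo⁻)
  open import Data.List.Properties
    using (length-++; length-map; length-replicate; length-reverse; map-cong; map-cong-local; map-id; map-∘;
           reverse-injective; reverse-involutive; reverse-map; unfold-reverse)
  open import Data.List.Relation.Binary.Permutation.Propositional as Perm using (_↭_)
  open import Data.List.Relation.Binary.Permutation.Propositional.Properties using (All-resp-↭)
  open import Data.List.Relation.Binary.Pointwise as Pointwise using (Pointwise; []; _∷_)
  open import Data.List.Relation.Unary.All as All using (All; []; _∷_)
  import Data.List.Relation.Unary.All.Properties as AllP
  open import Data.List.Relation.Unary.AllPairs using (AllPairs; []; _∷_)
  open import Data.List.Relation.Unary.Any as Any using (here; there)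
  open import Data.List.Relation.Unary.Unique.Propositional using (Unique)
  import Data.List.Relation.Unary.Unique.Propositional.Properties as UniqueP
  open import Data.Maybe.Base using (Maybe; just; nothing)
  open import Data.Nat.Base as ℕ using (ℕ; zero; suc; z≤n; s≤s; _∸_; _!)
  open import Data.Nat.Combinatorics using (nCn≡1; k![n∸k]!∣n!; nCk≡n!/k![n-k]!) renaming (_C_ to _choose_)
  open import Data.Nat.Coprimality using (Coprime; coprime-divisor; coprime-Bézout) renaming (sym to Coprime-sym)
  open import Data.Nat.DivMod using (_/_; _%_; m*n/n≡m; m/n*n≡m; /-monoˡ-≤)
  open import Data.Nat.Divisibility as ℕD using (_∣_)
  open import Data.Nat.GCD as GCD using (gcd; gcd[m,n]∣m; gcd[m,n]∣n; gcd-comm; gcd[m,n]≢0; module Bézout)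
  open import Data.Nat.Induction using (<-rec)
  open import Data.Nat.ListAction using (product)
  open import Data.Nat.ListAction.Properties using (∈⇒∣product)
  open import Data.Nat.Primality
    using (Prime; prime?; euclidsLemma; prime⇒nonZero; prime⇒nonTrivial; prime⇒irreducible; ¬prime[0]; ¬prime[1])
  open import Data.Nat.Primality.Factorisation using (factorise; PrimeFactorisation; factorisationHasAllPrimeFactors)
  import Data.Nat.Properties as ℕP
  open import Data.Product using (Σ; _×_; _,_; proj₁; proj₂; ∃)
  open import Data.Sum using (_⊎_; inj₁; inj₂; [_,_]′)
  open import Data.Vec.Base using (Vec; []; _∷_; here; there; tabulate)
  open import Data.Vec.Properties using (lookup∘tabulate; lookup⇒[]=; []=⇒lookup; tabulate-cong)
  open import Function.Base using (_∘_; flip; id)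
  open import Level using (0ℓ)
  open import Relation.Binary.Definitions using (tri<; tri≈; tri>)
  open import Relation.Binary.PropositionalEquality
    using (_≡_; _≢_; refl; sym; trans; cong; cong₂; subst; subst₂; ≢-sym; module ≡-Reasoning)
  import Relation.Binary.Reasoning.Setoid as SetoidReasoning
  open import Relation.Binary.Structures using (IsEquivalence)
  open import Relation.Nullary using (Dec; ¬_; yes; no; ¬?; does)
  open import Relation.Nullary.Decidable using (_×-dec_; dec-true; decidable-stable)
  open import Relation.Unary using (Decidable)
  import Tactic.RingSolver as Ring
  import Tactic.RingSolver.Core.AlmostCommutativeRing as ACR

  -- Long division by monic polynomials

  -- Agrees with the private removal of leading zeros inside `divMonic`, which cannot be named here.
  strip : List ℤ → List ℤ
  strip []             = []
  strip (+ 0 ∷ cs)     = strip cs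
  strip (+[1+ k ] ∷ cs) = +[1+ k ] ∷ cs
  strip (-[1+ k ] ∷ cs) = -[1+ k ] ∷ cs

  -- Undone by the private subtraction of fronts whenever `ys` is no longer than `xs`.
  addFront : List ℤ → List ℤ → List ℤ
  addFront xs       []       = xs
  addFront []       (y ∷ ys) = y ∷ ys
  addFront (x ∷ xs) (y ∷ ys) = (x + y) ∷ addFront xs ys

  -- The product of q and the monic 1 ∷ bt, all in descending order.
  mulD : List ℤ → List ℤ → List ℤ
  mulD []      bt = replicate (length bt) 0ℤ
  mulD (c ∷ q) bt = c ∷ addFront (mulD q bt) (map (c *_) bt)

  length-addFront : ∀ xs ys → length ys ℕ.≤ length xs → length (addFront xs ys) ≡ length xs
  length-addFront xs       []       _ = refl
  length-addFront (x ∷ xs) (y ∷ ys) (s≤s h) = cong suc (length-addFront xs ys h)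

  length-mulD : ∀ q bt → length (mulD q bt) ≡ length q ℕ.+ length bt
  length-mulD []      bt = length-replicate (length bt)
  length-mulD (c ∷ q) bt = cong suc (trans
    (length-addFront (mulD q bt) (map (c *_) bt)
      (subst₂ ℕ._≤_ (sym (length-map _ bt)) (sym (length-mulD q bt)) (ℕP.m≤n+m (length bt) (length q))))
    (length-mulD q bt))

  -- The long division of Defs is private; it is only visible through
  -- G acc n as ys bt = reverse (divD n (subFront as ys) bt) ++ acc, whose defining equations
  -- are the parameters below.
  module LongDivision
    (G : List ℤ → ℕ → List ℤ → List ℤ → List ℤ → List ℤ)
    (g-zero : ∀ acc as ys bt → G acc 0 as ys bt ≡ acc)
    (g-nil  : ∀ acc n bt → G acc (suc n) [] [] bt ≡ acc)
    (g-cons : ∀ acc n d ds bt → G acc (suc n) (d ∷ ds) [] bt ≡ G (d ∷ acc) n ds (map (d *_) bt) bt)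
    (g-sub  : ∀ acc n x xs y ys → G acc (suc n) (x ∷ xs) (y ∷ ys) [] ≡ G ((x - y) ∷ acc) n xs ys [])
    (diff   : ∀ as ys → Σ (List ℤ) λ zs → ∀ acc n bt → G acc n as ys bt ≡ G acc n zs [] bt)
    where

    -- With `bt` empty the divisor is the constant 1 and the quotient is the dividend itself. So `G`
    -- at `bt = []` reads off a list that is otherwise hidden.
    copy : ∀ n zs acc → G acc n zs [] [] ≡ foldl (flip _∷_) acc (take n zs)
    copy zero    zs       acc = g-zero acc zs [] []
    copy (suc n) []       acc = g-nil acc n []
    copy (suc n) (z ∷ zs) acc = trans (g-cons acc n z zs []) (copy n zs (z ∷ acc))

    copy-addFront : ∀ n zs ys acc → length ys ℕ.≤ length zs →
      G acc n (addFront zs ys) ys [] ≡ foldl (flip _∷_) acc (take n zs)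
    copy-addFront n       zs       []       acc _ = copy n zs acc
    copy-addFront zero    (z ∷ zs) (y ∷ ys) acc _ = g-zero acc _ _ []
    copy-addFront (suc n) (z ∷ zs) (y ∷ ys) acc (s≤s h) =
      trans (g-sub acc n (z + y) (addFront zs ys) y ys)
        (trans (cong (λ w → G (w ∷ acc) n (addFront zs ys) ys [])
                 (trans (ℤP.+-assoc z y _) (trans (cong (_+_ z) (ℤP.+-inverseʳ y)) (ℤP.+-identityʳ z))))
          (copy-addFront n zs ys (z ∷ acc) h))

    take-all : ∀ n (zs : List ℤ) → length zs ℕ.≤ n → take n zs ≡ zs
    take-all zero    []       _ = refl
    take-all (suc n) []       _ = refl
    take-all (suc n) (z ∷ zs) (s≤s h) = cong (z ∷_) (take-all n zs h)

    -- The difference `ws` is visible only through `G`. Dividing it by 1 with enough places `N`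
    -- copies it out, and `copy-addFront` finds `zs` as the same output, hence `ws ≡ zs`.
    sub-addFront : ∀ zs ys acc n bt → length ys ℕ.≤ length zs →
      G acc n (addFront zs ys) ys bt ≡ G acc n zs [] bt
    sub-addFront zs ys acc n bt h =
      trans (proj₂ (diff (addFront zs ys) ys) acc n bt) (cong (λ w → G acc n w [] bt) same)
      where
      ws = proj₁ (diff (addFront zs ys) ys)
      N  = length zs ℕ.⊔ length ws
      same : ws ≡ zs
      same = reverse-injective (trans
        (cong reverse (sym (take-all N ws (ℕP.m≤n⊔m (length zs) (length ws)))))
        (trans (sym (copy N ws []))
        (trans (sym (proj₂ (diff (addFront zs ys) ys) [] N []))
        (trans (copy-addFront N zs ys [] h)
          (cong reverse (take-all N zs (ℕP.m≤m⊔n (length zs) (length ws))))))))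

    -- Subtracting `c` times `bt` from the product leaves `mulD q bt`, whose head is the next
    -- coefficient of the quotient.
    divide : ∀ q c bt acc → G acc (length q) (addFront (mulD q bt) (map (c *_) bt)) (map (c *_) bt) bt
             ≡ foldl (flip _∷_) acc q
    divide q c bt acc = trans
      (sub-addFront (mulD q bt) (map (c *_) bt) acc (length q) bt
        (subst₂ ℕ._≤_ (sym (length-map _ bt)) (sym (length-mulD q bt)) (ℕP.m≤n+m (length bt) (length q))))
      (go q)
      where
      go : ∀ q → G acc (length q) (mulD q bt) [] bt ≡ foldl (flip _∷_) acc q
      go []      = g-zero acc _ [] bt
      go (d ∷ q) = trans (g-cons acc (length q) d _ bt) (divide q d bt (d ∷ acc))

  -- Meant for functions `K` that begin by dropping leading zeros, for which the first hypothesis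
  -- holds by computation.
  strip-induction : (K : List ℤ → List ℤ) → (∀ cs → K (+ 0 ∷ cs) ≡ K cs) →
    ∀ xs {zs y} c ws → strip xs ≡ zs → zs ≡ c ∷ ws → K (c ∷ ws) ≡ y → K xs ≡ y
  strip-induction K k0 (+ 0 ∷ cs) c ws e e' f = trans (k0 cs) (strip-induction K k0 cs c ws e e' f)
  strip-induction K k0 (+[1+ k ] ∷ cs) c ws refl refl f = f
  strip-induction K k0 (-[1+ k ] ∷ cs) c ws refl refl f = f
  strip-induction K k0 [] c ws refl () f

  -- divMonic-rev, dividend-rev and division stand for terms built from private functions of Defs;
  -- unification in the accompanying proofs determines them.
  mutual
    divMonic-rev : Poly → Poly → List ℤ → List ℤ
    divMonic-rev = _

    divMonic-strip : ∀ a b bt → strip (reverse b) ≡ 1ℤ ∷ bt → divMonic a b ≡ divMonic a (reverse (1ℤ ∷ bt))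
    divMonic-strip a b bt e with reverse b | reverse (reverse (1ℤ ∷ bt)) | reverse-involutive (1ℤ ∷ bt)
    ... | rb | ._ | refl = strip-induction (divMonic-rev a b) (λ _ → refl) rb 1ℤ bt e refl refl

  mutual
    dividend-rev : List ℤ → List ℤ → List ℤ
    dividend-rev = _

    divMonic-dividend : ∀ a bt c ws {zs y} → strip (reverse a) ≡ zs → zs ≡ c ∷ ws →
      dividend-rev (c ∷ ws) bt ≡ y → divMonic a (reverse (1ℤ ∷ bt)) ≡ y
    divMonic-dividend a bt c ws e e′ f with reverse (reverse (1ℤ ∷ bt)) | reverse-involutive (1ℤ ∷ bt)
    ... | ._ | refl with reverse a
    ... | ra = strip-induction (λ r → dividend-rev r bt) (λ _ → refl) ra c ws e e′ f

  mutual
    division : List ℤ → ℕ → List ℤ → List ℤ → List ℤ → List ℤ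
    division = _

    -- The hypothesis `strip (c ∷ []) ≡ c ∷ []` expresses that `c` is nonzero, in a form that
    -- refutes the clause `+ 0` by computation.
    divide-head : ∀ m c cs bt {out} → suc (length cs) ∸ length bt ≡ suc m →
      strip (c ∷ []) ≡ c ∷ [] →
      division (c ∷ []) m cs (map (c *_) bt) bt ≡ out → dividend-rev (c ∷ cs) bt ≡ out
    divide-head m (+ 0)     cs bt e () f
    divide-head m +[1+ k ]  cs bt e _ f with suc (length cs) ∸ length bt | e
    ... | ._ | refl with map (+[1+ k ] *_) bt | [ +[1+ k ] ]
    ... | ys | acc = f
    divide-head m -[1+ k ]  cs bt e _ f with suc (length cs) ∸ length bt | e
    ... | ._ | refl with map (-[1+ k ] *_) bt | [ -[1+ k ] ]
    ... | ys | acc = f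

  divMonic-exact : ∀ a b bt c q → strip (reverse b) ≡ 1ℤ ∷ bt →
    strip (reverse a) ≡ mulD (c ∷ q) bt → strip (c ∷ []) ≡ c ∷ [] → divMonic a b ≡ reverse (c ∷ q)
  divMonic-exact a b bt c q eb ea c≢0 = trans (divMonic-strip a b bt eb)
    (divMonic-dividend a bt c _ ea refl
      (divide-head (length q) c (addFront (mulD q bt) (map (c *_) bt)) bt quot-length c≢0
        (LongDivision.divide division (λ _ _ _ _ → refl) (λ _ _ _ → refl) (λ _ _ _ _ _ → refl)
          (λ _ _ _ _ _ _ → refl) (λ as ys → _ , λ acc n bt′ → refl) q c bt (c ∷ []))))
    where
    quot-length : length (mulD (c ∷ q) bt) ∸ length bt ≡ suc (length q)
    quot-length = trans (cong (_∸ length bt) (length-mulD (c ∷ q) bt)) (ℕP.m+n∸n≡m (suc (length q)) (length bt))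

  -- The commutative ring of integer polynomials

  infix 4 _≋_
  -- A record, because `P ≈P Q` unfolds to a function type from which `P` and `Q` cannot be
  -- inferred.
  record _≋_ (P Q : Poly) : Set where
    constructor mk
    field at : P ≈P Q
  open _≋_

  coeff-+P : ∀ P Q i → coeff (P +P Q) i ≡ coeff P i + coeff Q i
  coeff-+P []      Q       i       = sym (ℤP.+-identityˡ _)
  coeff-+P (c ∷ P) []      i       = sym (ℤP.+-identityʳ _)
  coeff-+P (c ∷ P) (d ∷ Q) zero    = refl
  coeff-+P (c ∷ P) (d ∷ Q) (suc i) = coeff-+P P Q i

  infixr 8 _·_
  _·_ : ℤ → Poly → Poly
  c · P = map (c *_) P

  coeff-· : ∀ c P i → coeff (c · P) i ≡ c * coeff P i
  coeff-· c []      i       = sym (ℤP.*-zeroʳ c)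
  coeff-· c (d ∷ P) zero    = refl
  coeff-· c (d ∷ P) (suc i) = coeff-· c P i

  ≋-refl : ∀ {P} → P ≋ P
  ≋-refl = mk λ _ → refl
  ≋-sym : ∀ {P Q} → P ≋ Q → Q ≋ P
  ≋-sym (mk e) = mk λ i → sym (e i)
  ≋-trans : ∀ {P Q R} → P ≋ Q → Q ≋ R → P ≋ R
  ≋-trans (mk e) (mk f) = mk λ i → trans (e i) (f i)

  ∷-cong : ∀ {c d P Q} → c ≡ d → P ≋ Q → c ∷ P ≋ d ∷ Q
  ∷-cong c≡d (mk e) = mk λ { zero → c≡d ; (suc i) → e i }

  +P-cong : ∀ {P P′ Q Q′} → P ≋ P′ → Q ≋ Q′ → P +P Q ≋ P′ +P Q′
  +P-cong {P} {P′} {Q} {Q′} (mk e) (mk f) = mk λ i →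
    trans (coeff-+P P Q i) (trans (cong₂ _+_ (e i) (f i)) (sym (coeff-+P P′ Q′ i)))

  +P-congˡ : ∀ P {Q R} → Q ≋ R → P +P Q ≋ P +P R
  +P-congˡ P e = +P-cong (≋-refl {P}) e

  +P-congʳ : ∀ Q {P R} → P ≋ R → P +P Q ≋ R +P Q
  +P-congʳ Q e = +P-cong e (≋-refl {Q})

  ·-cong : ∀ c {P Q} → P ≋ Q → c · P ≋ c · Q
  ·-cong c {P} {Q} (mk e) = mk λ i → trans (coeff-· c P i) (trans (cong (c *_) (e i)) (sym (coeff-· c Q i)))

  +P-assoc : ∀ P Q R → (P +P Q) +P R ≋ P +P (Q +P R)
  +P-assoc P Q R = mk λ i → trans (coeff-+P (P +P Q) R i) (trans (cong (_+ coeff R i) (coeff-+P P Q i))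
    (trans (ℤP.+-assoc (coeff P i) _ _)
      (sym (trans (coeff-+P P (Q +P R) i) (cong (_+_ (coeff P i)) (coeff-+P Q R i))))))

  +P-comm : ∀ P Q → P +P Q ≋ Q +P P
  +P-comm P Q = mk λ i → trans (coeff-+P P Q i) (trans (ℤP.+-comm (coeff P i) _) (sym (coeff-+P Q P i)))

  +P-identityʳ : ∀ P → P +P [] ≋ P
  +P-identityʳ P = mk λ i → trans (coeff-+P P [] i) (ℤP.+-identityʳ _)

  negP : Poly → Poly
  negP P = -1ℤ · P

  +P-inverseʳ : ∀ P → P +P negP P ≋ []
  +P-inverseʳ P = mk λ i → trans (coeff-+P P (negP P) i)
    (trans (cong (_+_ (coeff P i)) (coeff-· -1ℤ P i)) (lem (coeff P i)))
    where
    lem : ∀ x → x + -1ℤ * x ≡ 0ℤ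
    lem = solve-∀

  ·-distribˡ : ∀ c P Q → c · (P +P Q) ≋ c · P +P c · Q
  ·-distribˡ c P Q = mk λ i → trans (coeff-· c (P +P Q) i) (trans (cong (c *_) (coeff-+P P Q i))
    (trans (ℤP.*-distribˡ-+ c (coeff P i) _)
      (sym (trans (coeff-+P (c · P) (c · Q) i) (cong₂ _+_ (coeff-· c P i) (coeff-· c Q i))))))

  ·-assoc : ∀ c d P → (c * d) · P ≋ c · d · P
  ·-assoc c d P = mk λ i → trans (coeff-· (c * d) P i) (trans (ℤP.*-assoc c d _)
    (sym (trans (coeff-· c (d · P) i) (cong (c *_) (coeff-· d P i)))))

  1· : ∀ P → 1ℤ · P ≋ P
  1· P = mk λ i → trans (coeff-· 1ℤ P i) (ℤP.*-identityˡ _)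

  0· : ∀ P → 0ℤ · P ≋ []
  0· P = mk λ i → coeff-· 0ℤ P i

  X·_ : Poly → Poly
  X· P = 0ℤ ∷ P

  X-cong : ∀ {P Q} → P ≋ Q → X· P ≋ X· Q
  X-cong = ∷-cong refl

  X-· : ∀ c P → X· (c · P) ≋ c · (X· P)
  X-· c P = ∷-cong (sym (ℤP.*-zeroʳ c)) ≋-refl

  X-zero : X· [] ≋ []
  X-zero = mk λ { zero → refl ; (suc i) → refl }

  +P-interchange : ∀ P Q R S → (P +P Q) +P (R +P S) ≋ (P +P R) +P (Q +P S)
  +P-interchange P Q R S = mk λ i → trans (coeff-+P (P +P Q) (R +P S) i)
    (trans (cong₂ _+_ (coeff-+P P Q i) (coeff-+P R S i))
      (trans (lem (coeff P i) (coeff Q i) (coeff R i) (coeff S i))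
    (sym (trans (coeff-+P (P +P R) (Q +P S) i) (cong₂ _+_ (coeff-+P P R i) (coeff-+P Q S i))))))
    where
    lem : ∀ a b c d → (a + b) + (c + d) ≡ (a + c) + (b + d)
    lem = solve-∀

  *P-congʳ : ∀ P {Q R} → Q ≋ R → P *P Q ≋ P *P R
  *P-congʳ []      e = ≋-refl
  *P-congʳ (c ∷ P) e = +P-cong (·-cong c e) (X-cong (*P-congʳ P e))

  *P-zeroʳ : ∀ P → P *P [] ≋ []
  *P-zeroʳ []      = ≋-refl
  *P-zeroʳ (c ∷ P) = ≋-trans (X-cong (*P-zeroʳ P)) X-zero

  *P-∷ʳ : ∀ P d Q → P *P (d ∷ Q) ≋ d · P +P X· (P *P Q)
  *P-∷ʳ []      d Q = ≋-sym X-zero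
  *P-∷ʳ (c ∷ P) d Q = ∷-cong (cong (_+ 0ℤ) (ℤP.*-comm c d))
    (≋-trans (+P-cong ≋-refl (*P-∷ʳ P d Q))
      (≋-trans (≋-sym (+P-assoc (c · Q) (d · P) (X· (P *P Q))))
        (≋-trans (+P-cong (+P-comm (c · Q) (d · P)) ≋-refl) (+P-assoc (d · P) (c · Q) (X· (P *P Q))))))

  *P-comm : ∀ P Q → P *P Q ≋ Q *P P
  *P-comm []      Q = ≋-sym (*P-zeroʳ Q)
  *P-comm (c ∷ P) Q = ≋-trans (+P-cong ≋-refl (X-cong (*P-comm P Q))) (≋-sym (*P-∷ʳ Q c P))

  *P-congˡ : ∀ {P Q} R → P ≋ Q → P *P R ≋ Q *P R
  *P-congˡ {P} {Q} R e = ≋-trans (*P-comm P R) (≋-trans (*P-congʳ R e) (*P-comm R Q))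

  *P-distribˡ : ∀ P Q R → P *P (Q +P R) ≋ P *P Q +P P *P R
  *P-distribˡ []      Q R = ≋-refl
  *P-distribˡ (c ∷ P) Q R =
    ≋-trans (+P-cong (·-distribˡ c Q R) (X-cong (*P-distribˡ P Q R)))
      (+P-interchange (c · Q) (c · R) (X· (P *P Q)) (X· (P *P R)))

  *P-distribʳ : ∀ P Q R → (Q +P R) *P P ≋ Q *P P +P R *P P
  *P-distribʳ P Q R = ≋-trans (*P-comm (Q +P R) P)
    (≋-trans (*P-distribˡ P Q R) (+P-cong (*P-comm P Q) (*P-comm P R)))

  ·-*P : ∀ c P Q → (c · P) *P Q ≋ c · (P *P Q)
  ·-*P c []      Q = ≋-refl
  ·-*P c (d ∷ P) Q = ≋-trans (+P-cong (·-assoc c d Q) (≋-trans (X-cong (·-*P c P Q)) (X-· c (P *P Q))))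
    (≋-sym (·-distribˡ c (d · Q) (X· (P *P Q))))

  X-*P : ∀ P Q → (X· P) *P Q ≋ X· (P *P Q)
  X-*P P Q = +P-cong (0· Q) ≋-refl

  *P-assoc : ∀ P Q R → (P *P Q) *P R ≋ P *P (Q *P R)
  *P-assoc []      Q R = ≋-refl
  *P-assoc (c ∷ P) Q R = ≋-trans (*P-distribʳ R (c · Q) (X· (P *P Q)))
    (+P-cong (·-*P c Q R) (≋-trans (X-*P (P *P Q) R) (X-cong (*P-assoc P Q R))))

  1≢0 : 1ℤ ≢ 0ℤ
  1≢0 ()

  1P : Poly
  1P = 1ℤ ∷ []

  *P-identityˡ : ∀ P → 1P *P P ≋ P
  *P-identityˡ P = ≋-trans (+P-cong (1· P) X-zero) (+P-identityʳ P)

  polyRing : CommutativeRing 0ℓ 0ℓ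
  polyRing = record
    { Carrier = Poly ; _≈_ = _≋_ ; _+_ = _+P_ ; _*_ = _*P_ ; -_ = negP ; 0# = [] ; 1# = 1P
    ; isCommutativeRing = record
      { isRing = record
        { +-isAbelianGroup = record
          { isGroup = record
            { isMonoid = record
              { isSemigroup = record
                { isMagma = record { isEquivalence = eq ; ∙-cong = +P-cong }
                ; assoc = +P-assoc }
              ; identity = (λ _ → ≋-refl) , +P-identityʳ }
            ; inverse = (λ P → ≋-trans (+P-comm (negP P) P) (+P-inverseʳ P)) , +P-inverseʳ
            ; ⁻¹-cong = ·-cong -1ℤ }
          ; comm = +P-comm }
        ; *-cong = λ {P} {P′} {Q} {Q′} e f → ≋-trans (*P-congˡ Q e) (*P-congʳ P′ f)
        ; *-assoc = *P-assoc
        ; *-identity = *P-identityˡ , (λ P → ≋-trans (*P-comm P 1P) (*P-identityˡ P))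
        ; distrib = *P-distribˡ , *P-distribʳ }
      ; *-comm = *P-comm } }
    where
    eq : IsEquivalence _≋_
    eq = record { refl = ≋-refl ; sym = ≋-sym ; trans = ≋-trans }

  -- The zero test of the ring solver; it recognises constants that vanish only up to `≋`, such as
  -- `0ℤ ∷ []`.
  []≟ : ∀ P → Maybe ([] ≋ P)
  []≟ []         = just ≋-refl
  []≟ (+ 0 ∷ P)  with []≟ P
  ... | just e  = just (≋-trans (≋-sym X-zero) (X-cong e))
  ... | nothing = nothing
  []≟ (_ ∷ P)    = nothing

  polyACR : ACR.AlmostCommutativeRing 0ℓ 0ℓ
  polyACR = ACR.fromCommutativeRing polyRing []≟

  module R = CommutativeRing polyRing

  -- Divisibility of polynomials

  module ≋-Reasoning = SetoidReasoning R.setoid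

  infix 4 _∣ᴾ_
  record _∣ᴾ_ (P F : Poly) : Set where
    constructor divides
    field
      quotient : Poly
      equality : F ≋ P *P quotient
  open _∣ᴾ_

  ∣ᴾ-refl : ∀ {P} → P ∣ᴾ P
  ∣ᴾ-refl {P} = divides 1P (≋-sym (R.*-identityʳ P))

  ∣ᴾ-trans : ∀ {P Q F} → P ∣ᴾ Q → Q ∣ᴾ F → P ∣ᴾ F
  ∣ᴾ-trans {P} (divides q e) (divides r f) = divides (q *P r)
    (≋-trans f (≋-trans (*P-congˡ r e) (*P-assoc P q r)))

  ∣ᴾ-resp : ∀ {P F G} → F ≋ G → P ∣ᴾ F → P ∣ᴾ G
  ∣ᴾ-resp e (divides q f) = divides q (≋-trans (≋-sym e) f)

  ∣ᴾ-respˡ : ∀ {P Q F} → P ≋ Q → P ∣ᴾ F → Q ∣ᴾ F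
  ∣ᴾ-respˡ e (divides q f) = divides q (≋-trans f (*P-congˡ q e))

  ∣ᴾ-*ʳ : ∀ {P F} G → P ∣ᴾ F → P ∣ᴾ F *P G
  ∣ᴾ-*ʳ {P} G (divides q e) = divides (q *P G) (≋-trans (*P-congˡ G e) (*P-assoc P q G))

  ∣ᴾ-*ˡ : ∀ {P F} G → P ∣ᴾ F → P ∣ᴾ G *P F
  ∣ᴾ-*ˡ {P} {F} G d = ∣ᴾ-resp (*P-comm F G) (∣ᴾ-*ʳ G d)

  ∣ᴾ-+ : ∀ {P F G} → P ∣ᴾ F → P ∣ᴾ G → P ∣ᴾ F +P G
  ∣ᴾ-+ {P} (divides q e) (divides r f) = divides (q +P r) (≋-trans (+P-cong e f) (≋-sym (*P-distribˡ P q r)))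

  const : ℤ → Poly
  const c = c ∷ []

  const-*P : ∀ c P → const c *P P ≋ c · P
  const-*P c P = ≋-trans (+P-cong ≋-refl X-zero) (+P-identityʳ _)

  -- Degree bounds and monic polynomials

  Bound : ℕ → Poly → Set
  Bound d P = ∀ i → d ℕ.≤ i → coeff P i ≡ 0ℤ

  Bound-resp : ∀ {d P Q} → P ≋ Q → Bound d P → Bound d Q
  Bound-resp (mk e) b i h = trans (sym (e i)) (b i h)

  record Monic (d : ℕ) (P : Poly) : Set where
    constructor monic
    field
      lead : coeff P d ≡ 1ℤ
      bound : Bound (suc d) P
  open Monic

  Monic-resp : ∀ {d P Q} → P ≋ Q → Monic d P → Monic d Q
  Monic-resp {d} e@(mk f) (monic l b) = monic (trans (sym (f d)) l) (Bound-resp e b)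

  bounded : ∀ P → Σ ℕ λ d → Bound d P
  bounded []      = 0 , λ _ _ → refl
  bounded (c ∷ P) with bounded P
  ... | d , b = suc d , λ { (suc i) (s≤s h) → b i h }

  coeff-∷-*P : ∀ c P Q i → coeff ((c ∷ P) *P Q) i ≡ c * coeff Q i + coeff (X· (P *P Q)) i
  coeff-∷-*P c P Q i = trans (coeff-+P (c · Q) _ i) (cong (_+ _) (coeff-· c Q i))

  Bound-zero : ∀ {P} → Bound 0 P → P ≋ []
  Bound-zero b = mk λ i → b i z≤n

  Bound-*P : ∀ d e P Q → Bound d P → Bound (suc e) Q → Bound (d ℕ.+ e) (P *P Q)
  Bound-*P zero e P Q bP bQ i h = at (*P-congˡ {P} Q (Bound-zero bP)) i
  Bound-*P (suc d) e [] Q bP bQ i h = refl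
  Bound-*P (suc d) e (c ∷ P) Q bP bQ (suc i) (s≤s h) = trans (coeff-∷-*P c P Q (suc i))
    (cong₂ _+_ (trans (cong (c *_) (bQ (suc i) (s≤s (ℕP.≤-trans (ℕP.m≤n+m e d) h)))) (ℤP.*-zeroʳ c))
      (Bound-*P d e P Q (λ j g → bP (suc j) (s≤s g)) bQ i h))

  lead-*P : ∀ d e P Q → Bound (suc d) P → Bound (suc e) Q →
    coeff (P *P Q) (d ℕ.+ e) ≡ coeff P d * coeff Q e
  lead-*P d e [] Q bP bQ = sym (ℤP.*-zeroˡ (coeff Q e))
  lead-*P zero zero (c ∷ P) Q bP bQ = trans (coeff-∷-*P c P Q 0) (ℤP.+-identityʳ _)
  lead-*P zero (suc e) (c ∷ P) Q bP bQ = trans (coeff-∷-*P c P Q (suc e))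
    (trans (cong (_+_ (c * coeff Q (suc e))) (at (*P-congˡ {P} Q (Bound-zero λ i h → bP (suc i) (s≤s z≤n))) e))
      (ℤP.+-identityʳ _))
  lead-*P (suc d) e (c ∷ P) Q bP bQ = trans (coeff-∷-*P c P Q (suc d ℕ.+ e))
    (trans (cong₂ _+_ (trans (cong (c *_) (bQ (suc d ℕ.+ e) (s≤s (ℕP.m≤n+m e d)))) (ℤP.*-zeroʳ c))
        (lead-*P d e P Q (λ j g → bP (suc j) (s≤s g)) bQ))
      (ℤP.+-identityˡ _))

  Monic-*P : ∀ {d e P Q} → Monic d P → Monic e Q → Monic (d ℕ.+ e) (P *P Q)
  Monic-*P {d} {e} {P} {Q} (monic lP bP) (monic lQ bQ) =
    monic (trans (lead-*P d e P Q bP bQ) (cong₂ _*_ lP lQ)) (Bound-*P (suc d) e P Q bP bQ)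

  Monic-1 : Monic 0 1P
  Monic-1 = monic refl λ { (suc i) _ → refl }

  -- X^n and X^n - 1

  X^_ : ℕ → Poly
  X^ zero  = 1P
  X^ suc n = X· (X^ n)

  X^-+ : ∀ m n → X^ (m ℕ.+ n) ≋ X^ m *P X^ n
  X^-+ zero    n = ≋-sym (*P-identityˡ (X^ n))
  X^-+ (suc m) n = ≋-trans (X-cong (X^-+ m n)) (≋-sym (X-*P (X^ m) (X^ n)))

  X^-monic : ∀ n → Monic n (X^ n)
  X^-monic zero    = Monic-1
  X^-monic (suc n) = monic (lead (X^-monic n)) λ { (suc i) (s≤s h) → bound (X^-monic n) i h }

  X^-1 : ℕ → Poly
  X^-1 n = X^ n +P negP 1P

  X^-1-monic : ∀ n → Monic (suc n) (X^-1 (suc n))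
  X^-1-monic n = monic
    (trans (coeff-+P (X^ suc n) (negP 1P) (suc n)) (trans (ℤP.+-identityʳ _) (lead (X^-monic (suc n)))))
    λ { (suc i) (s≤s h) → trans (coeff-+P (X^ suc n) (negP 1P) (suc i))
          (trans (ℤP.+-identityʳ _) (bound (X^-monic (suc n)) (suc i) (s≤s h))) }

  xn-1≋ : ∀ n → xn-1 n ≋ X^-1 n
  xn-1≋ zero    = mk λ { zero → refl ; (suc i) → refl }
  xn-1≋ (suc n) = ∷-cong refl (≋-trans (go n) (≋-sym (+P-identityʳ _)))
    where
    go : ∀ n → replicate n 0ℤ ++ (1ℤ ∷ []) ≋ X^ n
    go zero    = ≋-refl
    go (suc n) = X-cong (go n)

  X^-1-+ : ∀ m n → X^-1 (m ℕ.+ n) ≋ X^-1 m *P X^ n +P X^-1 n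
  X^-1-+ m n = ≋-trans (+P-cong (X^-+ m n) ≋-refl) (lem (X^ m) (X^ n))
    where
    lem : ∀ P Q → P *P Q +P negP 1P ≋ (P +P negP 1P) *P Q +P (Q +P negP 1P)
    lem = Ring.solve-∀ polyACR

  -- The sum 1 + X^d + ... + X^((k-1)d), the cofactor of X^d - 1 in X^(kd) - 1.
  geom : ℕ → ℕ → Poly
  geom d zero    = []
  geom d (suc k) = 1P +P X^ d *P geom d k

  X^-1-geom : ∀ d k → X^-1 (k ℕ.* d) ≋ X^-1 d *P geom d k
  X^-1-geom d zero    = ≋-trans (R.-‿inverseʳ 1P) (≋-sym (*P-zeroʳ (X^-1 d)))
  X^-1-geom d (suc k) = begin
    X^-1 (d ℕ.+ k ℕ.* d)                          ≡⟨ cong X^-1 (ℕP.+-comm d (k ℕ.* d)) ⟩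
    X^-1 (k ℕ.* d ℕ.+ d)                          ≈⟨ X^-1-+ (k ℕ.* d) d ⟩
    X^-1 (k ℕ.* d) *P X^ d +P X^-1 d              ≈⟨ +P-cong (*P-congˡ (X^ d) (X^-1-geom d k)) ≋-refl ⟩
    X^-1 d *P geom d k *P X^ d +P X^-1 d          ≈⟨ lem (X^-1 d) (geom d k) (X^ d) ⟩
    X^-1 d *P (1P +P X^ d *P geom d k)            ∎
    where
    open ≋-Reasoning
    lem : ∀ P Q R → P *P Q *P R +P P ≋ P *P (1P +P R *P Q)
    lem = Ring.solve-∀ polyACR

  X^-1-mono : ∀ {d n} → d ℕD.∣ n → X^-1 d ∣ᴾ X^-1 n
  X^-1-mono {d} (ℕD.divides k refl) = divides (geom d k) (X^-1-geom d k)

  -- Modulo X^d - 1 each of the k summands is 1. The constant k is the nonzero integer on which all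
  -- later coprimality statements rest.
  geom-mod : ∀ d k → Σ Poly λ S → geom d k ≋ const (+ k) +P X^-1 d *P S
  geom-mod d zero    = [] , mk λ i → sym (trans (coeff-+P (const 0ℤ) (X^-1 d *P []) i)
    (cong₂ _+_ (at X-zero i) (at (*P-zeroʳ (X^-1 d)) i)))
  geom-mod d (suc k) with geom-mod d k
  ... | S , e = const (+ k) +P X^ d *P S , (begin
    1P +P X^ d *P geom d k                                ≈⟨ +P-cong (≋-refl {1P}) (*P-congʳ (X^ d) e) ⟩
    1P +P X^ d *P (const (+ k) +P X^-1 d *P S)            ≈⟨ lem (X^ d) (const (+ k)) S ⟩
    (1P +P const (+ k)) +P X^-1 d *P (const (+ k) +P X^ d *P S)  ∎)
    where
    open ≋-Reasoning
    lem : ∀ P Q R → 1P +P P *P (Q +P (P +P negP 1P) *P R) ≋ (1P +P Q) +P (P +P negP 1P) *P (Q +P P *P R)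
    lem = Ring.solve-∀ polyACR

  -- If g + y n = x m, then X^g - 1 = (X^(xm) - 1) - X^g (X^(yn) - 1), and the two brackets are
  -- multiples of X^m - 1 and X^n - 1; the other sign is symmetric.
  X^-1-bezout : ∀ m n → Σ Poly λ U → Σ Poly λ V → X^-1 (gcd m n) ≋ U *P X^-1 m +P V *P X^-1 n
  X^-1-bezout m n with Bézout.identity (GCD.gcd-GCD m n)
  ... | Bézout.+- x y eq = geom m x , negP (X^ gcd m n *P geom n y) , (begin
    X^-1 g                                                        ≈⟨ lem (X^-1 g) (X^ g) (X^-1 (y ℕ.* n)) ⟩
    (X^-1 (y ℕ.* n) *P X^ g +P X^-1 g) +P negP (X^ g *P X^-1 (y ℕ.* n))  ≈⟨ +P-cong
      (≋-sym (X^-1-+ (y ℕ.* n) g)) ≋-refl ⟩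
    X^-1 (y ℕ.* n ℕ.+ g) +P negP (X^ g *P X^-1 (y ℕ.* n))         ≡⟨ cong
      (λ k → X^-1 k +P negP (X^ g *P X^-1 (y ℕ.* n))) (trans (ℕP.+-comm (y ℕ.* n) g) eq) ⟩
    X^-1 (x ℕ.* m) +P negP (X^ g *P X^-1 (y ℕ.* n))               ≈⟨ +P-cong (X^-1-geom m x)
      (R.-‿cong (*P-congʳ (X^ g) (X^-1-geom n y))) ⟩
    X^-1 m *P geom m x +P negP (X^ g *P (X^-1 n *P geom n y))     ≈⟨ lem₂ (X^-1 m) (geom m x) (X^ g) (X^-1 n)
      (geom n y) ⟩
    geom m x *P X^-1 m +P negP (X^ g *P geom n y) *P X^-1 n       ∎)
    where
    open ≋-Reasoning
    g = gcd m n
    lem : ∀ P Q R → P ≋ (R *P Q +P P) +P negP (Q *P R)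
    lem = Ring.solve-∀ polyACR
    lem₂ : ∀ P Q R S T → P *P Q +P negP (R *P (S *P T)) ≋ Q *P P +P negP (R *P T) *P S
    lem₂ = Ring.solve-∀ polyACR
  ... | Bézout.-+ x y eq = negP (X^ gcd m n *P geom m x) , geom n y , (begin
    X^-1 g                                                        ≈⟨ lem (X^-1 g) (X^ g) (X^-1 (x ℕ.* m)) ⟩
    (X^-1 (x ℕ.* m) *P X^ g +P X^-1 g) +P negP (X^ g *P X^-1 (x ℕ.* m))  ≈⟨ +P-cong
      (≋-sym (X^-1-+ (x ℕ.* m) g)) ≋-refl ⟩
    X^-1 (x ℕ.* m ℕ.+ g) +P negP (X^ g *P X^-1 (x ℕ.* m))         ≡⟨ cong
      (λ k → X^-1 k +P negP (X^ g *P X^-1 (x ℕ.* m))) (trans (ℕP.+-comm (x ℕ.* m) g) eq) ⟩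
    X^-1 (y ℕ.* n) +P negP (X^ g *P X^-1 (x ℕ.* m))               ≈⟨ +P-cong (X^-1-geom n y)
      (R.-‿cong (*P-congʳ (X^ g) (X^-1-geom m x))) ⟩
    X^-1 n *P geom n y +P negP (X^ g *P (X^-1 m *P geom m x))     ≈⟨ lem₂ (X^-1 n) (geom n y) (X^ g) (X^-1 m)
      (geom m x) ⟩
    negP (X^ g *P geom m x) *P X^-1 m +P geom n y *P X^-1 n       ∎)
    where
    open ≋-Reasoning
    g = gcd m n
    lem : ∀ P Q R → P ≋ (R *P Q +P P) +P negP (Q *P R)
    lem = Ring.solve-∀ polyACR
    lem₂ : ∀ P Q R S T → P *P Q +P negP (R *P (S *P T)) ≋ negP (R *P T) *P S +P Q *P P
    lem₂ = Ring.solve-∀ polyACR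

  Bound-step : ∀ e P → Bound (suc e) P → coeff P e ≡ 0ℤ → Bound e P
  Bound-step e P b z i h with ℕP.m≤n⇒m<n∨m≡n h
  ... | inj₁ e<i  = b i e<i
  ... | inj₂ refl = z

  -- A monic `P` carries the top coefficient of `C` unchanged into the product, so this coefficient
  -- vanishes and the bound `e` drops.
  Monic-*P-zero : ∀ e {d P C} → Monic d P → Bound e C → P *P C ≋ [] → C ≋ []
  Monic-*P-zero zero mP bC z = Bound-zero bC
  Monic-*P-zero (suc e) {d} {P} {C} mP bC z = Monic-*P-zero e mP (Bound-step e C bC top) z
    where
    top : coeff C e ≡ 0ℤ
    top = trans (sym (trans (lead-*P d e P C (bound mP) bC)
      (trans (cong (_* coeff C e) (lead mP)) (ℤP.*-identityˡ _))))
      (at z (d ℕ.+ e))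

  ≋-from-difference : ∀ {A B} → A +P negP B ≋ [] → A ≋ B
  ≋-from-difference {A} {B} e = ≋-trans (lem A B) (+P-congʳ B e)
    where
    lem : ∀ A B → A ≋ (A +P negP B) +P B
    lem = Ring.solve-∀ polyACR

  Monic-cancel : ∀ {d P A B} → Monic d P → P *P A ≋ P *P B → A ≋ B
  Monic-cancel {d} {P} {A} {B} mP e with bounded (A +P negP B)
  ... | k , b = ≋-from-difference (Monic-*P-zero k mP b
    (≋-trans (lem P A B) (≋-trans (+P-congʳ (negP (P *P B)) e) (R.-‿inverseʳ (P *P B)))))
    where
    lem : ∀ P A B → P *P (A +P negP B) ≋ P *P A +P negP (P *P B)
    lem = Ring.solve-∀ polyACR

  coeff-const-*P : ∀ c P i → coeff (const c *P P) i ≡ c * coeff P i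
  coeff-const-*P c P i = trans (at (const-*P c P) i) (coeff-· c P i)

  coeff-X^ : ∀ n → coeff (X^ n) n ≡ 1ℤ
  coeff-X^ n = lead (X^-monic n)

  private
    -- In degree d + n the equation shows that the top coefficient of `H` is c g, where g is the
    -- coefficient of `F` in that degree. Subtracting g X^n `P` from `F` therefore removes this
    -- coefficient of `H`, and its bound drops.
    torsion-step : ∀ e {d P F H} c → c ≢ 0ℤ → Monic d P → const c *P F ≋ P *P H → Bound e H → P ∣ᴾ F
    torsion-step zero {P = P} {F = F} {H = H} c c≢0 mP e b = divides [] (≋-trans F≋[] (≋-sym (*P-zeroʳ P)))
      where
      F≋[] : F ≋ []
      F≋[] = mk λ i → ℤP.*-cancelˡ-≡ c (coeff F i) 0ℤ {{≢-nonZero c≢0}} (trans (sym (coeff-const-*P c F i))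
        (trans (at (≋-trans e (≋-trans (*P-congʳ P (Bound-zero {H} b)) (*P-zeroʳ P))) i) (sym (ℤP.*-zeroʳ c))))
    torsion-step (suc n) {d} {P} {F} {H} c c≢0 mP e b =
      ∣ᴾ-resp (restore F P (const g *P X^ n))
        (∣ᴾ-+ (torsion-step n {F = F +P negP (P *P (const g *P X^ n))}
          {H = H +P negP (const c *P (const g *P X^ n))}
            c c≢0 mP (≋-trans (lem (const c) F P (const g *P X^ n))
              (≋-trans (+P-congʳ (negP (const c *P (P *P (const g *P X^ n)))) e)
              (lem₂ (const c) H P (const g *P X^ n)))) b′)
          (divides (const g *P X^ n) ≋-refl))
      where
      g = coeff F (d ℕ.+ n)
      top : c * g ≡ coeff H n
      top = trans (sym (coeff-const-*P c F (d ℕ.+ n))) (trans (at e (d ℕ.+ n)) (trans (lead-*P d n P H (bound mP) b)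
        (trans (cong (_* coeff H n) (lead mP)) (ℤP.*-identityˡ _))))
      term : ∀ i → coeff (negP (const c *P (const g *P X^ n))) i ≡ - (c * g * coeff (X^ n) i)
      term i = trans (coeff-· -1ℤ (const c *P (const g *P X^ n)) i) (trans (ℤP.-1*i≡-i _)
        (cong -_ (trans (coeff-const-*P c (const g *P X^ n) i) (trans (cong (c *_) (coeff-const-*P g (X^ n) i))
          (sym (ℤP.*-assoc c g _))))))
      b′ : Bound n (H +P negP (const c *P (const g *P X^ n)))
      b′ = Bound-step n (H +P negP (const c *P (const g *P X^ n)))
        (λ i h → trans (coeff-+P H _ i) (cong₂ _+_ (b i h)
          (trans (term i) (cong -_ (trans (cong (c * g *_) (bound (X^-monic n) i h)) (ℤP.*-zeroʳ (c * g)))))))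
        (trans (coeff-+P H _ n) (trans (cong (_+_ (coeff H n))
          (trans (term n) (cong -_ (trans (cong (c * g *_) (coeff-X^ n)) (trans (ℤP.*-identityʳ _) top)))))
          (ℤP.+-inverseʳ (coeff H n))))
      lem : ∀ C F P M → C *P (F +P negP (P *P M)) ≋ C *P F +P negP (C *P (P *P M))
      lem = Ring.solve-∀ polyACR
      lem₂ : ∀ C H P M → P *P H +P negP (C *P (P *P M)) ≋ P *P (H +P negP (C *P M))
      lem₂ = Ring.solve-∀ polyACR
      restore : ∀ F P M → (F +P negP (P *P M)) +P P *P M ≋ F
      restore = Ring.solve-∀ polyACR

  -- Z[X]/(P) is torsion free for monic P.
  torsion : ∀ {d P F} c → c ≢ 0ℤ → Monic d P → P ∣ᴾ const c *P F → P ∣ᴾ F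
  torsion c c≢0 mP (divides H e) = torsion-step (proj₁ (bounded H)) c c≢0 mP e (proj₂ (bounded H))

  -- Coprimality over ℚ, with denominators cleared.
  record Coprimeᴾ (P Q : Poly) : Set where
    constructor coprime
    field
      U V     : Poly
      c       : ℤ
      c≢0     : c ≢ 0ℤ
      bezout  : const c ≋ U *P P +P V *P Q

  Coprimeᴾ-sym : ∀ {P Q} → Coprimeᴾ P Q → Coprimeᴾ Q P
  Coprimeᴾ-sym {P} {Q} (coprime U V c c≢0 e) = coprime V U c c≢0 (≋-trans e (+P-comm (U *P P) (V *P Q)))

  -- The Bézout identity times `F` shows that `Q` divides c `F`; `torsion` removes the integer c.
  Coprimeᴾ-cancel : ∀ {d P Q F} → Monic d Q → Coprimeᴾ P Q → Q ∣ᴾ P *P F → Q ∣ᴾ F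
  Coprimeᴾ-cancel {d} {P} {Q} {F} mQ (coprime U V c c≢0 e) q = torsion c c≢0 mQ
    (∣ᴾ-resp (≋-trans (lem U P V Q F) (*P-congˡ F (≋-sym e))) (∣ᴾ-+ (∣ᴾ-*ˡ U q) (∣ᴾ-*ʳ (V *P F) ∣ᴾ-refl)))
    where
    lem : ∀ U P V Q F → U *P (P *P F) +P Q *P (V *P F) ≋ (U *P P +P V *P Q) *P F
    lem = Ring.solve-∀ polyACR

  ∏ : List Poly → Poly
  ∏ = foldr _*P_ 1P

  ∏-cancel : ∀ {d Q F} Ps → Monic d Q → All (λ P → Coprimeᴾ P Q) Ps → Q ∣ᴾ ∏ Ps *P F → Q ∣ᴾ F
  ∏-cancel []       mQ []       q = ∣ᴾ-resp (*P-identityˡ _) q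
  ∏-cancel {F = F} (P ∷ Ps) mQ (c ∷ cs) q =
    ∏-cancel Ps mQ cs (Coprimeᴾ-cancel mQ c (∣ᴾ-resp (*P-assoc P (∏ Ps) F) q))

  ∏-∣ : ∀ {F} Ps → All (λ P → Σ ℕ λ d → Monic d P) Ps → AllPairs Coprimeᴾ Ps → All (_∣ᴾ F) Ps → ∏ Ps ∣ᴾ F
  ∏-∣ {F} [] [] [] [] = divides F (≋-sym (*P-identityˡ F))
  ∏-∣ {F} (P ∷ Ps) ((d , m) ∷ ms) (c ∷ cs) (p ∷ ps) with ∏-∣ Ps ms cs ps
  ... | divides G e with ∏-cancel {F = G} Ps m (All.map Coprimeᴾ-sym c) (∣ᴾ-resp e p)
  ... | divides H f = divides H (≋-trans e (≋-trans (*P-congʳ (∏ Ps) f) (lem (∏ Ps) P H)))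
    where
    lem : ∀ A B C → A *P (B *P C) ≋ B *P A *P C
    lem = Ring.solve-∀ polyACR

  ∏-monic : ∀ Ps → All (λ P → Σ ℕ λ d → Monic d P) Ps → Σ ℕ λ d → Monic d (∏ Ps)
  ∏-monic []       []             = 0 , Monic-1
  ∏-monic (P ∷ Ps) ((d , m) ∷ ms) = _ , Monic-*P m (proj₂ (∏-monic Ps ms))

  -- Exactness of divMonic

  snoc : ∀ P c → P ++ c ∷ [] ≋ P +P const c *P X^ (length P)
  snoc []      c = ∷-cong (sym (trans (ℤP.+-identityʳ _) (ℤP.*-identityʳ c))) ≋-refl
  snoc (d ∷ P) c = ≋-trans (∷-cong (sym (ℤP.+-identityʳ d)) (snoc P c))
    (+P-cong (≋-refl {d ∷ P}) (lem (X^ length P)))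
    where
    lem : ∀ Q → X· (const c *P Q) ≋ const c *P (X· Q)
    lem Q = ≋-trans (≋-sym (X-*P (const c) Q))
      (≋-trans (*P-comm (X· const c) Q) (≋-trans (≋-sym (mid Q)) (*P-comm (X· Q) (const c))))
      where
      mid : ∀ Q → (X· Q) *P const c ≋ Q *P (X· const c)
      mid Q = ≋-trans (X-*P Q (const c)) (≋-trans (X-cong (*P-comm Q (const c)))
        (≋-trans (≋-sym (X-*P (const c) Q)) (*P-comm (X· const c) Q)))

  reverse-∷ : ∀ c P → reverse (c ∷ P) ≋ reverse P +P const c *P X^ (length P)
  reverse-∷ c P = ≋-trans (R.reflexive (unfold-reverse c P))
    (≋-trans (snoc (reverse P) c) (R.reflexive (cong (λ k → reverse P +P const c *P X^ k) (length-reverse P))))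

  reverse-addFront : ∀ k xs ys → length xs ≡ k ℕ.+ length ys →
    reverse (addFront xs ys) ≋ reverse xs +P X^ k *P reverse ys
  reverse-addFront k xs [] h = ≋-sym (≋-trans (+P-congˡ (reverse xs) (*P-zeroʳ (X^ k))) (+P-identityʳ (reverse xs)))
  reverse-addFront k [] (y ∷ ys) h = ⊥-elim (ℕP.0≢1+n (trans h (ℕP.+-suc k (length ys))))
  reverse-addFront k (x ∷ xs) (y ∷ ys) h = begin
    reverse ((x + y) ∷ addFront xs ys)
      ≈⟨ reverse-∷ (x + y) (addFront xs ys) ⟩
    reverse (addFront xs ys) +P (const x +P const y) *P X^ (length (addFront xs ys))
      ≈⟨ +P-cong (reverse-addFront k xs ys h′)
        (*P-congʳ (const x +P const y) (≋-trans (R.reflexive (cong X^_ (trans len h′))) (X^-+ k (length ys)))) ⟩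
    (reverse xs +P X^ k *P reverse ys) +P (const x +P const y) *P (X^ k *P X^ (length ys))
      ≈⟨ lem (reverse xs) (X^ k) (reverse ys) (const x) (const y) (X^ (length ys)) ⟩
    (reverse xs +P const x *P (X^ k *P X^ (length ys))) +P X^ k *P (reverse ys +P const y *P X^ (length ys))
      ≈⟨ +P-cong (+P-congˡ (reverse xs)
        (*P-congʳ (const x) (≋-trans (≋-sym (X^-+ k (length ys))) (R.reflexive (cong X^_ (sym h′))))))
        (*P-congʳ (X^ k) (≋-sym (reverse-∷ y ys))) ⟩
    (reverse xs +P const x *P X^ (length xs)) +P X^ k *P reverse (y ∷ ys)
      ≈⟨ +P-congʳ (X^ k *P reverse (y ∷ ys)) (≋-sym (reverse-∷ x xs)) ⟩
    reverse (x ∷ xs) +P X^ k *P reverse (y ∷ ys) ∎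
    where
    open ≋-Reasoning
    h′ : length xs ≡ k ℕ.+ length ys
    h′ = ℕP.suc-injective (trans h (ℕP.+-suc k (length ys)))
    len : length (addFront xs ys) ≡ length xs
    len = length-addFront xs ys (subst (length ys ℕ.≤_) (sym h′) (ℕP.m≤n+m _ k))
    lem : ∀ A K B x y L → (A +P K *P B) +P (x +P y) *P (K *P L) ≋ (A +P x *P (K *P L)) +P K *P (B +P y *P L)
    lem = Ring.solve-∀ polyACR

  reverse-· : ∀ c P → reverse (map (c *_) P) ≋ const c *P reverse P
  reverse-· c P = ≋-trans (R.reflexive (sym (reverse-map (c *_) P))) (≋-sym (const-*P c (reverse P)))

  -- Links the list product used in the division lemmas to the product of polynomials.
  reverse-mulD : ∀ q bt → reverse (mulD q bt) ≋ reverse q *P reverse (1ℤ ∷ bt)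
  reverse-mulD [] bt = go (length bt)
    where
    go : ∀ n → reverse (replicate n 0ℤ) ≋ []
    go zero    = ≋-refl
    go (suc n) = ≋-trans (reverse-∷ 0ℤ (replicate n 0ℤ))
      (+P-cong (go n) (≋-trans (const-*P 0ℤ (X^ length (replicate n 0ℤ))) (0· (X^ length (replicate n 0ℤ)))))
  reverse-mulD (c ∷ q) bt = begin
    reverse (c ∷ addFront (mulD q bt) (map (c *_) bt))
      ≈⟨ reverse-∷ c (addFront (mulD q bt) (map (c *_) bt)) ⟩
    reverse (addFront (mulD q bt) (map (c *_) bt)) +P const c *P X^ (length (addFront (mulD q bt) (map (c *_) bt)))
      ≈⟨ +P-cong (≋-trans (reverse-addFront (length q) (mulD q bt) (map (c *_) bt) len)
                   (+P-cong (reverse-mulD q bt) (*P-congʳ (X^ (length q)) (reverse-· c bt))))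
          (*P-congʳ (const c) (≋-trans (R.reflexive (cong X^_ len′)) (X^-+ (length q) (length bt)))) ⟩
    (reverse q *P reverse (1ℤ ∷ bt) +P X^ (length q) *P (const c *P reverse bt)) +P const c *P
      (X^ (length q) *P X^ (length bt))
      ≈⟨ lem (reverse q *P reverse (1ℤ ∷ bt)) (X^ (length q)) (const c) (reverse bt) (X^ (length bt)) ⟩
    reverse q *P reverse (1ℤ ∷ bt) +P const c *P X^ (length q) *P (reverse bt +P 1P *P X^ (length bt))
      ≈⟨ +P-congˡ (reverse q *P reverse (1ℤ ∷ bt)) (*P-congʳ (const c *P X^ (length q)) (≋-sym (reverse-∷ 1ℤ bt))) ⟩
    reverse q *P reverse (1ℤ ∷ bt) +P const c *P X^ (length q) *P reverse (1ℤ ∷ bt)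
      ≈⟨ ≋-sym (*P-distribʳ (reverse (1ℤ ∷ bt)) (reverse q) (const c *P X^ (length q))) ⟩
    (reverse q +P const c *P X^ (length q)) *P reverse (1ℤ ∷ bt)
      ≈⟨ *P-congˡ (reverse (1ℤ ∷ bt)) (≋-sym (reverse-∷ c q)) ⟩
    reverse (c ∷ q) *P reverse (1ℤ ∷ bt) ∎
    where
    open ≋-Reasoning
    len : length (mulD q bt) ≡ length q ℕ.+ length (map (c *_) bt)
    len = trans (length-mulD q bt) (cong (length q ℕ.+_) (sym (length-map (c *_) bt)))
    len′ : length (addFront (mulD q bt) (map (c *_) bt)) ≡ length q ℕ.+ length bt
    len′ = ℕP.suc-injective (length-mulD (c ∷ q) bt)
    lem : ∀ A L C B K → (A +P L *P (C *P B)) +P C *P (L *P K) ≋ A +P C *P L *P (B +P 1P *P K)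
    lem = Ring.solve-∀ polyACR

  data Stripped : List ℤ → Set where
    nil  : Stripped []
    lead≢0 : ∀ {c cs} → c ≢ 0ℤ → Stripped (c ∷ cs)

  strip-stripped : ∀ xs → Stripped (strip xs)
  strip-stripped []              = nil
  strip-stripped (+ 0 ∷ cs)      = strip-stripped cs
  strip-stripped (+[1+ k ] ∷ cs) = lead≢0 λ ()
  strip-stripped (-[1+ k ] ∷ cs) = lead≢0 λ ()

  reverse-strip : ∀ xs → reverse (strip xs) ≋ reverse xs
  reverse-strip []              = ≋-refl
  reverse-strip (+ 0 ∷ cs)      = ≋-trans (reverse-strip cs) (≋-sym (≋-trans (reverse-∷ 0ℤ cs)
    (≋-trans (+P-congˡ (reverse cs) (≋-trans (const-*P 0ℤ (X^ length cs)) (0· (X^ length cs))))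
      (+P-identityʳ (reverse cs)))))
  reverse-strip (+[1+ k ] ∷ cs) = ≋-refl
  reverse-strip (-[1+ k ] ∷ cs) = ≋-refl

  Bound-length : ∀ P → Bound (length P) P
  Bound-length []      i       h       = refl
  Bound-length (c ∷ P) (suc i) (s≤s h) = Bound-length P i h

  reverse-bound : ∀ P → Bound (length P) (reverse P)
  reverse-bound P i h = Bound-length (reverse P) i (subst (ℕ._≤ i) (sym (length-reverse P)) h)

  reverse-lead : ∀ c P → coeff (reverse (c ∷ P)) (length P) ≡ c
  reverse-lead c P = trans (at (reverse-∷ c P) (length P)) (trans (coeff-+P (reverse P) _ (length P))
    (trans (cong₂ _+_ (reverse-bound P (length P) ℕP.≤-refl)
        (trans (coeff-const-*P c (X^ length P) (length P))
          (trans (cong (c *_) (coeff-X^ (length P))) (ℤP.*-identityʳ c))))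
      (ℤP.+-identityˡ c)))

  ≋⇒≡ : ∀ P Q → length P ≡ length Q → P ≋ Q → P ≡ Q
  ≋⇒≡ []      []      h e = refl
  ≋⇒≡ (c ∷ P) (d ∷ Q) h e = cong₂ _∷_ (at e 0) (≋⇒≡ P Q (ℕP.suc-injective h) (mk λ i → at e (suc i)))

  -- The head of a stripped list is the nonzero coefficient of highest degree, so equal polynomials
  -- force equal lengths.
  stripped-unique : ∀ {xs ys} → Stripped xs → Stripped ys → reverse xs ≋ reverse ys → xs ≡ ys
  stripped-unique {xs} {ys} sx sy e = reverse-injective
    (≋⇒≡ (reverse xs) (reverse ys) (trans (length-reverse xs) (trans len (sym (length-reverse ys)))) e)
    where
    longer : ∀ xs ys → Stripped xs → reverse xs ≋ reverse ys → length xs ℕ.≤ length ys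
    longer [] ys nil _ = z≤n
    longer (c ∷ xs) ys (lead≢0 c≢0) e = ℕP.≮⇒≥ λ { (s≤s h) →
      c≢0 (trans (sym (reverse-lead c xs)) (trans (at e (length xs)) (reverse-bound ys (length xs) h))) }
    len : length xs ≡ length ys
    len = ℕP.≤-antisym (longer xs ys sx e) (longer ys xs sy (≋-sym e))

  monic-strip : ∀ {d b} → Monic d b → Σ (List ℤ) λ bt → strip (reverse b) ≡ 1ℤ ∷ bt × reverse (1ℤ ∷ bt) ≋ b
  monic-strip {d} {b} (monic l bd) = go (strip (reverse b)) refl (strip-stripped (reverse b))
    (≋-trans (reverse-strip (reverse b)) (R.reflexive (reverse-involutive b)))
    where
    go : ∀ xs → strip (reverse b) ≡ xs → Stripped xs → reverse xs ≋ b →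
      Σ (List ℤ) λ bt → strip (reverse b) ≡ 1ℤ ∷ bt × reverse (1ℤ ∷ bt) ≋ b
    go [] _ nil e with trans (sym l) (sym (at e d))
    ... | ()
    go (c ∷ cs) h (lead≢0 c≢0) e = cs , trans h (cong (_∷ cs) c≡1) , subst (λ x → reverse (x ∷ cs) ≋ b) c≡1 e
      where
      top : coeff b (length cs) ≡ c
      top = trans (sym (at e (length cs))) (reverse-lead c cs)
      d≤ : d ℕ.≤ length cs
      d≤ = ℕP.≮⇒≥ λ h → 1≢0 (trans (sym l) (trans (sym (at e d)) (reverse-bound (c ∷ cs) d h)))
      ≤d : length cs ℕ.≤ d
      ≤d = ℕP.≮⇒≥ λ h → c≢0 (trans (sym top) (bd (length cs) h))
      c≡1 : c ≡ 1ℤ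
      c≡1 = trans (sym top) (trans (cong (coeff b) (ℕP.≤-antisym ≤d d≤)) l)

  strip-singleton : ∀ c → c ≢ 0ℤ → strip (c ∷ []) ≡ c ∷ []
  strip-singleton (+ 0)    c≢0 = ⊥-elim (c≢0 refl)
  strip-singleton +[1+ _ ] _   = refl
  strip-singleton -[1+ _ ] _   = refl

  divMonic-*P : ∀ {d a b Q} → Monic d b → ¬ (a ≋ []) → a ≋ b *P Q → divMonic a b ≋ Q
  divMonic-*P {d} {a} {b} {Q} mb a≢0 e with monic-strip mb
  ... | bt , eb , rb = go (strip (reverse Q)) (strip-stripped (reverse Q))
      (≋-trans (reverse-strip (reverse Q)) (R.reflexive (reverse-involutive Q)))
    where
    go : ∀ q → Stripped q → reverse q ≋ Q → divMonic a b ≋ Q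
    go [] nil f = ⊥-elim (a≢0 (≋-trans e (≋-trans (*P-congʳ b (≋-sym f)) (*P-zeroʳ b))))
    go (c ∷ q) (lead≢0 c≢0) f = ≋-trans (R.reflexive (divMonic-exact a b bt c q eb
        (stripped-unique (strip-stripped (reverse a)) (lead≢0 c≢0)
          (≋-trans (reverse-strip (reverse a)) (≋-trans (R.reflexive (reverse-involutive a))
            (≋-trans e (≋-trans (*P-comm b Q)
              (≋-sym (≋-trans (reverse-mulD (c ∷ q) bt)
              (≋-trans (*P-congˡ (reverse (1ℤ ∷ bt)) f) (*P-congʳ Q rb)))))))))
        (strip-singleton c c≢0))) f

  -- Cyclotomic polynomials

  ∈-properDivisors⁻ : ∀ {n d} → d ∈ properDivisors n → d ∣ n × 1 ℕ.≤ d × d ℕ.< n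
  ∈-properDivisors⁻ {n} {d} m with ∈-filter⁻ (λ d → d ℕD.∣? n) {xs = filter (λ d → 1 ℕP.≤? d) (upTo n)} m
  ... | m′ , d∣n with ∈-filter⁻ (λ d → 1 ℕP.≤? d) {xs = upTo n} m′
  ... | m″ , 1≤d = d∣n , 1≤d , ∈-upTo⁻ m″

  ∈-properDivisors⁺ : ∀ {n d} → d ∣ n → 1 ℕ.≤ d → d ℕ.< n → d ∈ properDivisors n
  ∈-properDivisors⁺ {n} d∣n 1≤d d<n =
    ∈-filter⁺ (λ d → d ℕD.∣? n) (∈-filter⁺ (λ d → 1 ℕP.≤? d) (∈-upTo⁺ d<n) 1≤d) d∣n

  properDivisors-unique : ∀ n → Unique (properDivisors n)
  properDivisors-unique n = UniqueP.filter⁺ (λ d → d ℕD.∣? n) (UniqueP.filter⁺ (λ d → 1 ℕP.≤? d) (UniqueP.upTo⁺ n))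

  AllPairs-map : ∀ {a b p r s} {A : Set a} {B : Set b} {P : A → Set p} {R : A → A → Set r} {S : B → B → Set s}
    {f : A → B} →
    (∀ {x y} → P x → P y → R x y → S (f x) (f y)) → ∀ {xs} → All P xs → AllPairs R xs → AllPairs S (map f xs)
  AllPairs-map g []       []       = []
  AllPairs-map g (p ∷ ps) (r ∷ rs) =
    AllP.map⁺ (All.map (λ (q , r) → g p q r) (All.zip (ps , r))) ∷ AllPairs-map g ps rs

  -- The recursion visits proper divisors only, and these decrease at least as fast as the fuel.
  cycF-fuel : ∀ n f → 1 ℕ.≤ n → n ℕ.≤ f → cycF f n ≡ Φ n
  cycF-fuel = <-rec _ go
    where
    go : ∀ n → (∀ {m} → m ℕ.< n → ∀ f → 1 ℕ.≤ m → m ℕ.≤ f → cycF f m ≡ Φ m) →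
      ∀ f → 1 ℕ.≤ n → n ℕ.≤ f → cycF f n ≡ Φ n
    go (suc n) rec (suc f) _ (s≤s n≤f) = cong (λ l → divMonic (xn-1 (suc n)) (∏ l))
      (map-cong-local (All.tabulate λ {d} m → let (_ , 1≤d , d<n) = ∈-properDivisors⁻ m in
        trans (rec d<n f 1≤d (ℕP.≤-trans (ℕP.≤-pred d<n) n≤f)) (sym (rec d<n n 1≤d (ℕP.≤-pred d<n)))))

  Φ-unfold : ∀ n → Φ (suc n) ≡ divMonic (xn-1 (suc n)) (∏ (map Φ (properDivisors (suc n))))
  Φ-unfold n = cong (λ l → divMonic (xn-1 (suc n)) (∏ l))
    (map-cong-local (All.tabulate λ {d} m → let (_ , 1≤d , d<n) = ∈-properDivisors⁻ m in cycF-fuel d n 1≤d (ℕP.≤-pred d<n)))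

  -- Descent on a degree bound for `Q`: since `P` is monic, the coefficient of the product in degree
  -- d + e is that of `Q` in degree e. Above degree b it is zero and the bound drops; in degree b it
  -- is 1.
  quotient-monic : ∀ k {d b P Q} → Monic d P → Monic b (P *P Q) → Bound k Q → Σ ℕ λ e → Monic e Q
  quotient-monic zero {d} {b} {P} {Q} mP (monic l _) bQ =
    ⊥-elim (1≢0 (trans (sym l) (at (≋-trans (*P-congʳ P (Bound-zero {Q} bQ)) (*P-zeroʳ P)) b)))
  quotient-monic (suc e) {d} {b} {P} {Q} mP (monic l bd) bQ with ℕP.<-cmp (d ℕ.+ e) b
    | trans (lead-*P d e P Q (bound mP) bQ) (trans (cong (_* coeff Q e) (lead mP)) (ℤP.*-identityˡ _))
  ... | tri< h _ _ | _ = ⊥-elim (1≢0 (trans (sym l) (Bound-*P (suc d) e P Q (bound mP) bQ b h)))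
  ... | tri≈ _ refl _ | t = e , monic (trans (sym t) l) bQ
  ... | tri> _ _ h | t = quotient-monic e mP (monic l bd) (Bound-step e Q bQ (trans (sym t) (bd (d ℕ.+ e) h)))

  -- What the strong induction on n carries along. `Φ∣geom` stands for the primitivity of the roots:
  -- `Φ n` divides (X^n - 1)/(X^g - 1) for every proper divisor g of n.
  record Cyclotomic (n : ℕ) : Set where
    field
      degree   : ℕ
      Φ-monic  : Monic degree (Φ n)
      formula  : X^-1 n ≋ ∏ (map Φ (properDivisors n)) *P Φ n
      Φ∣geom   : ∀ g k → 1 ℕ.≤ g → n ≡ k ℕ.* g → g ℕ.< n → Φ n ∣ᴾ geom g k

    Φ∣X^-1 : Φ n ∣ᴾ X^-1 n
    Φ∣X^-1 = ∣ᴾ-resp (≋-sym formula) (∣ᴾ-*ˡ (∏ (map Φ (properDivisors n))) ∣ᴾ-refl)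
  open Cyclotomic

  -- With g = gcd d e < d, Φ d divides geom g (d / g) ≡ d / g modulo X^g - 1, and X^g - 1 lies
  -- in the ideal generated by X^d - 1 and X^e - 1.
  Φ-coprime-gcd : ∀ {d e} → Cyclotomic d → Cyclotomic e → 1 ℕ.≤ d → gcd d e ≢ d → Coprimeᴾ (Φ d) (Φ e)
  Φ-coprime-gcd {d} {e} cd ce 1≤d g≢d with gcd[m,n]∣m d e
  ... | ℕD.divides k eq = coprime (Gd −ᴾ SU) (negP SV) (+ k) k≢0 (begin
      const (+ k)                                       ≈⟨ lem₁ (const (+ k)) (X^-1 g) S ⟩
      (const (+ k) +P X^-1 g *P S) +P negP (X^-1 g *P S) ≈⟨ +P-cong (≋-trans (≋-sym geom≋) (equality geom∣))
                                                             (R.-‿cong (*P-congˡ S bez)) ⟩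
      Φ d *P quotient geom∣ +P negP ((U *P X^-1 d +P V *P X^-1 e) *P S)
        ≈⟨ +P-congˡ (Φ d *P quotient geom∣)
          (R.-‿cong (*P-congˡ S (+P-cong (*P-congʳ U (equality (Φ∣X^-1 cd)))
          (*P-congʳ V (equality (Φ∣X^-1 ce)))))) ⟩
      Φ d *P quotient geom∣ +P negP ((U *P (Φ d *P W) +P V *P (Φ e *P W′)) *P S)
        ≈⟨ lem₂ (Φ d) (quotient geom∣) U W V (Φ e) W′ S ⟩
      (quotient geom∣ +P negP (U *P W *P S)) *P Φ d +P negP (V *P W′ *P S) *P Φ e ∎)
    where
    open ≋-Reasoning
    g = gcd d e
    g≥1 : 1 ℕ.≤ g
    g≥1 = ℕP.n≢0⇒n>0 (gcd[m,n]≢0 d e (inj₁ (ℕP.m<n⇒n≢0 1≤d)))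
    g<d : g ℕ.< d
    g<d = ℕP.≤∧≢⇒< (ℕD.∣⇒≤ {{ℕ.>-nonZero 1≤d}} (gcd[m,n]∣m d e)) g≢d
    k≢0 : + k ≢ 0ℤ
    k≢0 refl = ℕP.m<n⇒n≢0 1≤d eq
    S = proj₁ (geom-mod g k)
    geom≋ = proj₂ (geom-mod g k)
    U = proj₁ (X^-1-bezout d e)
    V = proj₁ (proj₂ (X^-1-bezout d e))
    bez = proj₂ (proj₂ (X^-1-bezout d e))
    geom∣ = Φ∣geom cd g k g≥1 eq g<d
    W = quotient (Φ∣X^-1 cd)
    W′ = quotient (Φ∣X^-1 ce)
    Gd = quotient geom∣
    SU = U *P W *P S
    SV = V *P W′ *P S
    _−ᴾ_ : Poly → Poly → Poly
    P −ᴾ Q = P +P negP Q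
    lem₁ : ∀ C X S → C ≋ (C +P X *P S) +P negP (X *P S)
    lem₁ = Ring.solve-∀ polyACR
    lem₂ : ∀ F G U W V E W′ S → F *P G +P negP ((U *P (F *P W) +P V *P (E *P W′)) *P S) ≋
      (G +P negP (U *P W *P S)) *P F +P negP (V *P W′ *P S) *P E
    lem₂ = Ring.solve-∀ polyACR

  Φ-coprime : ∀ {d e} → Cyclotomic d → Cyclotomic e → 1 ℕ.≤ d → 1 ℕ.≤ e → d ≢ e → Coprimeᴾ (Φ d) (Φ e)
  Φ-coprime {d} {e} cd ce 1≤d 1≤e d≢e with gcd d e ℕP.≟ d
  ... | no g≢d = Φ-coprime-gcd cd ce 1≤d g≢d
  ... | yes g≡d = Coprimeᴾ-sym (Φ-coprime-gcd ce cd 1≤e λ g′≡e →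
      d≢e (trans (sym g≡d) (trans (gcd-comm d e) g′≡e)))

  ∏-Φ-∣ : ∀ {F} ds → Unique ds → All (λ d → Cyclotomic d × 1 ℕ.≤ d × Φ d ∣ᴾ F) ds → ∏ (map Φ ds) ∣ᴾ F
  ∏-Φ-∣ ds u cs = ∏-∣ (map Φ ds) (AllP.map⁺ (All.map (λ (c , _) → degree c , Φ-monic c) cs))
    (AllPairs-map (λ (c , p , _) (c′ , p′ , _) d≢e → Φ-coprime c c′ p p′ d≢e) cs u)
    (AllP.map⁺ (All.map (proj₂ ∘ proj₂) cs))

  -- X^n - 1 is a product of pairwise coprime monic factors. The hypothesis `cyc` is limited to the
  -- divisors of n, so that the lemma is available inside the induction that proves `cyclotomic`.
  X^-1-∣ : ∀ {F} n → 1 ℕ.≤ n → (∀ d → d ∣ n → 1 ℕ.≤ d → Cyclotomic d) →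
    (∀ d → d ∣ n → 1 ℕ.≤ d → Φ d ∣ᴾ F) → X^-1 n ∣ᴾ F
  X^-1-∣ {F} n 1≤n cyc h = ∣ᴾ-respˡ
    (≋-trans (*P-comm (Φ n) (∏ (map Φ (properDivisors n)))) (≋-sym (formula (cyc n ℕD.∣-refl 1≤n))))
    (∏-Φ-∣ (n ∷ properDivisors n)
      (All.tabulate (λ m → ℕP.>⇒≢ (proj₂ (proj₂ (∈-properDivisors⁻ m)))) ∷ properDivisors-unique n)
      ((cyc n ℕD.∣-refl 1≤n , 1≤n , h n ℕD.∣-refl 1≤n) ∷
        All.tabulate λ {d} m → let (d∣n , 1≤d , _) = ∈-properDivisors⁻ m in cyc d d∣n 1≤d , 1≤d , h d d∣n 1≤d))

  ∈⇒∣∏ : ∀ {P} Ps → P ∈ Ps → P ∣ᴾ ∏ Ps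
  ∈⇒∣∏ (P ∷ Ps) (here refl) = ∣ᴾ-*ʳ (∏ Ps) ∣ᴾ-refl
  ∈⇒∣∏ (P ∷ Ps) (there m)   = ∣ᴾ-*ˡ P (∈⇒∣∏ Ps m)

  cyclotomic : ∀ n → 1 ℕ.≤ n → Cyclotomic n
  cyclotomic = <-rec _ go
    where
    go : ∀ n → (∀ {m} → m ℕ.< n → 1 ℕ.≤ m → Cyclotomic m) → 1 ℕ.≤ n → Cyclotomic n
    go (suc n) rec _ = record { degree = proj₁ Φmon ; Φ-monic = proj₂ Φmon ; formula = form ; Φ∣geom = geo }
      where
      N = suc n
      L = map Φ (properDivisors N)
      cyc : ∀ {d} → d ∈ properDivisors N → Cyclotomic d
      cyc m = let (_ , 1≤d , d<n) = ∈-properDivisors⁻ {N} m in rec d<n 1≤d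
      L∣ : ∏ L ∣ᴾ X^-1 N
      L∣ = ∏-Φ-∣ (properDivisors N) (properDivisors-unique N) (All.tabulate λ m →
        let (d∣n , 1≤d , _) = ∈-properDivisors⁻ {N} m in cyc m , 1≤d , ∣ᴾ-trans (Φ∣X^-1 (cyc m)) (X^-1-mono {n = N} d∣n))
      L-monic : Σ ℕ λ d → Monic d (∏ L)
      L-monic = ∏-monic L (AllP.map⁺ (All.tabulate λ m → degree (cyc m) , Φ-monic (cyc m)))
      X≢0 : ¬ (xn-1 N ≋ [])
      X≢0 e with at e 0
      ... | ()
      Φ≋ : Φ N ≋ quotient L∣
      Φ≋ = ≋-trans (R.reflexive (Φ-unfold n)) (divMonic-*P (proj₂ L-monic) X≢0 (≋-trans (xn-1≋ N) (equality L∣)))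
      form : X^-1 N ≋ ∏ L *P Φ N
      form = ≋-trans (equality L∣) (*P-congʳ (∏ L) (≋-sym Φ≋))
      Φmon : Σ ℕ λ d → Monic d (Φ N)
      Φmon = quotient-monic (proj₁ (bounded (Φ N))) (proj₂ L-monic) (Monic-resp form (X^-1-monic n))
        (proj₂ (bounded (Φ N)))
      -- The divisors of g are proper divisors of `N`, hence X^g - 1 divides the product `∏ L`;
      -- cancelling X^g - 1 from both factorisations of X^N - 1 leaves `geom g k` as a multiple of
      -- `Φ N`.
      geo : ∀ g k → 1 ℕ.≤ g → N ≡ k ℕ.* g → g ℕ.< N → Φ N ∣ᴾ geom g k
      geo (suc g) k _ eq g<N = divides (quotient g∣) (Monic-cancel (X^-1-monic g) (begin
          X^-1 (suc g) *P geom (suc g) k              ≈⟨ ≋-sym (X^-1-geom (suc g) k) ⟩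
          X^-1 (k ℕ.* suc g)                          ≡⟨ cong X^-1 (sym eq) ⟩
          X^-1 N                                      ≈⟨ form ⟩
          ∏ L *P Φ N                                  ≈⟨ *P-congˡ (Φ N) (equality g∣) ⟩
          X^-1 (suc g) *P quotient g∣ *P Φ N          ≈⟨ lem (X^-1 (suc g)) (quotient g∣) (Φ N) ⟩
          X^-1 (suc g) *P (Φ N *P quotient g∣)        ∎))
        where
        open ≋-Reasoning
        lem : ∀ A B C → A *P B *P C ≋ A *P (C *P B)
        lem = Ring.solve-∀ polyACR
        below : ∀ {d} → d ∣ suc g → d ℕ.< N
        below d∣g = ℕP.≤-<-trans (ℕD.∣⇒≤ d∣g) g<N
        g∣ : X^-1 (suc g) ∣ᴾ ∏ L
        g∣ = X^-1-∣ (suc g) (s≤s z≤n) (λ d d∣g 1≤d → rec (below d∣g) 1≤d)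
          (λ d d∣g 1≤d → ∈⇒∣∏ L (∈-map⁺ Φ (∈-properDivisors⁺ (ℕD.∣-trans d∣g (ℕD.divides k eq)) 1≤d (below d∣g))))

  -- Φ n is a factor of geom d k whose value modulo X^d - 1 is the integer k.
  Φ-cancel-X^-1 : ∀ {n d F} → 1 ℕ.≤ n → ¬ (n ∣ d) → Φ n ∣ᴾ X^-1 d *P F → Φ n ∣ᴾ F
  Φ-cancel-X^-1 {n} {d} {F} 1≤n n∤d h with gcd[m,n]∣m n d
  ... | ℕD.divides k eq = torsion (+ k) k≢0 (Φ-monic cn) (∣ᴾ-resp (begin
      geom g k *P F +P negP (S *P (U *P (X^-1 n *P F) +P V *P (X^-1 d *P F)))
        ≈⟨ lem₁ (geom g k) F S U (X^-1 n) V (X^-1 d) ⟩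
      (geom g k +P negP ((U *P X^-1 n +P V *P X^-1 d) *P S)) *P F
        ≈⟨ *P-congˡ F (+P-cong geom≋ (R.-‿cong (*P-congˡ S (≋-sym bez)))) ⟩
      ((const (+ k) +P X^-1 g *P S) +P negP (X^-1 g *P S)) *P F
        ≈⟨ lem₂ (const (+ k)) (X^-1 g) S F ⟩
      const (+ k) *P F ∎)
    (∣ᴾ-+ (∣ᴾ-*ʳ F (Φ∣geom cn g k g≥1 eq g<n))
      (∣ᴾ-resp (neg-* (S *P (U *P (X^-1 n *P F) +P V *P (X^-1 d *P F))))
        (∣ᴾ-*ˡ (negP 1P) (∣ᴾ-*ˡ S (∣ᴾ-+ (∣ᴾ-*ˡ U (∣ᴾ-*ʳ F (Φ∣X^-1 cn))) (∣ᴾ-*ˡ V h)))))))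
    where
    open ≋-Reasoning
    cn = cyclotomic n 1≤n
    g = gcd n d
    g≥1 : 1 ℕ.≤ g
    g≥1 = ℕP.n≢0⇒n>0 (gcd[m,n]≢0 n d (inj₁ (ℕP.m<n⇒n≢0 1≤n)))
    g<n : g ℕ.< n
    g<n = ℕP.≤∧≢⇒< (ℕD.∣⇒≤ {{ℕ.>-nonZero 1≤n}} (gcd[m,n]∣m n d)) λ g≡n → n∤d (subst (_∣ d) g≡n (gcd[m,n]∣n n d))
    k≢0 : + k ≢ 0ℤ
    k≢0 refl = ℕP.m<n⇒n≢0 1≤n eq
    S = proj₁ (geom-mod g k)
    geom≋ = proj₂ (geom-mod g k)
    U = proj₁ (X^-1-bezout n d)
    V = proj₁ (proj₂ (X^-1-bezout n d))
    bez = proj₂ (proj₂ (X^-1-bezout n d))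
    neg-* : ∀ P → negP 1P *P P ≋ negP P
    neg-* = Ring.solve-∀ polyACR
    lem₁ : ∀ G F S U X V Y → G *P F +P negP (S *P (U *P (X *P F) +P V *P (Y *P F))) ≋
      (G +P negP ((U *P X +P V *P Y) *P S)) *P F
    lem₁ = Ring.solve-∀ polyACR
    lem₂ : ∀ C X S F → ((C +P X *P S) +P negP (X *P S)) *P F ≋ C *P F
    lem₂ = Ring.solve-∀ polyACR

  +-cancelˡ : ∀ a {b c} → a + b ≡ a + c → b ≡ c
  +-cancelˡ a {b} {c} e = trans (lem a b) (trans (cong (_+_ (- a)) e) (sym (lem a c)))
    where
    lem : ∀ a b → b ≡ - a + (a + b)
    lem = solve-∀

  x+y-x≡y : ∀ x y → (x + y) - x ≡ y
  x+y-x≡y = solve-∀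

  -- Divisibility of integers by natural numbers

  infix 4 _∣ℤ_
  _∣ℤ_ : ℕ → ℤ → Set
  s ∣ℤ z = + s ℤD.∣ z

  ∣0 : ∀ {s} → s ∣ℤ 0ℤ
  ∣0 = divides 0ℤ refl

  ∣-self : ∀ {s} k → s ∣ℤ k * + s
  ∣-self k = divides k refl

  ∣ℕ⇒∣ℤ : ∀ {s t} → s ∣ t → s ∣ℤ + t
  ∣ℕ⇒∣ℤ = ∣ᵤ⇒∣

  ∣ℤ⇒∣ℕ : ∀ {s t} → s ∣ℤ + t → s ∣ t
  ∣ℤ⇒∣ℕ = ∣⇒∣ᵤ

  ∣ℤ-refl : ∀ {s} → s ∣ℤ + s
  ∣ℤ-refl = ∣-refl

  ∣ℤ-trans : ∀ {s t z} → s ℕD.∣ t → t ∣ℤ z → s ∣ℤ z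
  ∣ℤ-trans h = ∣-trans (∣ℕ⇒∣ℤ h)

  ∣-cast : ∀ {s y z} → y ≡ z → s ∣ℤ y → s ∣ℤ z
  ∣-cast refl h = h

  ∣-flip : ∀ {s} a b → s ∣ℤ a - b → s ∣ℤ b - a
  ∣-flip a b h = ∣-cast (lem a b) (∣m⇒∣-m h)
    where
    lem : ∀ a b → - (a - b) ≡ b - a
    lem = solve-∀

  ∣-chain : ∀ {s} a b c → s ∣ℤ a - b → s ∣ℤ b - c → s ∣ℤ a - c
  ∣-chain a b c h k = ∣-cast (lem a b c) (∣m∣n⇒∣m+n h k)
    where
    lem : ∀ a b c → (a - b) + (b - c) ≡ a - c
    lem = solve-∀

  ∣-%ℕ : ∀ {n} .{{_ : ℕ.NonZero n}} a → n ∣ℤ a - + (a %ℕ n)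
  ∣-%ℕ {n} a = divides (a /ℕ n) (trans (cong (_- + (a %ℕ n)) (a≡a%ℕn+[a/ℕn]*n a n))
    (x+y-x≡y (+ (a %ℕ n)) (a /ℕ n * + n)))

  small-∣⇒≡ : ∀ {n i j} → i ℕ.< n → j ℕ.< n → n ∣ℤ + i - + j → i ≡ j
  small-∣⇒≡ {n} {i} {j} i<n j<n h = [ (λ i≤j → sym (from-≤ i≤j j<n (∣-flip (+ i) (+ j) h))) ,
    (λ j≤i → from-≤ j≤i i<n h) ]′ (ℕP.≤-total i j)
    where
    from-≤ : ∀ {i j} → i ℕ.≤ j → j ℕ.< n → n ∣ℤ + j - + i → j ≡ i
    from-≤ {i} {j} i≤j j<n h = ℕP.≤-antisym (ℕP.m∸n≡0⇒m≤n (small (ℕP.≤-<-trans (ℕP.m∸n≤m j i) j<n)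
        (∣ℤ⇒∣ℕ (∣-cast (trans (ℤP.m-n≡m⊖n j i) (ℤP.⊖-≥ i≤j)) h)))) i≤j
      where
      small : ∀ {d} → d ℕ.< n → n ℕD.∣ d → d ≡ 0
      small {zero}  _ _ = refl
      small {suc d} d<n h = ⊥-elim (ℕP.<⇒≱ d<n (ℕD.∣⇒≤ h))

  -- Indicator functions

  𝟙 : ∀ {p} {P : Set p} → Dec P → ℤ
  𝟙 (yes _) = 1ℤ
  𝟙 (no _)  = 0ℤ

  module _ {p} {P : Set p} where

    𝟙-yes : (d : Dec P) → P → 𝟙 d ≡ 1ℤ
    𝟙-yes (yes _) _ = refl
    𝟙-yes (no ¬p) p = ⊥-elim (¬p p)

    𝟙-no : (d : Dec P) → ¬ P → 𝟙 d ≡ 0ℤ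
    𝟙-no (yes p) ¬p = ⊥-elim (¬p p)
    𝟙-no (no _)  _  = refl

    𝟙≢0 : (d : Dec P) → 𝟙 d ≢ 0ℤ → P
    𝟙≢0 (yes p) _ = p
    𝟙≢0 (no _)  h = ⊥-elim (h refl)

    𝟙≥0 : (d : Dec P) → 0ℤ ≤ 𝟙 d
    𝟙≥0 (yes _) = +≤+ z≤n
    𝟙≥0 (no _)  = +≤+ z≤n

    𝟙≤1 : (d : Dec P) → 𝟙 d ≤ 1ℤ
    𝟙≤1 (yes _) = ℤP.≤-refl
    𝟙≤1 (no _)  = +≤+ z≤n

  𝟙-cong : ∀ {p q} {P : Set p} {Q : Set q} (d : Dec P) (e : Dec Q) → (P → Q) → (Q → P) → 𝟙 d ≡ 𝟙 e
  𝟙-cong (yes p) e f g = sym (𝟙-yes e (f p))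
  𝟙-cong (no ¬p) e f g = sym (𝟙-no e (¬p ∘ g))

  δ : ℕ → ℤ → ℤ
  δ s z = 𝟙 (+ s ∣? z)

  δ-yes : ∀ {s z} → s ∣ℤ z → δ s z ≡ 1ℤ
  δ-yes {s} {z} = 𝟙-yes (+ s ∣? z)

  δ-no : ∀ {s z} → ¬ (s ∣ℤ z) → δ s z ≡ 0ℤ
  δ-no {s} {z} = 𝟙-no (+ s ∣? z)

  δ-cong : ∀ {s t y z} → (s ∣ℤ y → t ∣ℤ z) → (t ∣ℤ z → s ∣ℤ y) → δ s y ≡ δ t z
  δ-cong {s} {t} {y} {z} = 𝟙-cong (+ s ∣? y) (+ t ∣? z)

  δ-shift : ∀ s y z → s ∣ℤ y - z → δ s y ≡ δ s z
  δ-shift s y z h = δ-cong {s} {s} {y} {z}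
    (λ k → ∣-cast (lem y z) (∣m∣n⇒∣m-n k h))
    (λ k → ∣-cast (lem₂ y z) (∣m∣n⇒∣m+n h k))
    where
    lem : ∀ y z → y - (y - z) ≡ z
    lem = solve-∀
    lem₂ : ∀ y z → (y - z) + z ≡ y
    lem₂ = solve-∀

  -- Finite sums

  module _ {a} {A : Set a} where

    ∑ₗ : List A → (A → ℤ) → ℤ
    ∑ₗ []       f = 0ℤ
    ∑ₗ (x ∷ xs) f = f x + ∑ₗ xs f

    ∑ₗ-cong-∈ : ∀ xs {f g : A → ℤ} → (∀ {x} → x ∈ xs → f x ≡ g x) → ∑ₗ xs f ≡ ∑ₗ xs g
    ∑ₗ-cong-∈ []       h = refl
    ∑ₗ-cong-∈ (x ∷ xs) h = cong₂ _+_ (h (here refl)) (∑ₗ-cong-∈ xs (h ∘ there))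

    ∑ₗ-cong : ∀ xs {f g : A → ℤ} → (∀ x → f x ≡ g x) → ∑ₗ xs f ≡ ∑ₗ xs g
    ∑ₗ-cong xs h = ∑ₗ-cong-∈ xs λ {x} _ → h x

    ∑ₗ-zero : ∀ xs {f : A → ℤ} → (∀ {x} → x ∈ xs → f x ≡ 0ℤ) → ∑ₗ xs f ≡ 0ℤ
    ∑ₗ-zero []       h = refl
    ∑ₗ-zero (x ∷ xs) h = cong₂ _+_ (h (here refl)) (∑ₗ-zero xs (h ∘ there))

    ∑ₗ-+ : ∀ xs (f g : A → ℤ) → ∑ₗ xs (λ x → f x + g x) ≡ ∑ₗ xs f + ∑ₗ xs g
    ∑ₗ-+ []       f g = refl
    ∑ₗ-+ (x ∷ xs) f g = trans (cong (_+_ (f x + g x)) (∑ₗ-+ xs f g)) (lem (f x) (g x) (∑ₗ xs f) (∑ₗ xs g))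
      where
      lem : ∀ a b c d → (a + b) + (c + d) ≡ (a + c) + (b + d)
      lem = solve-∀

    ∑ₗ-* : ∀ xs c (f : A → ℤ) → ∑ₗ xs (λ x → c * f x) ≡ c * ∑ₗ xs f
    ∑ₗ-* []       c f = sym (ℤP.*-zeroʳ c)
    ∑ₗ-* (x ∷ xs) c f = trans (cong (_+_ (c * f x)) (∑ₗ-* xs c f)) (sym (ℤP.*-distribˡ-+ c (f x) _))

    ∑ₗ-- : ∀ xs (f g : A → ℤ) → ∑ₗ xs (λ x → f x - g x) ≡ ∑ₗ xs f - ∑ₗ xs g
    ∑ₗ-- xs f g = trans (∑ₗ-cong xs (λ x → cong (_+_ (f x)) (sym (ℤP.-1*i≡-i (g x)))))
      (trans (∑ₗ-+ xs f (λ x → -1ℤ * g x)) (cong (_+_ (∑ₗ xs f)) (trans (∑ₗ-* xs -1ℤ g) (ℤP.-1*i≡-i _))))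

    ∑ₗ-one : ∀ xs → ∑ₗ xs (λ _ → 1ℤ) ≡ + length xs
    ∑ₗ-one []       = refl
    ∑ₗ-one (x ∷ xs) = cong (_+_ 1ℤ) (∑ₗ-one xs)

    ∑ₗ-const : ∀ xs c → ∑ₗ xs (λ _ → c) ≡ + length xs * c
    ∑ₗ-const xs c = trans (∑ₗ-cong xs λ _ → sym (ℤP.*-identityʳ c))
      (trans (∑ₗ-* xs c (λ _ → 1ℤ)) (trans (cong (c *_) (∑ₗ-one xs)) (ℤP.*-comm c _)))

    ∑ₗ-mono : ∀ xs {f g : A → ℤ} → (∀ {x} → x ∈ xs → f x ≤ g x) → ∑ₗ xs f ≤ ∑ₗ xs g
    ∑ₗ-mono []       h = ℤP.≤-refl
    ∑ₗ-mono (x ∷ xs) h = ℤP.+-mono-≤ (h (here refl)) (∑ₗ-mono xs (h ∘ there))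

    ∑ₗ≥0 : ∀ xs {f : A → ℤ} → (∀ x → 0ℤ ≤ f x) → 0ℤ ≤ ∑ₗ xs f
    ∑ₗ≥0 xs {f} h = subst (_≤ ∑ₗ xs f) (∑ₗ-zero xs λ _ → refl) (∑ₗ-mono xs λ {x} _ → h x)

    ∑ₗ-≥-term : ∀ {xs x} (f : A → ℤ) → (∀ x → 0ℤ ≤ f x) → x ∈ xs → f x ≤ ∑ₗ xs f
    ∑ₗ-≥-term {x ∷ xs} f h (here refl) = subst (_≤ f x + ∑ₗ xs f) (ℤP.+-identityʳ (f x))
      (ℤP.+-monoʳ-≤ (f x) (∑ₗ≥0 xs h))
    ∑ₗ-≥-term {y ∷ xs} {x} f h (there m) = subst (_≤ f y + ∑ₗ xs f) (ℤP.+-identityˡ (f x))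
      (ℤP.+-mono-≤ (h y) (∑ₗ-≥-term f h m))

    ∑ₗ≢0 : ∀ xs (f : A → ℤ) → ∑ₗ xs f ≢ 0ℤ → ∃ λ x → x ∈ xs × f x ≢ 0ℤ
    ∑ₗ≢0 []       f h = ⊥-elim (h refl)
    ∑ₗ≢0 (x ∷ xs) f h with f x ℤP.≟ 0ℤ
    ... | no fx≢0 = x , here refl , fx≢0
    ... | yes fx≡0 with ∑ₗ≢0 xs f (λ e → h (cong₂ _+_ fx≡0 e))
    ... | y , m , fy≢0 = y , there m , fy≢0

    ∑ₗ-filter : ∀ {p} {P : A → Set p} (P? : Decidable P) xs (f : A → ℤ) →
      ∑ₗ (filter P? xs) f ≡ ∑ₗ xs (λ x → 𝟙 (P? x) * f x)
    ∑ₗ-filter P? []       f = refl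
    ∑ₗ-filter P? (x ∷ xs) f with P? x
    ... | yes _ = cong₂ _+_ (sym (ℤP.*-identityˡ (f x))) (∑ₗ-filter P? xs f)
    ... | no _  = trans (∑ₗ-filter P? xs f) (sym (trans (cong (_+ rest) (ℤP.*-zeroˡ (f x))) (ℤP.+-identityˡ rest)))
      where rest = ∑ₗ xs (λ x → 𝟙 (P? x) * f x)

    ∑ₗ≤1 : ∀ {xs} (f : A → ℤ) → Unique xs → (∀ {x} → x ∈ xs → f x ≤ 1ℤ) →
      (∀ {x y} → x ∈ xs → y ∈ xs → f x ≢ 0ℤ → f y ≢ 0ℤ → x ≡ y) → ∑ₗ xs f ≤ 1ℤ
    ∑ₗ≤1 {[]}     f u         b e = +≤+ z≤n
    ∑ₗ≤1 {x ∷ xs} f (x∉ ∷ u) b e with f x ℤP.≟ 0ℤ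
    ... | yes fx≡0 = subst (_≤ 1ℤ) (sym (trans (cong (_+ ∑ₗ xs f) fx≡0) (ℤP.+-identityˡ (∑ₗ xs f))))
                       (∑ₗ≤1 f u (b ∘ there) (λ m m′ → e (there m) (there m′)))
    ... | no fx≢0 = subst (_≤ 1ℤ) (sym (trans (cong (_+_ (f x)) (∑ₗ-zero xs rest)) (ℤP.+-identityʳ (f x))))
      (b (here refl))
      where
      rest : ∀ {y} → y ∈ xs → f y ≡ 0ℤ
      rest {y} m with f y ℤP.≟ 0ℤ
      ... | yes z = z
      ... | no nz = ⊥-elim (All.lookup x∉ m (e (here refl) (there m) fx≢0 nz))

  ∑ₗ-swap : ∀ {a b} {A : Set a} {B : Set b} xs ys (f : A → B → ℤ) →
    ∑ₗ xs (λ x → ∑ₗ ys (f x)) ≡ ∑ₗ ys (λ y → ∑ₗ xs (λ x → f x y))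
  ∑ₗ-swap []       ys f = sym (∑ₗ-zero ys λ _ → refl)
  ∑ₗ-swap (x ∷ xs) ys f = trans (cong (_+_ (∑ₗ ys (f x))) (∑ₗ-swap xs ys f)) (sym (∑ₗ-+ ys (f x) _))

  ∑ₗ-map : ∀ {a b} {A : Set a} {B : Set b} (g : A → B) xs f → ∑ₗ (map g xs) f ≡ ∑ₗ xs (f ∘ g)
  ∑ₗ-map g []       f = refl
  ∑ₗ-map g (x ∷ xs) f = cong (_+_ (f (g x))) (∑ₗ-map g xs f)

  ∑< : ℕ → (ℕ → ℤ) → ℤ
  ∑< zero    f = 0ℤ
  ∑< (suc n) f = f 0 + ∑< n (f ∘ suc)

  ∑<-cong : ∀ n {f g} → (∀ i → i ℕ.< n → f i ≡ g i) → ∑< n f ≡ ∑< n g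
  ∑<-cong zero    h = refl
  ∑<-cong (suc n) h = cong₂ _+_ (h 0 (s≤s z≤n)) (∑<-cong n λ i i<n → h (suc i) (s≤s i<n))

  ∑<-mono : ∀ n {f g} → (∀ i → i ℕ.< n → f i ≤ g i) → ∑< n f ≤ ∑< n g
  ∑<-mono zero    h = ℤP.≤-refl
  ∑<-mono (suc n) h = ℤP.+-mono-≤ (h 0 (s≤s z≤n)) (∑<-mono n λ i i<n → h (suc i) (s≤s i<n))

  ∑<-const : ∀ n c → ∑< n (λ _ → c) ≡ + n * c
  ∑<-const zero    c = sym (ℤP.*-zeroˡ c)
  ∑<-const (suc n) c = trans (cong (_+_ c) (∑<-const n c)) (trans (lem (+ n) c) (cong (_* c) (sym (ℤP.pos-+ 1 n))))
    where
    lem : ∀ n c → c + n * c ≡ (1ℤ + n) * c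
    lem = solve-∀

  ∑<-∣ : ∀ {s} n f → (∀ i → s ∣ℤ f i) → s ∣ℤ ∑< n f
  ∑<-∣ zero    f h = ∣0
  ∑<-∣ (suc n) f h = ∣m∣n⇒∣m+n (h 0) (∑<-∣ n (f ∘ suc) (h ∘ suc))

  ∑<-zero : ∀ n {f} → (∀ i → i ℕ.< n → f i ≡ 0ℤ) → ∑< n f ≡ 0ℤ
  ∑<-zero n h = trans (∑<-cong n h) (trans (∑<-const n 0ℤ) (ℤP.*-zeroʳ (+ n)))

  ∑<-+ : ∀ n f g → ∑< n (λ i → f i + g i) ≡ ∑< n f + ∑< n g
  ∑<-+ zero    f g = refl
  ∑<-+ (suc n) f g = trans (cong (_+_ (f 0 + g 0)) (∑<-+ n (f ∘ suc) (g ∘ suc))) (lem (f 0) (g 0) _ _)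
    where
    lem : ∀ a b c d → (a + b) + (c + d) ≡ (a + c) + (b + d)
    lem = solve-∀

  ∑<-* : ∀ n c f → ∑< n (λ i → c * f i) ≡ c * ∑< n f
  ∑<-* zero    c f = sym (ℤP.*-zeroʳ c)
  ∑<-* (suc n) c f = trans (cong (_+_ (c * f 0)) (∑<-* n c (f ∘ suc))) (sym (ℤP.*-distribˡ-+ c (f 0) _))

  ∑<-last : ∀ n f → ∑< (suc n) f ≡ ∑< n f + f n
  ∑<-last zero    f = ℤP.+-comm (f 0) 0ℤ
  ∑<-last (suc n) f = trans (cong (_+_ (f 0)) (∑<-last n (f ∘ suc))) (sym (ℤP.+-assoc (f 0) _ _))

  ∑<-rotate : ∀ n f → (∀ i → f (i ℕ.+ n) ≡ f i) → ∀ k → ∑< n (λ i → f (i ℕ.+ k)) ≡ ∑< n f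
  ∑<-rotate n f per zero    = ∑<-cong n λ i _ → cong f (ℕP.+-identityʳ i)
  ∑<-rotate n f per (suc k) = trans (∑<-cong n λ i _ → cong f (ℕP.+-suc i k))
    (trans (shift n (λ i → f (i ℕ.+ k)) per′) (∑<-rotate n f per k))
    where
    per′ : ∀ i → f (i ℕ.+ n ℕ.+ k) ≡ f (i ℕ.+ k)
    per′ i = trans (cong f (trans (ℕP.+-assoc i n k)
      (trans (cong (i ℕ.+_) (ℕP.+-comm n k)) (sym (ℕP.+-assoc i k n))))) (per (i ℕ.+ k))
    shift : ∀ n g → (∀ i → g (i ℕ.+ n) ≡ g i) → ∑< n (g ∘ suc) ≡ ∑< n g
    shift zero    g _ = refl
    shift (suc n) g p = trans (∑<-last n (g ∘ suc)) (trans (cong (_+_ (∑< n (g ∘ suc))) (p 0)) (ℤP.+-comm _ (g 0)))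

  ∑<-pick : ∀ n {f} r → r ℕ.< n → (∀ i → i ℕ.< n → i ≢ r → f i ≡ 0ℤ) → ∑< n f ≡ f r
  ∑<-pick (suc n) {f} zero    _         h =
    trans (cong (_+_ (f 0)) (∑<-zero n λ i i<n → h (suc i) (s≤s i<n) λ ())) (ℤP.+-identityʳ (f 0))
  ∑<-pick (suc n) {f} (suc r) (s≤s r<n) h = trans (cong₂ _+_ (h 0 (s≤s z≤n) λ ())
    (∑<-pick n r r<n λ i i<n i≢r → h (suc i) (s≤s i<n) (i≢r ∘ ℕP.suc-injective))) (ℤP.+-identityˡ _)

  ∑ₗ-∑<-swap : ∀ {a} {A : Set a} (xs : List A) n (f : A → ℕ → ℤ) →
    ∑ₗ xs (λ x → ∑< n (f x)) ≡ ∑< n (λ i → ∑ₗ xs (λ x → f x i))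
  ∑ₗ-∑<-swap []       n f = sym (∑<-zero n λ _ _ → refl)
  ∑ₗ-∑<-swap (x ∷ xs) n f = trans (cong (_+_ (∑< n (f x))) (∑ₗ-∑<-swap xs n f)) (sym (∑<-+ n (f x) _))

  ∑<-≡1 : ∀ n f → (∀ i → i ℕ.< n → 1ℤ ≤ f i) → ∑< n f ≡ + n → ∀ i → i ℕ.< n → f i ≡ 1ℤ
  ∑<-≡1 (suc n) f h e = go
    where
    s≥n : + n ≤ ∑< n (f ∘ suc)
    s≥n = subst (_≤ ∑< n (f ∘ suc)) (trans (∑<-const n 1ℤ) (ℤP.*-identityʳ _))
      (∑<-mono n λ i i<n → h (suc i) (s≤s i<n))
    f0≤1 : f 0 ≤ 1ℤ
    f0≤1 = ℤP.≤-trans (ℤP.≤-reflexive (sym (cancel (f 0) (+ n))))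
      (ℤP.≤-trans (ℤP.+-monoˡ-≤ (- (+ n))
        (ℤP.≤-trans (ℤP.+-monoʳ-≤ (f 0) s≥n) (ℤP.≤-reflexive (trans e (ℤP.pos-+ 1 n)))))
        (ℤP.≤-reflexive (cancel 1ℤ (+ n))))
      where
      cancel : ∀ a b → a + b + - b ≡ a
      cancel = solve-∀
    f0≡1 : f 0 ≡ 1ℤ
    f0≡1 = ℤP.≤-antisym f0≤1 (h 0 (s≤s z≤n))
    rest : ∑< n (f ∘ suc) ≡ + n
    rest = +-cancelˡ 1ℤ (trans (cong (_+ ∑< n (f ∘ suc)) (sym f0≡1)) (trans e (ℤP.pos-+ 1 n)))
    go : ∀ i → i ℕ.< suc n → f i ≡ 1ℤ
    go zero    _         = f0≡1
    go (suc i) (s≤s i<n) = ∑<-≡1 n (f ∘ suc) (λ i i<n → h (suc i) (s≤s i<n)) rest i i<n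

  ∑<-δ : ∀ n .{{_ : ℕ.NonZero n}} a → ∑< n (λ i → δ n (a - + i)) ≡ 1ℤ
  ∑<-δ n a = trans (∑<-pick n (a %ℕ n) (n%ℕd<d a n)
      (λ i i<n i≢r → δ-no λ h → i≢r (small-∣⇒≡ i<n (n%ℕd<d a n)
        (∣-chain (+ i) a (+ (a %ℕ n)) (∣-flip a (+ i) h) (∣-%ℕ a)))))
    (δ-yes (∣-%ℕ a))

  -- Primes and coprimality

  prime≢0 : ∀ {p} → Prime p → p ≢ 0
  prime≢0 pr refl = ¬prime[0] pr

  prime≢1 : ∀ {p} → Prime p → p ≢ 1
  prime≢1 pr refl = ¬prime[1] pr

  prime∣1 : ∀ {p} → Prime p → ¬ p ∣ 1
  prime∣1 pr h = prime≢1 pr (ℕD.∣1⇒≡1 h)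

  prime∣prime : ∀ {p q} → Prime p → Prime q → p ∣ q → p ≡ q
  prime∣prime pp pq h with prime⇒irreducible pq h
  ... | inj₁ p≡1 = ⊥-elim (prime≢1 pp p≡1)
  ... | inj₂ p≡q = p≡q

  prime∣^ : ∀ {p} m k → Prime p → p ∣ m ℕ.^ k → p ∣ m
  prime∣^ m zero    pr h = ⊥-elim (prime∣1 pr h)
  prime∣^ m (suc k) pr h with euclidsLemma m (m ℕ.^ k) pr h
  ... | inj₁ p∣m = p∣m
  ... | inj₂ p∣^ = prime∣^ m k pr p∣^

  ^-mono-∣ : ∀ p {m n} → m ℕ.≤ n → p ℕ.^ m ∣ p ℕ.^ n
  ^-mono-∣ p {m} {n} m≤n = ℕD.divides (p ℕ.^ (n ℕ.∸ m))
    (trans (cong (p ℕ.^_) (sym (ℕP.m∸n+n≡m m≤n))) (ℕP.^-distribˡ-+-* p (n ℕ.∸ m) m))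

  primeFactor : ∀ d → d ≢ 0 → d ≢ 1 → ∃ λ ℓ → Prime ℓ × ℓ ∣ d
  primeFactor d d≢0 d≢1 with factorise d {{ℕ.≢-nonZero d≢0}}
  ... | record { factors = [] ; isFactorisation = eq } = ⊥-elim (d≢1 eq)
  ... | record { factors = ℓ ∷ ls ; isFactorisation = eq ; factorsPrime = pr ∷ _ } =
    ℓ , pr , ℕD.divides (product ls) (trans eq (ℕP.*-comm ℓ (product ls)))

  no-common-prime⇒coprime : ∀ m n → m ≢ 0 → (∀ ℓ → Prime ℓ → ℓ ∣ m → ℓ ∣ n → ⊥) → Coprime m n
  no-common-prime⇒coprime m n m≢0 h {i} (i∣m , i∣n) with i ℕP.≟ 1
  ... | yes i≡1 = i≡1
  ... | no i≢1 with primeFactor i (λ { refl → m≢0 (ℕD.0∣⇒≡0 i∣m) }) i≢1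
  ... | ℓ , pr , ℓ∣i = ⊥-elim (h ℓ pr (ℕD.∣-trans ℓ∣i i∣m) (ℕD.∣-trans ℓ∣i i∣n))

  prime^-coprime : ∀ {p m} k → Prime p → ¬ p ∣ m → Coprime (p ℕ.^ k) m
  prime^-coprime {p} {m} k pr p∤m = no-common-prime⇒coprime (p ℕ.^ k) m (λ e → prime≢0 pr (ℕP.m^n≡0⇒m≡0 p k e))
    λ ℓ pℓ ℓ∣p^ ℓ∣m → p∤m (subst (_∣ m) (prime∣prime pℓ pr (prime∣^ p k pℓ ℓ∣p^)) ℓ∣m)

  prime-coprime : ∀ {p m} → Prime p → ¬ p ∣ m → Coprime p m
  prime-coprime {p} {m} pr p∤m = subst (λ k → Coprime k m) (ℕP.*-identityʳ p) (prime^-coprime {p} {m} 1 pr p∤m)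

  coprime-*∣ : ∀ {m n k} → Coprime m n → m ∣ k → n ∣ k → m ℕ.* n ∣ k
  coprime-*∣ {m} {n} c (ℕD.divides q refl) n∣k = subst (m ℕ.* n ∣_) (ℕP.*-comm m q)
    (ℕD.*-monoʳ-∣ m (coprime-divisor (Coprime-sym c) (subst (n ∣_) (ℕP.*-comm q m) n∣k)))

  coprime-*∣ℤ : ∀ {m n z} → Coprime m n → m ∣ℤ z → n ∣ℤ z → m ℕ.* n ∣ℤ z
  coprime-*∣ℤ c h k = ∣ᵤ⇒∣ (coprime-*∣ c (∣⇒∣ᵤ h) (∣⇒∣ᵤ k))

  coprime-divisorℤ : ∀ {m n} z → Coprime m n → m ∣ℤ + n * z → m ∣ℤ z
  coprime-divisorℤ {m} {n} z c h = ∣ᵤ⇒∣ (coprime-divisor c (subst (m ∣_) (ℤP.abs-* (+ n) z) (∣⇒∣ᵤ h)))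

  euclidsLemmaℤ : ∀ {p} y z → Prime p → p ∣ℤ y * z → p ∣ℤ y ⊎ p ∣ℤ z
  euclidsLemmaℤ {p} y z pr h with euclidsLemma ℤ.∣ y ∣ ℤ.∣ z ∣ pr (subst (p ∣_) (ℤP.abs-* y z) (∣⇒∣ᵤ h))
  ... | inj₁ k = inj₁ (∣ᵤ⇒∣ k)
  ... | inj₂ k = inj₂ (∣ᵤ⇒∣ k)

  *-cancelˡ-∣ℤ : ∀ k {m z} → k ≢ 0 → k ℕ.* m ∣ℤ + k * z → m ∣ℤ z
  *-cancelˡ-∣ℤ k {m} {z} k≢0 h = ∣ᵤ⇒∣ (ℕD.*-cancelˡ-∣ k {{ℕ.≢-nonZero k≢0}}
    (subst (k ℕ.* m ∣_) (ℤP.abs-* (+ k) z) (∣⇒∣ᵤ h)))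

  *-monoʳ-∣ℤ : ∀ k {m z} → m ∣ℤ z → k ℕ.* m ∣ℤ + k * z
  *-monoʳ-∣ℤ k {m} {z} h = ∣ᵤ⇒∣ (subst (k ℕ.* m ∣_) (sym (ℤP.abs-* (+ k) z)) (ℕD.*-monoʳ-∣ k (∣⇒∣ᵤ h)))

  -- Products of prime powers

  PrimePower : ℕ × ℕ → Set
  PrimePower (p , α) = Prime p × 1 ℕ.≤ α

  prod : List (ℕ × ℕ) → ℕ
  prod []             = 1
  prod ((p , α) ∷ ps) = p ℕ.^ α ℕ.* prod ps

  prime∣prod : ∀ {ℓ} ps → All PrimePower ps → Prime ℓ → ℓ ∣ prod ps → ℓ ∈ map proj₁ ps
  prime∣prod []             []              pr h = ⊥-elim (prime∣1 pr h)
  prime∣prod ((p , α) ∷ ps) ((pp , _) ∷ gs) pr h with euclidsLemma (p ℕ.^ α) (prod ps) pr h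
  ... | inj₁ k = here (prime∣prime pr pp (prime∣^ p α pr k))
  ... | inj₂ k = there (prime∣prod ps gs pr k)

  prime∤prod : ∀ {q} ps → All PrimePower ps → Prime q → All (q ≢_) (map proj₁ ps) → ¬ q ∣ prod ps
  prime∤prod ps gs pr q∉ h = All.lookup q∉ (prime∣prod ps gs pr h) refl

  ∈⇒∣prod : ∀ {p α} ps → (p , α) ∈ ps → p ℕ.^ α ∣ prod ps
  ∈⇒∣prod ((p , α) ∷ ps) (here refl) = ℕD.m∣m*n (prod ps)
  ∈⇒∣prod ((p , α) ∷ ps) (there m)   = ℕD.∣n⇒∣m*n (p ℕ.^ α) (∈⇒∣prod ps m)

  prod≢0 : ∀ ps → All PrimePower ps → prod ps ≢ 0
  prod≢0 []             []              ()
  prod≢0 ((p , α) ∷ ps) ((pp , _) ∷ gs) e with ℕP.m*n≡0⇒m≡0∨n≡0 (p ℕ.^ α) e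
  ... | inj₁ k = prime≢0 pp (ℕP.m^n≡0⇒m≡0 p α k)
  ... | inj₂ k = prod≢0 ps gs k

  prod-∣ : ∀ {M} ps → All PrimePower ps → Unique (map proj₁ ps) → All (λ (p , α) → p ℕ.^ α ∣ M) ps → prod ps ∣ M
  prod-∣ {M} []     []     []      []      = ℕD.1∣ M
  prod-∣ ((p , α) ∷ ps) ((pp , _) ∷ gs) (p∉ ∷ u) (d ∷ ds) =
    coprime-*∣ (prime^-coprime α pp (prime∤prod ps gs pp p∉)) d (prod-∣ ps gs u ds)

  -- Class counts and their iterated differences

  cnt : ℕ → ℤ → List ℤ → ℤ
  cnt s x A = ∑ₗ A (λ a → δ s (a - x))

  cnt-shift : ∀ s x y A → s ∣ℤ x - y → cnt s x A ≡ cnt s y A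
  cnt-shift s x y A h = ∑ₗ-cong A λ a → δ-shift s (a - x) (a - y) (∣-cast (lem a x y) (∣m⇒∣-m h))
    where
    lem : ∀ a x y → - (x - y) ≡ (a - x) - (a - y)
    lem = solve-∀

  cnt≥0 : ∀ s x A → 0ℤ ≤ cnt s x A
  cnt≥0 s x A = ∑ₗ≥0 A λ a → 𝟙≥0 _

  -- The alternating sum of `f` over the vertices of a cuboid, the points `x` minus a partial sum of
  -- the directions.
  Cub : List ℤ → (ℤ → ℤ) → ℤ → ℤ
  Cub []       f x = f x
  Cub (h ∷ hs) f x = Cub hs f (x - h) - Cub hs f x

  -- For f = cnt (prod ps) A this is divisibility of the mask polynomial of A by Φ (prod ps).
  Cuboid : List (ℕ × ℕ) → (ℤ → ℤ) → Set
  Cuboid ps f = ∀ hs → Pointwise (λ pα h → prod ps ∣ℤ + proj₁ pα * h) ps hs → ∀ x → Cub hs f x ≡ 0ℤ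

  -- The relation `R` survives matching steps, so it pairs all vertices of the two cuboids. Every
  -- change of variable and every restriction of a cuboid to one class below is an instance.
  Cub-transfer : ∀ {r} (R : ℤ → ℤ → Set r) {f g : ℤ → ℤ} {hs hs′} →
    (∀ y y′ → R y y′ → f y ≡ g y′) →
    Pointwise (λ h h′ → ∀ y y′ → R y y′ → R (y - h) (y′ - h′)) hs hs′ →
    ∀ x x′ → R x x′ → Cub hs f x ≡ Cub hs′ g x′
  Cub-transfer R e []       x x′ r = e x x′ r
  Cub-transfer R {f} {g} e (s ∷ ss) x x′ r =
    cong₂ _-_ (Cub-transfer R {f} {g} e ss _ _ (s x x′ r)) (Cub-transfer R {f} {g} e ss x x′ r)

  Cub-cong : ∀ hs {f g} → (∀ y → f y ≡ g y) → ∀ x → Cub hs f x ≡ Cub hs g x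
  Cub-cong []       e x = e x
  Cub-cong (h ∷ hs) e x = cong₂ _-_ (Cub-cong hs e (x - h)) (Cub-cong hs e x)

  Cub-+ : ∀ hs f g x → Cub hs (λ y → f y + g y) x ≡ Cub hs f x + Cub hs g x
  Cub-+ []       f g x = refl
  Cub-+ (h ∷ hs) f g x = trans (cong₂ _-_ (Cub-+ hs f g (x - h)) (Cub-+ hs f g x))
    (lem (Cub hs f (x - h)) (Cub hs g (x - h)) (Cub hs f x) (Cub hs g x))
    where
    lem : ∀ a b c d → (a + b) - (c + d) ≡ (a - c) + (b - d)
    lem = solve-∀

  Cub-0 : ∀ hs {f} → (∀ y → f y ≡ 0ℤ) → ∀ x → Cub hs f x ≡ 0ℤ
  Cub-0 []       e x = e x
  Cub-0 (h ∷ hs) e x = cong₂ _-_ (Cub-0 hs e (x - h)) (Cub-0 hs e x)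

  Cub-∑< : ∀ hs n (f : ℕ → ℤ → ℤ) → (∀ i → i ℕ.< n → ∀ x → Cub hs (f i) x ≡ 0ℤ) →
    ∀ x → Cub hs (λ y → ∑< n (λ i → f i y)) x ≡ 0ℤ
  Cub-∑< hs zero    f e x = Cub-0 hs (λ _ → refl) x
  Cub-∑< hs (suc n) f e x = trans (Cub-+ hs (f 0) _ x)
    (cong₂ _+_ (e 0 (s≤s z≤n) x) (Cub-∑< hs n (f ∘ suc) (λ i i<n → e (suc i) (s≤s i<n)) x))

  Cub-↭ : ∀ {hs hs′} → hs ↭ hs′ → ∀ f x → Cub hs f x ≡ Cub hs′ f x
  Cub-↭ Perm.refl             f x = refl
  Cub-↭ (Perm.prep h p)       f x = cong₂ _-_ (Cub-↭ p f (x - h)) (Cub-↭ p f x)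
  Cub-↭ (Perm.trans p q)      f x = trans (Cub-↭ p f x) (Cub-↭ q f x)
  Cub-↭ {.h ∷ .k ∷ hs} {.k ∷ .h ∷ hs′} (Perm.swap h k p) f x =
    trans (cong₂ (λ u v → u - v)
        (cong₂ _-_ (Cub-↭ p f (x - h - k)) (Cub-↭ p f (x - h)))
        (cong₂ _-_ (Cub-↭ p f (x - k)) (Cub-↭ p f x)))
      (trans (cong (λ z → (Cub hs′ f z - Cub hs′ f (x - h)) - (Cub hs′ f (x - k) - Cub hs′ f x)) (comm x h k))
        (lem (Cub hs′ f (x - k - h)) (Cub hs′ f (x - h)) (Cub hs′ f (x - k)) (Cub hs′ f x)))
    where
    comm : ∀ x h k → x - h - k ≡ x - k - h
    comm = solve-∀
    lem : ∀ a b c d → (a - b) - (c - d) ≡ (a - c) - (b - d)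
    lem = solve-∀

  Cub-periodic : ∀ hs f h → (∀ x → f (x - h) ≡ f x) → ∀ x → Cub hs f (x - h) ≡ Cub hs f x
  Cub-periodic hs f h per x = 
    Cub-transfer (λ y y′ → y ≡ y′ - h) {f} {f} {hs} {hs} (λ { y y′ refl → per y′ })
      (Pointwise.refl λ {k} y y′ r → trans (cong (_- k) r) (comm y′ h k)) (x - h) x refl
    where
    comm : ∀ x h k → x - h - k ≡ x - k - h
    comm = solve-∀

  Pointwise-↭ : ∀ {a b r} {A : Set a} {B : Set b} {R : A → B → Set r} {xs xs′ ys} → xs ↭ xs′ → Pointwise R xs ys →
    ∃ λ ys′ → ys ↭ ys′ × Pointwise R xs′ ys′
  Pointwise-↭ Perm.refl rs = _ , Perm.refl , rs
  Pointwise-↭ (Perm.prep x p) (r ∷ rs) with Pointwise-↭ p rs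
  ... | ys′ , q , rs′ = _ , Perm.prep _ q , r ∷ rs′
  Pointwise-↭ (Perm.swap x y p) (r ∷ r′ ∷ rs) with Pointwise-↭ p rs
  ... | ys′ , q , rs′ = _ , Perm.swap _ _ q , r′ ∷ r ∷ rs′
  Pointwise-↭ (Perm.trans p q) rs with Pointwise-↭ p rs
  ... | ys′ , p′ , rs′ with Pointwise-↭ q rs′
  ... | ys″ , q′ , rs″ = ys″ , Perm.trans p′ q′ , rs″

  prod-↭ : ∀ {ps qs} → ps ↭ qs → prod ps ≡ prod qs
  prod-↭ Perm.refl = refl
  prod-↭ (Perm.prep (p , α) r) = cong (p ℕ.^ α ℕ.*_) (prod-↭ r)
  prod-↭ {_} {_ ∷ _ ∷ qs} (Perm.swap (p , α) (q , β) r) =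
    trans (cong (λ k → p ℕ.^ α ℕ.* (q ℕ.^ β ℕ.* k)) (prod-↭ r))
    (trans (sym (ℕP.*-assoc (p ℕ.^ α) (q ℕ.^ β) (prod qs)))
      (trans (cong (ℕ._* prod qs) (ℕP.*-comm (p ℕ.^ α) (q ℕ.^ β))) (ℕP.*-assoc (q ℕ.^ β) (p ℕ.^ α) (prod qs))))
  prod-↭ (Perm.trans r r′) = trans (prod-↭ r) (prod-↭ r′)

  CC : List (ℕ × ℕ) → List ℤ → Set
  CC ps A = Cuboid ps (λ y → cnt (prod ps) y A)

  CC-↭ : ∀ {ps qs A} → ps ↭ qs → CC ps A → CC qs A
  CC-↭ {ps} {qs} {A} r c hs ds x with Pointwise-↭ (Perm.↭-sym r) ds
  ... | hs′ , q , ds′ = trans (Cub-↭ q _ x)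
    (subst (λ s → Cub hs′ (λ y → cnt s y A) x ≡ 0ℤ) (prod-↭ r)
      (c hs′ (Pointwise.map (λ {pα} {h} → subst (λ s → s ∣ℤ + proj₁ pα * h) (sym (prod-↭ r))) ds′) x))

  -- Divisibility of the mask polynomial of A by Φ (p^(j+1)).
  Lev : ℕ → ℕ → List ℤ → Set
  Lev p j A = ∀ x → + p * cnt (p ℕ.^ suc j) x A ≡ cnt (p ℕ.^ j) x A

  δ-split : ∀ p .{{_ : ℕ.NonZero p}} m → m ≢ 0 → ∀ z → δ m z ≡ ∑< p (λ j → δ (p ℕ.* m) (z - + j * + m))
  δ-split p m m≢0 z with + m ∣? z
  ... | no ¬d = sym (∑<-zero p λ j _ → δ-no λ h → ¬d (∣-cast (lem z (+ j * + m))
          (∣m∣n⇒∣m+n (∣ℤ-trans (ℕD.n∣m*n p) h) (∣-self (+ j)))))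
    where
    lem : ∀ z w → z - w + w ≡ z
    lem = solve-∀
  ... | yes (divides t refl) =
    sym (trans (∑<-cong p λ j _ → δ-cong {p ℕ.* m} {p} {t * + m - + j * + m} {t - + j}
        (λ h → *-cancelˡ-∣ℤ m m≢0 (subst₂ _∣ℤ_ (ℕP.*-comm p m) (lem t (+ j) (+ m)) h))
        (λ h → subst₂ _∣ℤ_ (ℕP.*-comm m p) (sym (lem t (+ j) (+ m))) (*-monoʳ-∣ℤ m h)))
      (∑<-δ p t))
    where
    lem : ∀ t j m → t * m - j * m ≡ m * (t - j)
    lem = solve-∀

  cnt-split : ∀ p .{{_ : ℕ.NonZero p}} m → m ≢ 0 → ∀ x A → cnt m x A ≡ ∑< p (λ j → cnt (p ℕ.* m) (x + + j * + m) A)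
  cnt-split p m m≢0 x A = trans (∑ₗ-cong A λ a → trans (δ-split p m m≢0 (a - x))
      (∑<-cong p λ j _ → cong (δ (p ℕ.* m)) (lem a x (+ j * + m)))) (∑ₗ-∑<-swap A p _)
    where
    lem : ∀ a x w → a - x - w ≡ a - (x + w)
    lem = solve-∀

  -- A class modulo p^j consists of the p classes at x + i p^j modulo p^(j+1), and invariance makes
  -- their counts equal.
  cnt-invariant⇒Lev : ∀ p j A → p ≢ 0 → (∀ x → cnt (p ℕ.^ suc j) (x + + (p ℕ.^ j)) A ≡ cnt (p ℕ.^ suc j) x A) →
    Lev p j A
  cnt-invariant⇒Lev p j A p≢0 inv x =
    sym (trans (cnt-split p {{ℕ.≢-nonZero p≢0}} (p ℕ.^ j) (λ e → p≢0 (ℕP.m^n≡0⇒m≡0 p j e)) x A)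
    (trans (∑<-cong p λ i _ → go i) (∑<-const p _)))
    where
    go : ∀ i → cnt (p ℕ.^ suc j) (x + + i * + (p ℕ.^ j)) A ≡ cnt (p ℕ.^ suc j) x A
    go zero    = cong (λ y → cnt (p ℕ.^ suc j) y A)
      (trans (cong (_+_ x) (ℤP.*-zeroˡ (+ (p ℕ.^ j)))) (ℤP.+-identityʳ x))
    go (suc i) = trans (cong (λ y → cnt (p ℕ.^ suc j) y A)
      (trans (cong (λ k → x + k * + (p ℕ.^ j)) (ℤP.pos-+ 1 i)) (lem x (+ i) (+ (p ℕ.^ j)))))
      (trans (inv _) (go i))
      where
      lem : ∀ x i m → x + (1ℤ + i) * m ≡ x + i * m + m
      lem = solve-∀

  Lev⇒cnt-invariant : ∀ p j A → p ≢ 0 → Lev p j A → ∀ x h → p ℕ.^ j ∣ℤ h →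
    cnt (p ℕ.^ suc j) (x - h) A ≡ cnt (p ℕ.^ suc j) x A
  Lev⇒cnt-invariant p j A p≢0 lev x h d = ℤP.*-cancelˡ-≡ (+ p) _ _ {{ℕ.≢-nonZero p≢0}}
    (trans (lev (x - h)) (trans (cnt-shift (p ℕ.^ j) (x - h) x A (∣-cast (lem x h) (∣m⇒∣-m d))) (sym (lev x))))
    where
    lem : ∀ x h → - h ≡ x - h - x
    lem = solve-∀

  CC-single⇒Lev : ∀ p j A → p ≢ 0 → CC ((p , suc j) ∷ []) A → Lev p j A
  CC-single⇒Lev p j A p≢0 c = cnt-invariant⇒Lev p j A p≢0 λ x → sym (trans
    (cong (λ y → cnt (p ℕ.^ suc j) y A) (lem x (+ (p ℕ.^ j))))
    (ℤP.i-j≡0⇒i≡j _ _ (subst (λ s → cnt s (x + + (p ℕ.^ j) - + (p ℕ.^ j)) A - cnt s (x + + (p ℕ.^ j)) A ≡ 0ℤ)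
      (ℕP.*-identityʳ (p ℕ.^ suc j))
      (c (+ (p ℕ.^ j) ∷ []) (∣-cast (ℤP.pos-* p (p ℕ.^ j)) (∣ℕ⇒∣ℤ (ℕD.∣-reflexive (ℕP.*-identityʳ _))) ∷ [])
        (x + + (p ℕ.^ j))))))
    where
    lem : ∀ x h → x ≡ x + h - h
    lem = solve-∀

  Lev⇒CC-single : ∀ p j A → p ≢ 0 → Lev p j A → CC ((p , suc j) ∷ []) A
  Lev⇒CC-single p j A p≢0 lev (h ∷ []) (d ∷ []) x = subst (λ s → cnt s (x - h) A - cnt s x A ≡ 0ℤ)
    (sym (ℕP.*-identityʳ (p ℕ.^ suc j)))
    (ℤP.i≡j⇒i-j≡0 (Lev⇒cnt-invariant p j A p≢0 lev x h
      (*-cancelˡ-∣ℤ p p≢0 (subst (_∣ℤ + p * h) (ℕP.*-identityʳ (p ℕ.^ suc j)) d))))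

  -- Divisibility by cyclotomic polynomials in terms of cuboids

  -- Sums of coefficients over the degrees congruent to x modulo s.
  np : ℕ → Poly → ℤ → ℤ
  np s []      x = 0ℤ
  np s (c ∷ F) x = c * δ s (0ℤ - x) + np s F (x - 1ℤ)

  np-zero : ∀ s F → F ≋ [] → ∀ x → np s F x ≡ 0ℤ
  np-zero s []      e x = refl
  np-zero s (c ∷ F) e x = cong₂ _+_ (trans (cong (_* δ s (0ℤ - x)) (at e 0)) (ℤP.*-zeroˡ (δ s (0ℤ - x))))
    (np-zero s F (mk λ i → at e (suc i)) (x - 1ℤ))

  np-cong : ∀ s F G → F ≋ G → ∀ x → np s F x ≡ np s G x
  np-cong s []      G       e x = sym (np-zero s G (≋-sym e) x)
  np-cong s (c ∷ F) []      e x = np-zero s (c ∷ F) e x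
  np-cong s (c ∷ F) (d ∷ G) e x = cong₂ _+_ (cong (_* δ s (0ℤ - x)) (at e 0))
    (np-cong s F G (mk λ i → at e (suc i)) (x - 1ℤ))

  np-+P : ∀ s F G x → np s (F +P G) x ≡ np s F x + np s G x
  np-+P s []      G       x = sym (ℤP.+-identityˡ _)
  np-+P s (c ∷ F) []      x = sym (ℤP.+-identityʳ _)
  np-+P s (c ∷ F) (d ∷ G) x = trans (cong (_+_ ((c + d) * δ s (0ℤ - x))) (np-+P s F G (x - 1ℤ)))
    (lem c d (δ s (0ℤ - x)) (np s F (x - 1ℤ)) (np s G (x - 1ℤ)))
    where
    lem : ∀ c d e u v → (c + d) * e + (u + v) ≡ (c * e + u) + (d * e + v)
    lem = solve-∀

  np-· : ∀ s c F x → np s (c · F) x ≡ c * np s F x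
  np-· s c []      x = sym (ℤP.*-zeroʳ c)
  np-· s c (d ∷ F) x = trans (cong (_+_ (c * d * δ s (0ℤ - x))) (np-· s c F (x - 1ℤ)))
    (lem c d (δ s (0ℤ - x)) (np s F (x - 1ℤ)))
    where
    lem : ∀ c d e u → c * d * e + c * u ≡ c * (d * e + u)
    lem = solve-∀

  np-X : ∀ s F x → np s (X· F) x ≡ np s F (x - 1ℤ)
  np-X s F x = trans (cong (_+ np s F (x - 1ℤ)) (ℤP.*-zeroˡ (δ s (0ℤ - x)))) (ℤP.+-identityˡ _)

  np-X^ : ∀ s n F x → np s (X^ n *P F) x ≡ np s F (x - + n)
  np-X^ s zero    F x = trans (np-cong s _ _ (*P-identityˡ F) x) (cong (np s F) (sym (ℤP.+-identityʳ x)))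
  np-X^ s (suc n) F x = trans (np-cong s _ _ (X-*P (X^ n) F) x) (trans (np-X s (X^ n *P F) x)
    (trans (np-X^ s n F (x - 1ℤ)) (cong (np s F) (trans (lem x (+ n)) (cong (λ k → x - k) (sym (ℤP.pos-+ 1 n)))))))
    where
    lem : ∀ x n → x - 1ℤ - n ≡ x - (1ℤ + n)
    lem = solve-∀

  np-X^-1 : ∀ s n F x → np s (X^-1 n *P F) x ≡ np s F (x - + n) - np s F x
  np-X^-1 s n F x = trans (np-cong s _ _ (lem (X^ n) F) x) (trans (np-+P s (X^ n *P F) (negP F) x)
    (cong₂ _+_ (np-X^ s n F x) (trans (np-· s -1ℤ F x) (ℤP.-1*i≡-i _))))
    where
    lem : ∀ P F → (P +P negP 1P) *P F ≋ P *P F +P negP F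
    lem = Ring.solve-∀ polyACR

  np-shift : ∀ s F x y → s ∣ℤ x - y → np s F x ≡ np s F y
  np-shift s []      x y h = refl
  np-shift s (c ∷ F) x y h = cong₂ _+_
    (cong (c *_) (δ-shift s (0ℤ - x) (0ℤ - y) (∣-cast (lem x y) (∣m⇒∣-m h))))
    (np-shift s F (x - 1ℤ) (y - 1ℤ) (∣-cast (lem₂ x y) h))
    where
    lem : ∀ x y → - (x - y) ≡ (0ℤ - x) - (0ℤ - y)
    lem = solve-∀
    lem₂ : ∀ x y → x - y ≡ (x - 1ℤ) - (y - 1ℤ)
    lem₂ = solve-∀

  np-as-sum : ∀ s F x → np s F x ≡ ∑< (length F) (λ k → coeff F k * δ s (+ k - x))
  np-as-sum s []      x = refl
  np-as-sum s (c ∷ F) x = cong (_+_ (c * δ s (0ℤ - x))) (trans (np-as-sum s F (x - 1ℤ))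
    (∑<-cong (length F) λ k _ → cong (λ z → coeff F k * δ s z)
      (trans (lem (+ k) x) (cong (_- x) (sym (ℤP.pos-+ 1 k))))))
    where
    lem : ∀ k x → k - (x - 1ℤ) ≡ (1ℤ + k) - x
    lem = solve-∀

  np-coeff : ∀ s F → length F ℕ.≤ s → ∀ i → i ℕ.< length F → np s F (+ i) ≡ coeff F i
  np-coeff s F F≤s i i<F = trans (np-as-sum s F (+ i)) (trans
    (∑<-pick (length F) i i<F λ k k<F k≢i → trans (cong (coeff F k *_)
      (δ-no λ h → k≢i (small-∣⇒≡ (ℕP.<-≤-trans k<F F≤s) (ℕP.<-≤-trans i<F F≤s) h))) (ℤP.*-zeroʳ (coeff F k)))
    (trans (cong (coeff F i *_) (δ-yes (∣-cast (sym (ℤP.+-inverseʳ (+ i))) ∣0))) (ℤP.*-identityʳ _)))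

  X^-1∣⇒np : ∀ s F → X^-1 s ∣ᴾ F → ∀ x → np s F x ≡ 0ℤ
  X^-1∣⇒np s F (divides Q e) x = trans (np-cong s _ _ e x) (trans (np-X^-1 s s Q x)
    (ℤP.i≡j⇒i-j≡0 (np-shift s Q (x - + s) x (∣-cast (lem x (+ s)) (∣-self -1ℤ)))))
    where
    lem : ∀ x s → -1ℤ * s ≡ x - s - x
    lem = solve-∀

  split-last : ∀ n L → length L ≡ suc n → Σ Poly λ G → Σ ℤ λ g → length G ≡ n × L ≋ G +P const g *P X^ n
  split-last n L l with initLast L
  split-last n .(G ++ g ∷ []) l | G ∷ʳ′ g =
    G , g , len , ≋-trans (snoc G g) (R.reflexive (cong (λ k → G +P const g *P X^ k) len))
    where
    len : length G ≡ n
    len = ℕP.suc-injective (trans (sym (trans (length-++ G) (ℕP.+-comm (length G) 1))) l)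

  *P-X : ∀ P Q → X· (P *P Q) ≋ P *P (X· Q)
  *P-X P Q = ≋-trans (X-cong (*P-comm P Q)) (≋-trans (≋-sym (X-*P Q P)) (*P-comm (X· Q) P))

  X^-1-remainder : ∀ s F → 1 ℕ.≤ s → Σ Poly λ Q → Σ Poly λ G → F ≋ X^-1 s *P Q +P G × length G ℕ.≤ s
  X^-1-remainder s []      1≤s = [] , [] , ≋-sym (≋-trans (+P-identityʳ _) (*P-zeroʳ (X^-1 s))) , z≤n
  X^-1-remainder s (c ∷ F) 1≤s = go (X^-1-remainder s F 1≤s)
    where
    go : (Σ Poly λ Q → Σ Poly λ G → F ≋ X^-1 s *P Q +P G × length G ℕ.≤ s) →
      Σ Poly λ Q → Σ Poly λ G → c ∷ F ≋ X^-1 s *P Q +P G × length G ℕ.≤ s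
    go (Q , G , e , G≤s) = fit (length (c ∷ G) ℕP.≤? s)
      where
      step : c ∷ F ≋ X^-1 s *P (X· Q) +P (c ∷ G)
      step = ≋-trans (∷-cong (sym (ℤP.+-identityˡ c)) e) (+P-congʳ (c ∷ G) (*P-X (X^-1 s) Q))
      fit : Dec (length (c ∷ G) ℕ.≤ s) → Σ Poly λ Q → Σ Poly λ G → c ∷ F ≋ X^-1 s *P Q +P G × length G ℕ.≤ s
      fit (yes small) = X· Q , c ∷ G , step , small
      -- The remainder has length s + 1: its top term g X^s becomes g, at the price of adding g to
      -- the quotient.
      fit (no big) with split-last s (c ∷ G) (cong suc (ℕP.≤-antisym G≤s (ℕP.≤-pred (ℕP.≰⇒> big))))
      ... | G′ , g , len , f = X· Q +P const g , G′ +P const g ,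
          ≋-trans step (≋-trans (+P-congˡ (X^-1 s *P (X· Q)) f) (lem (X^ s) (X· Q) G′ (const g))) , bound′ G′ len
        where
        lem : ∀ X Q G g → (X +P negP 1P) *P Q +P (G +P g *P X) ≋ (X +P negP 1P) *P (Q +P g) +P (G +P g)
        lem = Ring.solve-∀ polyACR
        bound′ : ∀ L → length L ≡ s → length (L +P const g) ℕ.≤ s
        bound′ []          l = 1≤s
        bound′ (x ∷ [])    l = ℕP.≤-reflexive l
        bound′ (x ∷ y ∷ L) l = ℕP.≤-reflexive l

  -- The remainder modulo X^s - 1 has at most one coefficient per residue, so its class sums are its
  -- coefficients.
  np⇒X^-1∣ : ∀ s F → 1 ℕ.≤ s → (∀ x → np s F x ≡ 0ℤ) → X^-1 s ∣ᴾ F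
  np⇒X^-1∣ s F 1≤s z with X^-1-remainder s F 1≤s
  ... | Q , G , e , G≤s = divides Q (≋-trans e (≋-trans (+P-congˡ (X^-1 s *P Q) G≋[]) (+P-identityʳ _)))
    where
    npG : ∀ x → np s G x ≡ 0ℤ
    npG x = trans (sym (ℤP.+-identityˡ _))
      (trans (cong (_+ np s G x) (sym (X^-1∣⇒np s (X^-1 s *P Q) (∣ᴾ-*ʳ Q ∣ᴾ-refl) x)))
      (trans (sym (np-+P s (X^-1 s *P Q) G x)) (trans (sym (np-cong s _ _ e x)) (z x))))
    G≋[] : G ≋ []
    G≋[] = mk λ i → coeff-zero i (i ℕP.<? length G)
      where
      coeff-zero : ∀ i → Dec (i ℕ.< length G) → coeff G i ≡ 0ℤ
      coeff-zero i (yes i<G) = trans (sym (np-coeff s G G≤s i i<G)) (npG (+ i))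
      coeff-zero i (no i≮G)  = Bound-length G i (ℕP.≮⇒≥ i≮G)

  differences : List ℕ → Poly → Poly
  differences hs F = foldr (λ h G → X^-1 h *P G) F hs

  np-differences : ∀ s hs F x → np s (differences hs F) x ≡ Cub (map +_ hs) (np s F) x
  np-differences s []       F x = refl
  np-differences s (h ∷ hs) F x = trans (np-X^-1 s h (differences hs F) x)
    (cong₂ _-_ (np-differences s hs F (x - + h)) (np-differences s hs F x))

  ∣-differences : ∀ {P} hs F → P ∣ᴾ F → P ∣ᴾ differences hs F
  ∣-differences []       F d = d
  ∣-differences (h ∷ hs) F d = ∣ᴾ-*ˡ (X^-1 h) (∣-differences hs F d)

  Φ-cancel-differences : ∀ {n F} hs → 1 ℕ.≤ n → All (λ h → ¬ n ℕD.∣ h) hs → Φ n ∣ᴾ differences hs F → Φ n ∣ᴾ F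
  Φ-cancel-differences []       1≤n []       d = d
  Φ-cancel-differences (h ∷ hs) 1≤n (k ∷ ks) d = Φ-cancel-differences hs 1≤n ks (Φ-cancel-X^-1 1≤n k d)

  -- From s = ℓ k d and s | ℓ h follows d | h, so `Φ d` divides the factor X^h - 1 that belongs to
  -- ℓ.
  direction∣ : ∀ {s ℓ d k : ℕ} (ps : List (ℕ × ℕ)) hs F → ℓ ≢ 0 → s ≡ ℓ ℕ.* (k ℕ.* d) → ℓ ∈ map proj₁ ps → 1 ℕ.≤ d →
    Pointwise (λ pα h → s ℕD.∣ proj₁ pα ℕ.* h) ps hs → Φ d ∣ᴾ differences hs F
  direction∣ {s} {ℓ} {d} {k} (_ ∷ ps) (h ∷ hs) F ℓ≢0 refl (here refl) 1≤d (r ∷ rs) = ∣ᴾ-*ʳ (differences hs F)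
    (∣ᴾ-trans (Cyclotomic.Φ∣X^-1 (cyclotomic d 1≤d)) (X^-1-mono
      (ℕD.∣-trans (ℕD.n∣m*n k) (ℕD.*-cancelˡ-∣ ℓ {{ℕ.≢-nonZero ℓ≢0}} r))))
  direction∣ {k = k} (_ ∷ ps) (h ∷ hs) F ℓ≢0 e (there m) 1≤d (r ∷ rs) =
    ∣ᴾ-*ˡ (X^-1 h) (direction∣ {k = k} ps hs F ℓ≢0 e m 1≤d rs)

  -- After reducing the directions to natural numbers it suffices that X^s - 1 divides the product
  -- of `F` and all X^h - 1. Test each `Φ d` with d | s: for d = s it divides `F`, and otherwise a
  -- prime ℓ dividing s/d names a direction whose factor it divides.
  Φ∣⇒Cuboid : ∀ ps F → All PrimePower ps → Φ (prod ps) ∣ᴾ F → Cuboid ps (np (prod ps) F)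
  Φ∣⇒Cuboid ps F gs Φ∣F hs ds x = trans
    (Cub-transfer (λ y y′ → prod ps ∣ℤ y - y′) {np s F} {np s F} (λ y y′ → np-shift s F y y′) (reduced hs) x x
      (∣-cast (sym (ℤP.+-inverseʳ x)) ∣0))
    (trans (sym (np-differences s (map (_%ℕ s) hs) F x)) (X^-1∣⇒np s _ X^-1∣ x))
    where
    s = prod ps
    instance
      s≢0 : ℕ.NonZero (prod ps)
      s≢0 = ℕ.≢-nonZero (prod≢0 ps gs)
    reduced : ∀ hs → Pointwise (λ h h′ → ∀ y y′ → s ∣ℤ y - y′ → s ∣ℤ (y - h) - (y′ - h′)) hs
      (map +_ (map (_%ℕ s) hs))
    reduced []       = []
    reduced (h ∷ hs) = (λ y y′ d → ∣-cast (lem y y′ h (+ (h %ℕ s))) (∣m∣n⇒∣m-n d (∣-%ℕ h))) ∷ reduced hs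
      where
      lem : ∀ y y′ h h′ → (y - y′) - (h - h′) ≡ (y - h) - (y′ - h′)
      lem = solve-∀
    reduced-∣ : ∀ {qs hs} → Pointwise (λ pα h → s ∣ℤ + proj₁ pα * h) qs hs →
      Pointwise (λ pα h → s ℕD.∣ proj₁ pα ℕ.* h) qs (map (_%ℕ s) hs)
    reduced-∣ [] = []
    reduced-∣ {(p , _) ∷ _} {h ∷ _} (d ∷ ds) =
      ∣ℤ⇒∣ℕ (∣-cast (trans (lem (+ p) h (+ (h %ℕ s))) (sym (ℤP.pos-* p (h %ℕ s))))
      (∣m∣n⇒∣m-n d (∣n⇒∣m*n (+ p) (∣-%ℕ h)))) ∷ reduced-∣ ds
      where
      lem : ∀ p h h′ → p * h - p * (h - h′) ≡ p * h′
      lem = solve-∀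
    X^-1∣ : X^-1 s ∣ᴾ differences (map (_%ℕ s) hs) F
    X^-1∣ = X^-1-∣ s (ℕ.>-nonZero⁻¹ s) (λ d _ 1≤d → cyclotomic d 1≤d) part
      where
      part : ∀ d → d ℕD.∣ s → 1 ℕ.≤ d → Φ d ∣ᴾ differences (map (_%ℕ s) hs) F
      part d d∣s@(ℕD.divides k eq) 1≤d with k ℕP.≟ 1
      ... | yes refl = ∣-differences (map (_%ℕ s) hs) F (subst (λ n → Φ n ∣ᴾ F) (trans eq (ℕP.+-identityʳ d)) Φ∣F)
      ... | no k≢1 with primeFactor k (λ { refl → prod≢0 ps gs eq }) k≢1
      ... | ℓ , pr , ℕD.divides k′ refl = direction∣ {k = k′} ps (map (_%ℕ s) hs) F (prime≢0 pr)
            (trans eq (trans (cong (ℕ._* d) (ℕP.*-comm k′ ℓ)) (ℕP.*-assoc ℓ k′ d)))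
            (prime∣prod ps gs pr (ℕD.divides (k′ ℕ.* d) (trans eq (trans (ℕP.*-assoc k′ ℓ d)
              (trans (cong (k′ ℕ.*_) (ℕP.*-comm ℓ d)) (sym (ℕP.*-assoc k′ d ℓ)))))))
            1≤d (reduced-∣ ds)

  directions : ∀ {s} → s ≢ 0 → ∀ qs → All PrimePower qs → All (λ pα → proj₁ pα ℕD.∣ s) qs →
    Σ (List ℕ) λ hs → Pointwise (λ pα h → s ∣ℤ + proj₁ pα * h) qs (map +_ hs) × All (λ h → ¬ s ℕD.∣ h) hs
  directions s≢0 []             []              []                          = [] , [] , []
  directions {s} s≢0 ((p , α) ∷ qs) ((pr , _) ∷ gs) (ℕD.divides h eq ∷ ds) with directions s≢0 qs gs ds
  ... | hs , rs , ks = h ∷ hs , ∣-cast (trans (cong +_ (trans eq (ℕP.*-comm h p))) (ℤP.pos-* p h))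
    (∣ℕ⇒∣ℤ ℕD.∣-refl) ∷ rs , s∤h ∷ ks
    where
    instance
      h≢0 : ℕ.NonZero h
      h≢0 = ℕ.≢-nonZero λ { refl → s≢0 eq }
    s∤h : ¬ s ℕD.∣ h
    s∤h s∣h = ℕP.<⇒≱ (subst (h ℕ.<_) (sym eq) (ℕP.m<m*n h p (ℕ.nonTrivial⇒n>1 p {{prime⇒nonTrivial pr}})))
      (ℕD.∣⇒≤ s∣h)

  -- For the directions h = s/p the vanishing makes X^s - 1, hence `Φ s`, divide the product of `F`
  -- and all X^h - 1. As s does not divide h, these factors can be cancelled.
  Cuboid⇒Φ∣ : ∀ ps F → All PrimePower ps → Cuboid ps (np (prod ps) F) → Φ (prod ps) ∣ᴾ F
  Cuboid⇒Φ∣ ps F gs cub with directions (prod≢0 ps gs) ps gs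
    (All.tabulate λ m → base∣ (All.lookup gs m) (∈⇒∣prod ps m))
    where
    base∣ : ∀ {pα} → PrimePower pα → proj₁ pα ℕ.^ proj₂ pα ℕD.∣ prod ps → proj₁ pα ℕD.∣ prod ps
    base∣ {p , suc α} _ d = ℕD.∣-trans (ℕD.m∣m*n (p ℕ.^ α)) d
  ... | hs , rs , ks = Φ-cancel-differences hs s≥1 ks (∣ᴾ-trans (Cyclotomic.Φ∣X^-1 (cyclotomic s s≥1))
      (np⇒X^-1∣ s (differences hs F) s≥1 λ x → trans (np-differences s hs F x) (cub (map +_ hs) rs x)))
    where
    s = prod ps
    s≥1 : 1 ℕ.≤ s
    s≥1 = ℕP.n≢0⇒n>0 (prod≢0 ps gs)

  -- The Frobenius congruence modulo a prime

  open import Algebra.Properties.CommutativeSemiring.Binomial R.commutativeSemiring using (binomialTerm) renaming (theorem to binomial-theorem)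
  open import Algebra.Properties.Semiring.Exp R.semiring using (_^_)
  open import Algebra.Properties.Semiring.Mult R.semiring using () renaming (_×_ to _×ᴾ_)
  open import Algebra.Properties.Semiring.Sum R.semiring using (sum)

  prime∤! : ∀ {p} k → Prime p → k ℕ.< p → ¬ p ∣ k !
  prime∤! zero    pr _   h = prime∣1 pr h
  prime∤! (suc k) pr k<p h with euclidsLemma (suc k) (k !) pr h
  ... | inj₁ p∣k = ℕP.<⇒≱ k<p (ℕD.∣⇒≤ p∣k)
  ... | inj₂ p∣k! = prime∤! k pr (ℕP.<-trans (ℕP.n<1+n k) k<p) p∣k!

  prime∣C : ∀ {p k} → Prime p → 0 ℕ.< k → k ℕ.< p → p ∣ p choose k
  prime∣C {p} {k} pr 0<k k<p with euclidsLemma (p choose k) (k ! ℕ.* (p ℕ.∸ k) !) pr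
    (subst (p ∣_) (sym eq) (p∣p! p (prime≢0 pr)))
    where
    instance
      _ = k ℕP.!* (p ℕ.∸ k) !≢0
    eq : (p choose k) ℕ.* (k ! ℕ.* (p ℕ.∸ k) !) ≡ p !
    eq = trans (cong (ℕ._* (k ! ℕ.* (p ℕ.∸ k) !)) (nCk≡n!/k![n-k]! (ℕP.<⇒≤ k<p)))
      (m/n*n≡m (k![n∸k]!∣n! (ℕP.<⇒≤ k<p)))
    p∣p! : ∀ p → p ≢ 0 → p ∣ p !
    p∣p! zero    h = ⊥-elim (h refl)
    p∣p! (suc p) _ = ℕD.m∣m*n (p !)
  ... | inj₁ h = h
  ... | inj₂ h with euclidsLemma (k !) ((p ℕ.∸ k) !) pr h
  ... | inj₁ h′ = ⊥-elim (prime∤! k pr k<p h′)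
  ... | inj₂ h′ = ⊥-elim (prime∤! (p ℕ.∸ k) pr (ℕP.∸-monoʳ-< 0<k (ℕP.<⇒≤ k<p)) h′)

  ×ᴾ-const : ∀ n P → n ×ᴾ P ≋ const (+ n) *P P
  ×ᴾ-const zero    P = ≋-sym (≋-trans (const-*P 0ℤ P) (0· P))
  ×ᴾ-const (suc n) P = ≋-trans (+P-congˡ P (×ᴾ-const n P)) (lem (const (+ n)) P)
    where
    lem : ∀ N P → P +P N *P P ≋ (1P +P N) *P P
    lem = Ring.solve-∀ polyACR

  const∣ : ∀ {r n} P → r ∣ n → const (+ r) ∣ᴾ n ×ᴾ P
  const∣ {r} P (ℕD.divides q refl) = divides (const (+ q) *P P) (≋-trans (×ᴾ-const (q ℕ.* r) P)
    (≋-trans (*P-congˡ {const (+ (q ℕ.* r))} {const (+ r) *P const (+ q)} P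
      (∷-cong (trans (ℤP.pos-* q r) (trans (ℤP.*-comm (+ q) (+ r)) (sym (ℤP.+-identityʳ _)))) ≋-refl))
      (*P-assoc (const (+ r)) (const (+ q)) P)))

  sum-last : ∀ {D} n (t : Fin (suc n) → Poly) → (∀ k → toℕ k ≢ n → D ∣ᴾ t k) → D ∣ᴾ sum t +P negP (t (fromℕ n))
  sum-last {D} zero t h = divides [] (≋-trans (lem (t Fin.zero)) (≋-sym (*P-zeroʳ D)))
    where
    lem : ∀ P → (P +P []) +P negP P ≋ []
    lem P = ≋-trans (+P-congʳ (negP P) (+P-identityʳ P)) (+P-inverseʳ P)
  sum-last (suc n) t h = ∣ᴾ-resp (≋-sym (+P-assoc (t Fin.zero) (sum (t ∘ Fin.suc)) (negP (t (fromℕ (suc n))))))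
    (∣ᴾ-+ (h Fin.zero λ ()) (sum-last n (t ∘ Fin.suc) λ k k≢n → h (Fin.suc k) (k≢n ∘ ℕP.suc-injective)))

  freshman : ∀ {p} → Prime p → ∀ x y → const (+ p) ∣ᴾ (x +P y) ^ p +P negP (x ^ p +P y ^ p)
  freshman {zero} pr x y = ⊥-elim (prime≢0 pr refl)
  freshman {p@(suc n)} pr x y = ∣ᴾ-resp
    (≋-trans (lem (first) (sum tail) (tail (fromℕ n)))
      (+P-cong (≋-sym (binomial-theorem p x y))
        (R.-‿cong (≋-trans (+P-comm first (tail (fromℕ n))) (+P-cong last≋ first≋)))))
    (sum-last n tail λ k k≢n → const∣ _ (prime∣C pr (s≤s z≤n) (s≤s (ℕP.≤∧≢⇒< (ℕP.≤-pred (toℕ<n k)) k≢n))))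
    where
    term : Fin (suc p) → Poly
    term = binomialTerm x y p
    first = term Fin.zero
    tail : Fin p → Poly
    tail k = term (Fin.suc k)
    lem : ∀ F S L → S +P negP L ≋ (F +P S) +P negP (F +P L)
    lem = Ring.solve-∀ polyACR
    first≋ : first ≋ y ^ p
    first≋ = ≋-trans (+P-identityʳ _) (*P-identityˡ _)
    last≋ : tail (fromℕ n) ≋ x ^ p
    last≋ = ≋-trans (R.reflexive (cong₂ (λ c k → c ×ᴾ (x ^ suc k *P y ^ (n ℕ.∸ k)))
        (trans (cong (λ k → p choose suc k) (toℕ-fromℕ n)) (nCn≡1 p)) (toℕ-fromℕ n)))
      (≋-trans (+P-identityʳ _) (≋-trans (*P-congʳ (x ^ p) (R.reflexive (cong (y ^_) (ℕP.n∸n≡0 n))))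
        (R.*-identityʳ _)))

  maskL : List ℕ → Poly
  maskL []      = []
  maskL (a ∷ A) = X^ a +P maskL A

  X^-^ : ∀ a n → (X^ a) ^ n ≋ X^ (n ℕ.* a)
  X^-^ a zero    = ≋-refl
  X^-^ a (suc n) = ≋-trans (*P-congʳ (X^ a) (X^-^ a n)) (≋-sym (X^-+ a (n ℕ.* a)))

  -- Divisibility by `const (+ p)` is congruence modulo p; `freshman` splits off one monomial at a
  -- time.
  frobenius : ∀ {p} → Prime p → ∀ A → const (+ p) ∣ᴾ maskL A ^ p +P negP (maskL (map (p ℕ.*_) A))
  frobenius {zero} pr A = ⊥-elim (prime≢0 pr refl)
  frobenius {suc n} pr [] = divides [] (≋-sym (*P-zeroʳ (const (+ suc n))))
  frobenius {p@(suc n)} pr (a ∷ A) = ∣ᴾ-resp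
    (≋-trans (+P-congʳ (maskL A ^ p +P negP (maskL (map (p ℕ.*_) A)))
      (+P-congˡ ((X^ a +P maskL A) ^ p) (R.-‿cong (+P-congʳ (maskL A ^ p) (X^-^ a p)))))
      (lem ((X^ a +P maskL A) ^ p) (X^ (p ℕ.* a)) (maskL A ^ p) (maskL (map (p ℕ.*_) A))))
    (∣ᴾ-+ (freshman pr (X^ a) (maskL A)) (frobenius pr A))
    where
    lem : ∀ S X Q R → (S +P negP (X +P Q)) +P (Q +P negP R) ≋ S +P negP (X +P R)
    lem = Ring.solve-∀ polyACR

  -- Tilings

  -- Integer lists replace subsets of Z_M because dilates, slices and quotients need not consist of
  -- reduced residues. Pairs are counted with multiplicity.
  Tile : ℕ → List ℤ → List ℤ → Set
  Tile M A B = ∀ x → ∑ₗ A (λ a → cnt M (x - a) B) ≡ 1ℤ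

  Tile-total : ∀ M .{{_ : ℕ.NonZero M}} A B → ∑< M (λ i → ∑ₗ A (λ a → cnt M (+ i - a) B)) ≡ +
    (length A ℕ.* length B)
  Tile-total M A B = trans (sym (∑ₗ-∑<-swap A M _)) (trans (∑ₗ-cong A λ a → trans (sym (∑ₗ-∑<-swap B M _))
      (trans (∑ₗ-cong B λ b → trans (∑<-cong M λ i _ → cong (δ M) (lem b (+ i) a)) (∑<-δ M (b + a))) (∑ₗ-one B)))
    (trans (∑ₗ-const A (+ length B)) (sym (ℤP.pos-* (length A) (length B)))))
    where
    lem : ∀ b i a → b - (i - a) ≡ (b + a) - i
    lem = solve-∀

  Tile-size : ∀ M .{{_ : ℕ.NonZero M}} A B → Tile M A B → length A ℕ.* length B ≡ M
  Tile-size M A B t = ℤP.+-injective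
    (trans (sym (Tile-total M A B))
    (trans (∑<-cong M λ i _ → t (+ i)) (trans (∑<-const M 1ℤ) (ℤP.*-identityʳ (+ M)))))

  rep-shift : ∀ M A B x y → M ∣ℤ x - y → ∑ₗ A (λ a → cnt M (x - a) B) ≡ ∑ₗ A (λ a → cnt M (y - a) B)
  rep-shift M A B x y h = ∑ₗ-cong A λ a → cnt-shift M (x - a) (y - a) B (∣-cast (lem x y a) h)
    where
    lem : ∀ x y a → x - y ≡ (x - a) - (y - a)
    lem = solve-∀

  -- There are |A||B| = M pairs for M residues, so one pair for each residue leaves no second one.
  Tile-from-≥1 : ∀ M .{{_ : ℕ.NonZero M}} A B → length A ℕ.* length B ≡ M →
    (∀ x → 1ℤ ≤ ∑ₗ A (λ a → cnt M (x - a) B)) → Tile M A B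
  Tile-from-≥1 M A B size h x = trans (rep-shift M A B x (+ (x %ℕ M)) (∣-%ℕ x))
    (∑<-≡1 M (λ i → ∑ₗ A (λ a → cnt M (+ i - a) B)) (λ i _ → h (+ i)) (trans (Tile-total M A B) (cong +_ size))
      (x %ℕ M) (n%ℕd<d x M))

  Tile-comm : ∀ {M A B} → Tile M A B → Tile M B A
  Tile-comm {M} {A} {B} t x = trans (∑ₗ-swap B A _)
    (trans (∑ₗ-cong A λ a → ∑ₗ-cong B λ b → cong (δ M) (lem a b x)) (t x))
    where
    lem : ∀ a b x → a - (x - b) ≡ b - (x - a)
    lem = solve-∀

  np-maskL-* : ∀ s A F x → np s (maskL A *P F) x ≡ ∑ₗ A (λ a → np s F (x - + a))
  np-maskL-* s []      F x = refl
  np-maskL-* s (a ∷ A) F x = trans (np-cong s _ _ (*P-distribʳ F (X^ a) (maskL A)) x)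
    (trans (np-+P s (X^ a *P F) (maskL A *P F) x) (cong₂ _+_ (np-X^ s a F x) (np-maskL-* s A F x)))

  np-maskL : ∀ s A x → np s (maskL A) x ≡ cnt s x (map +_ A)
  np-maskL s []      x = refl
  np-maskL s (a ∷ A) x = trans (np-+P s (X^ a) (maskL A) x) (cong₂ _+_
    (trans (np-cong s _ _ (≋-sym (R.*-identityʳ (X^ a))) x) (trans (np-X^ s a 1P x)
      (trans (ℤP.+-identityʳ _) (trans (ℤP.*-identityˡ (δ s (0ℤ - (x - + a)))) (cong (δ s) (lem x (+ a)))))))
    (np-maskL s A x))
    where
    lem : ∀ x a → 0ℤ - (x - a) ≡ a - x
    lem = solve-∀

  prime∣^ℤ : ∀ {p} n k → Prime p → p ∣ℤ (+ n) ℤ.^ k → p ∣ n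
  prime∣^ℤ n zero    pr h = ⊥-elim (prime∣1 pr (∣ℤ⇒∣ℕ h))
  prime∣^ℤ n (suc k) pr h with euclidsLemmaℤ (+ n) _ pr h
  ... | inj₁ h′ = ∣ℤ⇒∣ℕ h′
  ... | inj₂ h′ = prime∣^ℤ n k pr h′

  reduce : ∀ M .{{_ : ℕ.NonZero M}} → List ℤ → List ℕ
  reduce M = map (_%ℕ M)

  ∑ₗ-reduce : ∀ M .{{_ : ℕ.NonZero M}} A (f : ℤ → ℤ) → (∀ x y → M ∣ℤ x - y → f x ≡ f y) →
    ∑ₗ (reduce M A) (λ a → f (+ a)) ≡ ∑ₗ A f
  ∑ₗ-reduce M A f h = trans (∑ₗ-map (_%ℕ M) A (λ a → f (+ a))) (∑ₗ-cong A λ a → sym (h a (+ (a %ℕ M)) (∣-%ℕ a)))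

  cnt-reduce : ∀ M .{{_ : ℕ.NonZero M}} A x → cnt M x (map +_ (reduce M A)) ≡ cnt M x A
  cnt-reduce M A x = trans (∑ₗ-map +_ (reduce M A) _) (∑ₗ-reduce M A (λ a → δ M (a - x))
    λ y z h → δ-shift M (y - x) (z - x) (∣-cast (lem y z x) h))
    where
    lem : ∀ y z x → y - z ≡ (y - x) - (z - x)
    lem = solve-∀

  -- Modulo r the r-th power of A(X) is A(X^r), and A(X)^(r-1) times the full sum is |A|^(r-1).
  Tile-dilate-prime : ∀ M .{{_ : ℕ.NonZero M}} {r} A B → Prime r → ¬ r ∣ length A → Tile M A B →
    Tile M (map (+ r *_) A) B
  Tile-dilate-prime M {zero} A B pr r∤A t = ⊥-elim (prime≢0 pr refl)
  Tile-dilate-prime M {r@(suc n)} A B pr r∤A t = Tile-from-≥1 M (map (+ r *_) A) B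
    (trans (cong (ℕ._* length B) (length-map (+ r *_) A)) (Tile-size M A B t)) λ x → ≥1 x
    where
    A′ = reduce M A
    B′ = reduce M B
    F = maskL B′
    npF : ∀ x → np M F x ≡ cnt M x B
    npF x = trans (np-maskL M B′ x) (cnt-reduce M B x)
    npAF : ∀ x → np M (maskL A′ *P F) x ≡ 1ℤ
    npAF x = trans (np-maskL-* M A′ F x) (trans (∑ₗ-cong A′ λ a → npF (x - + a))
      (trans (∑ₗ-reduce M A (λ a → cnt M (x - a) B) λ y z h →
        cnt-shift M (x - y) (x - z) B (∣-cast (lem x y z) (∣-flip y z h))) (t x)))
      where
      lem : ∀ x y z → z - y ≡ (x - y) - (x - z)
      lem = solve-∀
    powers : ∀ k x → np M (maskL A′ ^ suc k *P F) x ≡ (+ length A) ℤ.^ k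
    powers zero    x = trans (np-cong M _ _ (*P-congˡ F (R.*-identityʳ (maskL A′))) x) (npAF x)
    powers (suc k) x = trans (np-cong M _ _ (*P-assoc (maskL A′) (maskL A′ ^ suc k) F) x)
      (trans (np-maskL-* M A′ (maskL A′ ^ suc k *P F) x) (trans (∑ₗ-cong A′ λ a → powers k (x - + a))
        (trans (∑ₗ-const A′ _) (cong (λ l → + l * (+ length A) ℤ.^ k) (length-map (_%ℕ M) A)))))
    dilated : ∀ x → np M (maskL (map (r ℕ.*_) A′) *P F) x ≡ ∑ₗ (map (+ r *_) A) (λ a → cnt M (x - a) B)
    dilated x = trans (np-maskL-* M (map (r ℕ.*_) A′) F x) (trans (∑ₗ-map (r ℕ.*_) A′ _)
      (trans (∑ₗ-cong A′ λ a → trans (npF (x - + (r ℕ.* a))) (cong (λ k → cnt M (x - k) B) (ℤP.pos-* r a)))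
      (trans (∑ₗ-reduce M A (λ a → cnt M (x - + r * a) B) λ y z h → cnt-shift M (x - + r * y) (x - + r * z) B
          (∣-cast (lem x y z (+ r)) (∣n⇒∣m*n (+ r) (∣-flip y z h))))
        (sym (∑ₗ-map (+ r *_) A _)))))
      where
      lem : ∀ x y z r → r * (z - y) ≡ (x - r * y) - (x - r * z)
      lem = solve-∀
    frob = frobenius pr A′
    E = quotient frob
    congruence : ∀ x → (+ length A) ℤ.^ n ≡ + r * np M (E *P F) x + ∑ₗ (map (+ r *_) A) (λ a → cnt M (x - a) B)
    congruence x = trans (sym (powers n x))
      (trans (np-cong M _ _ split x) (trans (np-+P M (const (+ r) *P (E *P F)) (maskL (map (r ℕ.*_) A′) *P F) x)
      (cong₂ _+_ (trans (np-cong M (const (+ r) *P (E *P F)) ((+ r) · (E *P F)) (const-*P (+ r) (E *P F)) x)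
        (np-· M (+ r) (E *P F) x)) (dilated x))))
      where
      lem : ∀ P Q F → P *P F ≋ (P +P negP Q) *P F +P Q *P F
      lem = Ring.solve-∀ polyACR
      split : maskL A′ ^ r *P F ≋ const (+ r) *P (E *P F) +P maskL (map (r ℕ.*_) A′) *P F
      split = ≋-trans (lem (maskL A′ ^ r) (maskL (map (r ℕ.*_) A′)) F)
        (+P-congʳ (maskL (map (r ℕ.*_) A′) *P F)
          (≋-trans (*P-congˡ F (equality frob)) (*P-assoc (const (+ r)) E F)))
    ≥1 : ∀ x → 1ℤ ≤ ∑ₗ (map (+ r *_) A) (λ a → cnt M (x - a) B)
    -- A residue without representation would make r divide |A|^(r-1).
    ≥1 x = positive (∑ₗ≥0 (map (+ r *_) A) λ a → cnt≥0 M (x - a) B) λ z → r∤A (prime∣^ℤ (length A) n pr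
      (∣-cast (sym (trans (congruence x)
        (trans (cong (_+_ (+ r * np M (E *P F) x)) z)
        (trans (ℤP.+-identityʳ (+ r * np M (E *P F) x)) (ℤP.*-comm (+ r) (np M (E *P F) x))))))
        (∣-self (np M (E *P F) x))))
      where
      positive : ∀ {z} → 0ℤ ≤ z → z ≢ 0ℤ → 1ℤ ≤ z
      positive {+ zero}  _ h = ⊥-elim (h refl)
      positive {+ suc n} _ h = +≤+ (s≤s z≤n)

  -- The prime factors of r act one after the other; dilation keeps |A|, so the hypothesis persists.
  Tile-dilate : ∀ M .{{_ : ℕ.NonZero M}} r A B → r ≢ 0 → (∀ ℓ → Prime ℓ → ℓ ∣ r → ¬ ℓ ∣ length A) → Tile M A B →
    Tile M (map (+ r *_) A) B
  Tile-dilate M r A B r≢0 h t = subst (λ k → Tile M (map (+ k *_) A) B) (sym (PrimeFactorisation.isFactorisation f))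
    (go (PrimeFactorisation.factors f) (PrimeFactorisation.factorsPrime f) λ ℓ pr d →
      h ℓ pr (subst (ℓ ∣_) (sym (PrimeFactorisation.isFactorisation f)) d))
    where
    f = factorise r {{ℕ.≢-nonZero r≢0}}
    go : ∀ ls → All Prime ls → (∀ ℓ → Prime ℓ → ℓ ∣ product ls → ¬ ℓ ∣ length A) →
      Tile M (map (+ product ls *_) A) B
    go []       []         _ = subst (λ L → Tile M L B) (sym (trans (map-cong ℤP.*-identityˡ A) (map-id A))) t
    go (ℓ ∷ ls) (pr ∷ prs) g = subst (λ L → Tile M L B)
      (trans (sym (map-∘ A)) (map-cong (λ a → trans (sym (ℤP.*-assoc (+ ℓ) (+ product ls) a))
        (cong (_* a) (sym (ℤP.pos-* ℓ (product ls))))) A))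
      (Tile-dilate-prime M (map (+ product ls *_) A) B pr
        (λ d → g ℓ pr (ℕD.m∣m*n (product ls)) (subst (ℓ ∣_) (length-map _ A) d))
        (go ls prs λ ℓ′ pr′ d → g ℓ′ pr′ (ℕD.∣n⇒∣m*n ℓ d)))

  ∑ₗ-≥-two : ∀ {A : Set} {xs : List A} {x y} (f : A → ℤ) →
    (∀ x → 0ℤ ≤ f x) → x ∈ xs → y ∈ xs → x ≢ y → f x + f y ≤ ∑ₗ xs f
  ∑ₗ-≥-two f h (here refl) (here refl) x≢y = ⊥-elim (x≢y refl)
  ∑ₗ-≥-two {x = x} f h (here refl) (there m)   x≢y = ℤP.+-monoʳ-≤ (f x) (∑ₗ-≥-term f h m)
  ∑ₗ-≥-two {x = x} {y} f h (there m)   (here refl) x≢y = ℤP.≤-trans (ℤP.≤-reflexive (ℤP.+-comm (f x) (f y)))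
    (ℤP.+-monoʳ-≤ (f y) (∑ₗ-≥-term f h m))
  ∑ₗ-≥-two {xs = z ∷ xs} {x} {y} f h (there m)   (there m′)  x≢y =
    ℤP.≤-trans (ℤP.≤-reflexive (sym (ℤP.+-identityˡ (f x + f y)))) (ℤP.+-mono-≤ (h z) (∑ₗ-≥-two f h m m′ x≢y))

  2≰1 : ∀ {x y} → 1ℤ ≤ x → 1ℤ ≤ y → ¬ (x + y ≤ 1ℤ)
  2≰1 h k l with ℤP.≤-trans (ℤP.+-mono-≤ h k) l
  ... | +≤+ (s≤s ())

  cnt-member : ∀ {M x A a} → a ∈ A → M ∣ℤ a - x → 1ℤ ≤ cnt M x A
  cnt-member {M} {x} {A} {a} a∈A h =
    ℤP.≤-trans (ℤP.≤-reflexive (sym (δ-yes h))) (∑ₗ-≥-term (λ a → δ M (a - x)) (λ a → 𝟙≥0 _) a∈A)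

  Tile-injective : ∀ {M A B} → Tile M A B → ∀ {a a′ b b′} → a ∈ A → a′ ∈ A → b ∈ B → b′ ∈ B →
    M ∣ℤ (a + b) - (a′ + b′) → a ≡ a′ × b ≡ b′
  Tile-injective {M} {A} {B} t {a} {a′} {b} {b′} a∈ a′∈ b∈ b′∈ h = a≡ (a ℤP.≟ a′) , b≡ (b ℤP.≟ b′)
    where
    x = a + b
    f : ℤ → ℤ
    f a = cnt M (x - a) B
    hb : M ∣ℤ b - (x - a)
    hb = ∣-cast (lem a b) ∣0
      where
      lem : ∀ a b → 0ℤ ≡ b - (a + b - a)
      lem = solve-∀
    hb′ : M ∣ℤ b′ - (x - a′)
    hb′ = ∣-cast (lem a b a′ b′) (∣m⇒∣-m h)
      where
      lem : ∀ a b a′ b′ → - ((a + b) - (a′ + b′)) ≡ b′ - (a + b - a′)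
      lem = solve-∀
    a≡ : Dec (a ≡ a′) → a ≡ a′
    a≡ (yes e) = e
    a≡ (no a≢a′) = ⊥-elim (2≰1 (cnt-member b∈ hb) (cnt-member b′∈ hb′)
      (ℤP.≤-trans (∑ₗ-≥-two f (λ a → cnt≥0 M (x - a) B) a∈ a′∈ a≢a′) (ℤP.≤-reflexive (t x))))
    b≡ : Dec (b ≡ b′) → b ≡ b′
    b≡ (yes e) = e
    b≡ (no b≢b′) = ⊥-elim (2≰1 (ℤP.≤-reflexive (sym (δ-yes hb)))
      (ℤP.≤-reflexive (sym (δ-yes (subst (λ c → M ∣ℤ b′ - (x - c)) (sym (a≡ (a ℤP.≟ a′))) hb′))))
      (ℤP.≤-trans (∑ₗ-≥-two (λ b → δ M (b - (x - a))) (λ b → 𝟙≥0 _) b∈ b′∈ b≢b′)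
        (ℤP.≤-trans (∑ₗ-≥-term f (λ a → cnt≥0 M (x - a) B) a∈) (ℤP.≤-reflexive (t x)))))

  Tile-surjective : ∀ {M A B} → Tile M A B → ∀ x → ∃ λ a → ∃ λ b → a ∈ A × b ∈ B × M ∣ℤ (a + b) - x
  Tile-surjective {M} {A} {B} t x with ∑ₗ≢0 A (λ a → cnt M (x - a) B) (λ e → 1≢0 (trans (sym (t x)) e))
  ... | a , a∈ , h with ∑ₗ≢0 B (λ b → δ M (b - (x - a))) h
  ... | b , b∈ , k = a , b , a∈ , b∈ , ∣-cast (lem a b x) (𝟙≢0 (+ M ∣? (b - (x - a))) k)
    where
    lem : ∀ a b x → b - (x - a) ≡ (a + b) - x
    lem = solve-∀

  -- A class modulo s is a union of t classes modulo M, each represented once.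
  Tile-modulo : ∀ {M A B} t .{{_ : ℕ.NonZero t}} s → s ≢ 0 → M ≡ t ℕ.* s → Tile M A B → ∀ x →
    ∑ₗ A (λ a → cnt s (x - a) B) ≡ + t
  Tile-modulo {M} {A} {B} t s s≢0 refl tile x = trans (∑ₗ-cong A λ a → cnt-split t s s≢0 (x - a) B)
    (trans (∑ₗ-∑<-swap A t _) (trans (∑<-cong t λ j _ →
      trans (∑ₗ-cong A λ a → cong (λ z → cnt (t ℕ.* s) z B) (lem x a (+ j * + s))) (tile (x + + j * + s)))
      (trans (∑<-const t 1ℤ) (ℤP.*-identityʳ (+ t)))))
    where
    lem : ∀ x a w → x - a + w ≡ x + w - a
    lem = solve-∀

  Tile-translate : ∀ {M A B} z → Tile M A B → Tile M (map (_- z) A) B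
  Tile-translate {M} {A} {B} z t x =
    trans (∑ₗ-map (_- z) A _) (trans (∑ₗ-cong A λ a → cong (λ w → cnt M w B) (lem x a z)) (t (x + z)))
    where
    lem : ∀ x a z → x - (a - z) ≡ x + z - a
    lem = solve-∀

  -- Conditions at prime powers

  ∑<-++ : ∀ m n f → ∑< (m ℕ.+ n) f ≡ ∑< m f + ∑< n (λ i → f (m ℕ.+ i))
  ∑<-++ zero    n f = sym (ℤP.+-identityˡ _)
  ∑<-++ (suc m) n f = trans (cong (_+_ (f 0)) (∑<-++ m n (f ∘ suc))) (sym (ℤP.+-assoc (f 0) _ _))

  ∑<-blocks : ∀ m p f → ∑< (m ℕ.* p) f ≡ ∑< m (λ k → ∑< p (λ i → f (k ℕ.* p ℕ.+ i)))
  ∑<-blocks zero    p f = refl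
  ∑<-blocks (suc m) p f = trans (∑<-++ p (m ℕ.* p) f) (cong (_+_ (∑< p f))
    (trans (∑<-blocks m p (λ i → f (p ℕ.+ i)))
      (∑<-cong m λ k _ → ∑<-cong p λ i _ → cong f (sym (ℕP.+-assoc p (k ℕ.* p) i)))))

  -- Let k be the product of the primes of `N` that do not divide r. A prime of `N` dividing r
  -- divides neither k nor s; any other prime of `N` divides k s but not r.
  unit-lift : ∀ r s N → N ≢ 0 → (∀ ℓ → Prime ℓ → ℓ ∣ r → ¬ ℓ ∣ s) →
    ∃ λ k → ∀ ℓ → Prime ℓ → ℓ ∣ r ℕ.+ k ℕ.* s → ¬ ℓ ∣ N
  unit-lift r s N N≢0 cop = k , good
    where
    f = factorise N {{ℕ.≢-nonZero N≢0}}
    ls = filter (λ ℓ → ¬? (ℓ ℕD.∣? r)) (PrimeFactorisation.factors f)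
    k = product ls
    good : ∀ ℓ → Prime ℓ → ℓ ∣ r ℕ.+ k ℕ.* s → ¬ ℓ ∣ N
    good ℓ pr h ℓ∣N with ℓ ℕD.∣? r
    ... | no ℓ∤r = ℓ∤r (ℕD.∣m+n∣m⇒∣n (subst (ℓ ∣_) (ℕP.+-comm r (k ℕ.* s)) h) (ℕD.∣m⇒∣m*n s (∈⇒∣product
          (∈-filter⁺ (λ ℓ → ¬? (ℓ ℕD.∣? r))
            (factorisationHasAllPrimeFactors pr (subst (ℓ ∣_) (PrimeFactorisation.isFactorisation f) ℓ∣N)
            (PrimeFactorisation.factorsPrime f)) ℓ∤r))))
    ... | yes ℓ∣r with euclidsLemma k s pr (ℕD.∣m+n∣m⇒∣n h ℓ∣r)
    ... | inj₂ ℓ∣s = cop ℓ pr ℓ∣r ℓ∣s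
    ... | inj₁ ℓ∣k = proj₂ (∈-filter⁻ (λ ℓ → ¬? (ℓ ℕD.∣? r)) {xs = PrimeFactorisation.factors f}
          (factorisationHasAllPrimeFactors pr ℓ∣k
            (AllP.filter⁺ (λ ℓ → ¬? (ℓ ℕD.∣? r)) (PrimeFactorisation.factorsPrime f)))) ℓ∣r

  proper-divisor-prime^ : ∀ {p d} j → Prime p → d ∣ p ℕ.^ suc j → d ≢ p ℕ.^ suc j → d ∣ p ℕ.^ j
  proper-divisor-prime^ {p} {d} j pr (ℕD.divides e eq) d≢ with primeFactor e
      (λ { refl → prime≢0 pr (ℕP.m^n≡0⇒m≡0 p (suc j) eq) }) (λ { refl → d≢ (sym (trans eq (ℕP.+-identityʳ d))) })
  ... | ℓ , pℓ , ℕD.divides e′ refl with prime∣prime pℓ pr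
    (prime∣^ p (suc j) pℓ (ℕD.∣-trans (ℕD.n∣m*n e′) (ℕD.divides d (trans eq (ℕP.*-comm (e′ ℕ.* ℓ) d)))))
  ... | refl = ℕD.divides e′ (ℕP.*-cancelˡ-≡ _ _ p {{prime⇒nonZero pr}}
    (trans eq (trans (cong (ℕ._* d) (ℕP.*-comm e′ p)) (ℕP.*-assoc p e′ d))))

  -- The gcd of c and p^(j+1) is a proper divisor of p^(j+1), hence divides p^j, and Bézout writes
  -- it as a multiple of c.
  multiple-hits : ∀ {p} j c → Prime p → ¬ p ℕ.^ suc j ∣ℤ c → ∃ λ r → p ℕ.^ suc j ∣ℤ + r * c - + (p ℕ.^ j)
  multiple-hits {p} j c pr s∤c = go (Bézout.identity (GCD.gcd-GCD c₀ s))
    where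
    s = p ℕ.^ suc j
    instance
      s≢0 : ℕ.NonZero s
      s≢0 = ℕP.m^n≢0 p (suc j) {{prime⇒nonZero pr}}
    c₀ = c %ℕ s
    d = gcd c₀ s
    d∣m : d ∣ p ℕ.^ j
    d∣m = proper-divisor-prime^ j pr (gcd[m,n]∣n c₀ s) λ d≡s → s∤c
      (∣-cast (lem c (+ c₀)) (∣m∣n⇒∣m+n (∣-%ℕ c) (∣ℕ⇒∣ℤ (subst (_∣ c₀) d≡s (gcd[m,n]∣m c₀ s)))))
      where
      lem : ∀ c c₀ → c - c₀ + c₀ ≡ c
      lem = solve-∀
    k = ℕD.quotient d∣m
    m≡kd : + (p ℕ.^ j) ≡ + k * + d
    m≡kd = trans (cong +_ (ℕD._∣_.equality d∣m)) (ℤP.pos-* k d)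
    finish : ∀ x → s ∣ℤ + x * + c₀ - + d → ∃ λ r → s ∣ℤ + r * c - + (p ℕ.^ j)
    finish x h = k ℕ.* x , subst₂ (λ R m → s ∣ℤ R * c - m) (sym (ℤP.pos-* k x)) (sym m≡kd)
      (∣-cast (lem (+ k) (+ x) c (+ c₀) (+ d)) (∣m∣n⇒∣m+n (∣n⇒∣m*n (+ k) h) (∣n⇒∣m*n (+ k * + x) (∣-%ℕ c))))
      where
      lem : ∀ k x c c₀ d → k * (x * c₀ - d) + k * x * (c - c₀) ≡ k * x * c - k * d
      lem = solve-∀
    go : Bézout.Identity d c₀ s → ∃ λ r → s ∣ℤ + r * c - + (p ℕ.^ j)
    go (Bézout.+- x y eq) = finish x (divides (+ y) (trans (cong (_- + d) (trans (sym (ℤP.pos-* x c₀))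
        (trans (cong +_ (sym eq)) (trans (ℤP.pos-+ d (y ℕ.* s)) (cong (_+_ (+ d)) (ℤP.pos-* y s))))))
          (x+y-x≡y (+ d) (+ y * + s))))
    -- The multiplier -x is replaced by the natural number x (s - 1), congruent to it modulo s.
    go (Bézout.-+ x y eq) = finish (x ℕ.* (s ℕ.∸ 1)) (∣-cast (trans (lem (+ x) (+ s) (+ c₀) (+ d))
        (cong (λ w → w * + c₀ - + d) (trans (cong (_*_ (+ x)) (sym s-1)) (sym (ℤP.pos-* x (s ℕ.∸ 1))))))
        (∣m∣n⇒∣m-n (∣n⇒∣m*n (+ x * + c₀) (∣-self 1ℤ))
          (divides (+ y) (trans (trans (cong (_+_ (+ d)) (sym (ℤP.pos-* x c₀))) (sym (ℤP.pos-+ d (x ℕ.* c₀))))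
            (trans (cong +_ eq) (ℤP.pos-* y s))))))
      where
      s-1 : + (s ℕ.∸ 1) ≡ + s - 1ℤ
      s-1 = sym (trans (ℤP.m-n≡m⊖n s 1) (ℤP.⊖-≥ (ℕ.>-nonZero⁻¹ s)))
      lem : ∀ x s c₀ d → x * c₀ * (1ℤ * s) - (d + x * c₀) ≡ x * (s - 1ℤ) * c₀ - d
      lem = solve-∀

  -- Σ_{r<n} w (r c) over a period n; when s ∤ c the multiples of c meet every coset of p^j.
  module MultiplesSum {p : ℕ} (j : ℕ) (pr : Prime p) (B : List ℤ) where
    s = p ℕ.^ suc j
    m = p ℕ.^ j

    w : ℤ → ℤ → ℤ
    w c y = cnt s (y - c) B

    w-cong : ∀ c c′ y → s ∣ℤ c - c′ → w c y ≡ w c′ y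
    w-cong c c′ y h = cnt-shift s (y - c) (y - c′) B (∣-cast (lem c c′ y) (∣m⇒∣-m h))
      where
      lem : ∀ c c′ y → - (c - c′) ≡ (y - c) - (y - c′)
      lem = solve-∀

    W : ℕ → ℤ → ℤ → ℤ
    W n c y = ∑< n (λ r → w (+ r * c) y)

    W-invariant : ∀ n c y → s ∣ℤ + n * c → ¬ s ∣ℤ c → W n c (y + + m) ≡ W n c y
    W-invariant n c y per s∤c with multiple-hits j c pr s∤c
    ... | r₀ , hit = trans (sym (∑<-rotate n (λ r → w (+ r * c) (y + + m))
      (λ i → w-cong (+ (i ℕ.+ n) * c) (+ i * c) (y + + m)
        (∣-cast (trans (lem (+ i) (+ n) c) (cong (λ z → z * c - + i * c) (sym (ℤP.pos-+ i n)))) per)) r₀))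
      (∑<-cong n λ i _ → cnt-shift s (y + + m - + (i ℕ.+ r₀) * c) (y - + i * c) B
        (∣-cast (trans (lem₂ (+ i) (+ r₀) c y (+ m))
          (cong (λ z → (y + + m - z * c) - (y - + i * c)) (sym (ℤP.pos-+ i r₀)))) (∣m⇒∣-m hit)))
      where
      lem : ∀ i n c → n * c ≡ (i + n) * c - i * c
      lem = solve-∀
      lem₂ : ∀ i r c y m → - (r * c - m) ≡ (y + m - (i + r) * c) - (y - i * c)
      lem₂ = solve-∀

    W-zero : ∀ n c y → s ∣ℤ c → W n c y ≡ + n * w 0ℤ y
    W-zero n c y h = trans (∑<-cong n λ r _ →
      w-cong (+ r * c) 0ℤ y (∣-cast (sym (ℤP.+-identityʳ _)) (∣n⇒∣m*n (+ r) h))) (∑<-const n _)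

    W-difference : ∀ n c y → s ∣ℤ + n * c → W n c y - W n c (y + + m) ≡ + n * (w 0ℤ y - w 0ℤ (y + + m)) * δ s c
    W-difference n c y per with + s ∣? c
    ... | yes h = trans (cong₂ _-_ (W-zero n c y h) (W-zero n c (y + + m) h)) (lem (+ n) (w 0ℤ y) (w 0ℤ (y + + m)))
      where
      lem : ∀ n u v → n * u - n * v ≡ n * (u - v) * 1ℤ
      lem = solve-∀
    ... | no ¬h = trans (ℤP.i≡j⇒i-j≡0 (sym (W-invariant n c y per ¬h)))
      (sym (ℤP.*-zeroʳ (+ n * (w 0ℤ y - w 0ℤ (y + + m)))))

  ∑ₗ-W : ∀ (A : List ℤ) n (w : ℤ → ℤ → ℤ) y → ∑ₗ A (λ a → ∑< n (λ r → w (+ r * a) y)) ≡ ∑< n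
    (λ r → ∑ₗ A (λ a → w (+ r * a) y))
  ∑ₗ-W A n w y = ∑ₗ-∑<-swap A n (λ a r → w (+ r * a) y)

  -- The sum of the dilations by all units r modulo s of the representation counts modulo s.
  prime-power-product : ∀ {M p} j A B .{{_ : ℕ.NonZero M}} → Prime p → p ℕ.^ suc j ∣ M → Tile M A B → ∀ y →
    (+ p * cnt (p ℕ.^ suc j) 0ℤ A - cnt (p ℕ.^ j) 0ℤ A) *
      (cnt (p ℕ.^ suc j) y B - cnt (p ℕ.^ suc j) (y + + (p ℕ.^ j)) B) ≡ 0ℤ
  prime-power-product {M} {p@(suc p′)} j A B pr (ℕD.divides t eqM) tile y = cancel-m
    where
    open MultiplesSum j pr B
    M≢0 : M ≢ 0
    M≢0 = ℕ.≢-nonZero⁻¹ M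
    instance
      t≢0 : ℕ.NonZero t
      t≢0 = ℕ.≢-nonZero λ { refl → M≢0 eqM }
      m≢0 : ℕ.NonZero m
      m≢0 = ℕP.m^n≢0 p j
    s≢0 : s ≢ 0
    s≢0 e = prime≢0 pr (ℕP.m^n≡0⇒m≡0 p (suc j) e)
    g : ℤ → ℕ → ℤ
    g y r = ∑ₗ A (λ a → w (+ r * a) y)
    -- A unit r modulo s is replaced by r + k s coprime to M. Dilation by it preserves the tiling,
    -- so each class modulo s is represented t = M/s times.
    g-unit : ∀ y r → ¬ p ∣ r → g y r ≡ + t
    g-unit y r p∤r with unit-lift r s M M≢0
      (λ ℓ pℓ ℓ∣r ℓ∣s → p∤r (subst (_∣ r) (prime∣prime pℓ pr (prime∣^ p (suc j) pℓ ℓ∣s)) ℓ∣r))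
    ... | k , good = trans (∑ₗ-cong A λ a → w-cong (+ r * a) (+ (r ℕ.+ k ℕ.* s) * a) y
        (∣-cast (lem′ a) (∣n⇒∣m*n (- + k * a) (∣-self 1ℤ))))
      (trans (sym (∑ₗ-map (+ (r ℕ.+ k ℕ.* s) *_) A (λ c → w c y)))
        (Tile-modulo {A = map (+ (r ℕ.+ k ℕ.* s) *_) A} {B} t s s≢0 eqM
          (Tile-dilate M (r ℕ.+ k ℕ.* s) A B r′≢0
          (λ ℓ pℓ ℓ∣r′ ℓ∣A → good ℓ pℓ ℓ∣r′
          (ℕD.∣-trans ℓ∣A (ℕD.divides (length B)
          (trans (sym (Tile-size M A B tile)) (ℕP.*-comm (length A) (length B)))))) tile) y))
      where
      lem : ∀ r k s a → (- k * a) * (1ℤ * s) ≡ r * a - (r + k * s) * a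
      lem = solve-∀
      lem′ : ∀ a → (- + k * a) * (1ℤ * + s) ≡ + r * a - + (r ℕ.+ k ℕ.* s) * a
      lem′ a = trans (lem (+ r) (+ k) (+ s) a)
        (cong (λ z → + r * a - z * a) (sym (trans (ℤP.pos-+ r (k ℕ.* s)) (cong (_+_ (+ r)) (ℤP.pos-* k s)))))
      r′≢0 : r ℕ.+ k ℕ.* s ≢ 0
      r′≢0 e = p∤r (subst (p ∣_) (sym (ℕP.m+n≡0⇒m≡0 r e)) (p ℕD.∣0))
    -- The multipliers r below s fall into blocks of p: the multiples of p are kept, and all others
    -- contribute t each, independently of y.
    total : ∀ y → ∑< s (g y) ≡ ∑< m (λ k → g y (k ℕ.* p)) + + m * (+ p′ * + t)
    total y = trans (cong (λ n → ∑< n (g y)) (ℕP.*-comm p m)) (trans (∑<-blocks m p (g y))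
      (trans (∑<-cong m λ k _ → cong₂ _+_ (cong (g y) (ℕP.+-identityʳ (k ℕ.* p)))
          (trans (∑<-cong p′ λ i i<p′ → g-unit y _ λ d →
            ℕP.<⇒≱ (s≤s i<p′) (ℕD.∣⇒≤ (ℕD.∣m+n∣m⇒∣n d (ℕD.n∣m*n k)))) (∑<-const p′ (+ t))))
        (trans (∑<-+ m (λ k → g y (k ℕ.* p)) (λ _ → + p′ * + t))
          (cong (_+_ (∑< m (λ k → g y (k ℕ.* p)))) (∑<-const m (+ p′ * + t))))))
    d = w 0ℤ y - w 0ℤ (y + + m)
    G H : ℤ → ℤ
    G y = ∑< s (g y)
    H y = ∑< m (λ k → g y (k ℕ.* p))
    G≡ : ∀ y → G y ≡ ∑ₗ A (λ a → W s a y)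
    G≡ y = sym (∑ₗ-W A s w y)
    H≡ : ∀ y → H y ≡ ∑ₗ A (λ a → W m (+ p * a) y)
    H≡ y = trans (∑<-cong m λ k _ → ∑ₗ-cong A λ a →
      cong (λ c → w c y) (trans (cong (_* a) (ℤP.pos-* k p)) (ℤP.*-assoc (+ k) (+ p) a)))
      (sym (∑ₗ-∑<-swap A m (λ a r → w (+ r * (+ p * a)) y)))
    G-diff : G y - G (y + + m) ≡ + s * d * cnt s 0ℤ A
    G-diff = trans (cong₂ _-_ (G≡ y) (G≡ (y + + m))) (trans (sym (∑ₗ-- A _ _))
      (trans (∑ₗ-cong A λ a → trans (W-difference s a y (∣m⇒∣m*n a ∣ℤ-refl))
          (cong (λ z → + s * d * δ s z) (sym (ℤP.+-identityʳ a)))) (∑ₗ-* A (+ s * d) _)))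
    δ-scale : ∀ a → δ s (+ p * a) ≡ δ m (a - 0ℤ)
    δ-scale a = trans (δ-cong {s} {m} {+ p * a} {a} (*-cancelˡ-∣ℤ p λ ()) (*-monoʳ-∣ℤ p))
      (cong (δ m) (sym (ℤP.+-identityʳ a)))
    H-diff : H y - H (y + + m) ≡ + m * d * cnt m 0ℤ A
    H-diff = trans (cong₂ _-_ (H≡ y) (H≡ (y + + m))) (trans (sym (∑ₗ-- A _ _))
      (trans (∑ₗ-cong A λ a → trans (W-difference m (+ p * a) y
        (∣-cast (trans (cong (_* a) (ℤP.pos-* p m)) (lem (+ p) (+ m) a)) (∣m⇒∣m*n a ∣ℤ-refl)))
          (cong (+ m * d *_) (δ-scale a))) (∑ₗ-* A (+ m * d) _)))
      where
      lem : ∀ p m a → p * m * a ≡ m * (p * a)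
      lem = solve-∀
    -- In the difference between y and y + p^j the contribution of the units cancels. What remains
    -- compares all multipliers with the multiples of p.
    equal : + s * d * cnt s 0ℤ A ≡ + m * d * cnt m 0ℤ A
    equal = trans (sym G-diff) (trans (cong₂ _-_ (total y) (total (y + + m)))
      (trans (lem (H y) (H (y + + m)) (+ m * (+ p′ * + t))) H-diff))
      where
      lem : ∀ u v c → (u + c) - (v + c) ≡ u - v
      lem = solve-∀
    cancel-m : (+ p * cnt s 0ℤ A - cnt m 0ℤ A) * (cnt s y B - cnt s (y + + m) B) ≡ 0ℤ
    cancel-m = ℤP.*-cancelˡ-≡ (+ m) _ 0ℤ
      (trans (cong (λ e → + m * ((+ p * cnt s 0ℤ A - cnt m 0ℤ A) * e))
      (cong₂ _-_ (cong (λ z → cnt s z B) (sym (ℤP.+-identityʳ y)))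
      (cong (λ z → cnt s z B) (sym (ℤP.+-identityʳ (y + + m))))))
      (trans (lem (+ p) (+ m) (cnt s 0ℤ A) (cnt m 0ℤ A) d)
        (trans (cong (λ z → z * d * cnt s 0ℤ A - + m * d * cnt m 0ℤ A) (sym (ℤP.pos-* p m)))
        (trans (ℤP.i≡j⇒i-j≡0 equal) (sym (ℤP.*-zeroʳ (+ m)))))))
      where
      lem : ∀ p m u v d → m * ((p * u - v) * d) ≡ p * m * d * u - m * d * v
      lem = solve-∀

  -- In `prime-power-product` the second factor concerns `B` alone. If it is nonzero for one y, the
  -- first factor vanishes for every translate of `A`; if it is zero for all y in a period, `B` is
  -- equidistributed.
  Lev-dichotomy : ∀ {M p} j A B .{{_ : ℕ.NonZero M}} → Prime p → p ℕ.^ suc j ∣ M → Tile M A B →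
    Lev p j A ⊎ Lev p j B
  Lev-dichotomy {M} {p} j A B pr s∣M tile with ℕP.anyUpTo? (λ y → ¬? (cnt s (+ y) B ℤP.≟ cnt s (+ y + + m) B)) s
    where
    s = p ℕ.^ suc j
    m = p ℕ.^ j
  ... | yes (y , _ , ne) = inj₁ λ x → ℤP.i-j≡0⇒i≡j _ _ (level x)
    where
    s = p ℕ.^ suc j
    m = p ℕ.^ j
    translate : ∀ k x → cnt k 0ℤ (map (_- x) A) ≡ cnt k x A
    translate k x = trans (∑ₗ-map (_- x) A _) (∑ₗ-cong A λ a → cong (δ k) (ℤP.+-identityʳ (a - x)))
    level : ∀ x → + p * cnt s x A - cnt m x A ≡ 0ℤ
    level x with ℤP.i*j≡0⇒i≡0∨j≡0 (+ p * cnt s x A - cnt m x A)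
      (subst₂ (λ u v → (+ p * u - v) * (cnt s (+ y) B - cnt s (+ y + + m) B) ≡ 0ℤ) (translate s x) (translate m x)
      (prime-power-product j (map (_- x) A) B pr s∣M (Tile-translate {A = A} {B} x tile) (+ y)))
    ... | inj₁ e = e
    ... | inj₂ e = ⊥-elim (ne (ℤP.i-j≡0⇒i≡j _ _ e))
  ... | no none = inj₂ (cnt-invariant⇒Lev p j B (prime≢0 pr) inv)
    where
    s = p ℕ.^ suc j
    m = p ℕ.^ j
    instance
      s≢0 : ℕ.NonZero s
      s≢0 = ℕP.m^n≢0 p (suc j) {{prime⇒nonZero pr}}
    inv : ∀ x → cnt s (x + + m) B ≡ cnt s x B
    inv x with cnt s (+ (x %ℕ s)) B ℤP.≟ cnt s (+ (x %ℕ s) + + m) B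
    ... | no ne = ⊥-elim (none (x %ℕ s , n%ℕd<d x s , ne))
    ... | yes e = trans (cnt-shift s (x + + m) (+ (x %ℕ s) + + m) B (∣-cast (lem x (+ (x %ℕ s)) (+ m)) (∣-%ℕ x)))
        (trans (sym e) (cnt-shift s (+ (x %ℕ s)) x B (∣-flip x (+ (x %ℕ s)) (∣-%ℕ x))))
      where
      lem : ∀ x y m → x - y ≡ (x + m) - (y + m)
      lem = solve-∀

  -- Counting the conditions at powers of one prime

  weight : ∀ {X : Set} → Maybe X → ℕ
  weight (just _) = 1
  weight nothing  = 0

  -- A record of the conditions to be counted: `nothing` means that the level is not counted, not
  -- that its condition fails.
  Levels : ℕ → List ℤ → Set
  Levels p A = ∀ i → Maybe (Lev p i A)

  total-weight : ∀ p A → Levels p A → ℕ → ℕ → ℕ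
  total-weight p A lev k zero    = 0
  total-weight p A lev k (suc t) = weight (lev k) ℕ.+ total-weight p A lev (suc k) t

  -- At a recorded level the count modulo p^k is p times a count modulo p^(k+1); at any other level
  -- it is a sum of such counts.
  Levels-divide : ∀ p A (lev : Levels p A) → p ≢ 0 → ∀ t k x → p ℕ.^ total-weight p A lev k t ∣ℤ cnt (p ℕ.^ k) x A
  Levels-divide p A lev p≢0 zero    k x = ∣-cast (ℤP.*-identityʳ (cnt (p ℕ.^ k) x A)) (∣-self (cnt (p ℕ.^ k) x A))
  Levels-divide p A lev p≢0 (suc t) k x with lev k
  ... | just l  = ∣-cast (l x) (*-monoʳ-∣ℤ p (Levels-divide p A lev p≢0 t (suc k) x))
  ... | nothing = ∣-cast (sym (cnt-split p {{ℕ.≢-nonZero p≢0}} (p ℕ.^ k) (λ e → p≢0 (ℕP.m^n≡0⇒m≡0 p k e)) x A))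
      (∑<-∣ p (λ i → cnt (p ℕ.^ suc k) (x + + i * + (p ℕ.^ k)) A) λ i → Levels-divide p A lev p≢0 t (suc k) _)

  cnt-refine : ∀ p k x A → cnt (p ℕ.^ suc k) x A ≤ cnt (p ℕ.^ k) x A
  cnt-refine p k x A = ∑ₗ-mono A λ {a} _ → go a
    where
    go : ∀ a → δ (p ℕ.^ suc k) (a - x) ≤ δ (p ℕ.^ k) (a - x)
    go a with + (p ℕ.^ suc k) ∣? (a - x)
    ... | yes h = ℤP.≤-reflexive (sym (δ-yes (∣ℤ-trans (ℕD.n∣m*n p) h)))
    ... | no _  = 𝟙≥0 _

  -- Each recorded level multiplies the count by p on passing to the coarser class, and every other
  -- level at least does not decrease it.
  Levels-bound : ∀ p A (lev : Levels p A) → p ≢ 0 → ∀ t k x → + (p ℕ.^ total-weight p A lev k t) * cnt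
    (p ℕ.^ (t ℕ.+ k)) x A ≤ cnt (p ℕ.^ k) x A
  Levels-bound p A lev p≢0 zero    k x = ℤP.≤-reflexive (ℤP.*-identityˡ _)
  Levels-bound p A lev p≢0 (suc t) k x with lev k | subst
    (λ n → + (p ℕ.^ total-weight p A lev (suc k) t) * cnt (p ℕ.^ n) x A ≤ cnt (p ℕ.^ suc k) x A) (ℕP.+-suc t k)
    (Levels-bound p A lev p≢0 t (suc k) x)
  ... | just l  | b = ℤP.≤-trans (ℤP.≤-reflexive
    (trans (cong (_* c) (ℤP.pos-* p (p ℕ.^ total-weight p A lev (suc k) t))) (ℤP.*-assoc (+ p) _ _)))
      (ℤP.≤-trans (ℤP.*-monoˡ-≤-nonNeg (+ p) b) (ℤP.≤-reflexive (l x)))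
    where c = cnt (p ℕ.^ (suc t ℕ.+ k)) x A
  ... | nothing | b = ℤP.≤-trans b (cnt-refine p k x A)

  cnt-1 : ∀ x A → cnt 1 x A ≡ + length A
  cnt-1 x A = trans (∑ₗ-cong A λ a → δ-yes (∣-cast (ℤP.*-identityʳ (a - x)) (∣-self (a - x)))) (∑ₗ-one A)

  total-weight-+ : ∀ p A B (levA : Levels p A) (levB : Levels p B) k t →
    + (total-weight p A levA k t ℕ.+ total-weight p B levB k t) ≡ ∑< t
      (λ i → + (weight (levA (k ℕ.+ i)) ℕ.+ weight (levB (k ℕ.+ i))))
  total-weight-+ p A B levA levB k zero    = refl
  total-weight-+ p A B levA levB k (suc t) =
    trans (cong +_ (lem (weight (levA k)) (total-weight p A levA (suc k) t) (weight (levB k))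
    (total-weight p B levB (suc k) t)))
    (trans (ℤP.pos-+ (weight (levA k) ℕ.+ weight (levB k)) _)
      (cong₂ _+_ (cong (λ i → + (weight (levA i) ℕ.+ weight (levB i))) (sym (ℕP.+-identityʳ k)))
      (trans (total-weight-+ p A B levA levB (suc k) t)
        (∑<-cong t λ i _ → cong (λ i → + (weight (levA i) ℕ.+ weight (levB i))) (sym (ℕP.+-suc k i))))))
    where
    open import Data.Nat.Tactic.RingSolver using () renaming (solve-∀ to ℕ-solve-∀)
    lem : ∀ a b c d → (a ℕ.+ b) ℕ.+ (c ℕ.+ d) ≡ (a ℕ.+ c) ℕ.+ (b ℕ.+ d)
    lem = ℕ-solve-∀

  ∑<-below : ∀ n v → v ℕ.≤ n → ∑< n (λ i → 𝟙 (i ℕP.<? v)) ≡ + v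
  ∑<-below n       zero    _         = ∑<-zero n λ i _ → 𝟙-no (i ℕP.<? 0) λ ()
  ∑<-below (suc n) (suc v) (s≤s v≤n) = trans (cong₂ _+_ (𝟙-yes (0 ℕP.<? suc v) (s≤s z≤n))
    (trans (∑<-cong n λ i _ → 𝟙-cong (suc i ℕP.<? suc v) (i ℕP.<? v) ℕP.≤-pred s≤s) (∑<-below n v v≤n)))
      (sym (ℤP.pos-+ 1 v))

  -- The last hypothesis asks for one condition at every level below v and for an additional one at
  -- level j, which accounts for `suc v`.
  total-weight-lower : ∀ p A B (levA : Levels p A) (levB : Levels p B) n v j → v ℕ.≤ n → j ℕ.< n →
    (∀ i → 𝟙 (i ℕP.<? v) + 𝟙 (i ℕP.≟ j) ≤ + (weight (levA i) ℕ.+ weight (levB i))) →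
    suc v ℕ.≤ total-weight p A levA 0 n ℕ.+ total-weight p B levB 0 n
  total-weight-lower p A B levA levB n v j v≤n j<n h =
    ℤP.drop‿+≤+ (ℤP.≤-trans (ℤP.≤-reflexive (sym (trans (∑<-+ n _ _)
    (trans (cong₂ _+_ (∑<-below n v v≤n)
      (trans (∑<-pick n j j<n λ i _ i≢j → 𝟙-no (i ℕP.≟ j) i≢j) (𝟙-yes (j ℕP.≟ j) refl)))
      (trans (ℤP.+-comm (+ v) 1ℤ) (sym (ℤP.pos-+ 1 v)))))))
    (ℤP.≤-trans (∑<-mono n λ i _ → h i) (ℤP.≤-reflexive (sym (total-weight-+ p A B levA levB 0 n)))))

  ^-cancel-∣ : ∀ {p v e M₂} → Prime p → ¬ p ∣ M₂ → p ℕ.^ e ∣ p ℕ.^ v ℕ.* M₂ → e ℕ.≤ v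
  ^-cancel-∣ {p} {v} {zero} pr h d = z≤n
  ^-cancel-∣ {p} {zero} {suc e} {M₂} pr h d =
    ⊥-elim (h (subst (p ∣_) (ℕP.+-identityʳ M₂) (ℕD.∣-trans (ℕD.m∣m*n (p ℕ.^ e)) d)))
  ^-cancel-∣ {p} {suc v} {suc e} {M₂} pr h d = s≤s (^-cancel-∣ {p} {v} {e} pr h
    (ℕD.*-cancelˡ-∣ p {{prime⇒nonZero pr}} (subst (p ℕ.* p ℕ.^ e ∣_) (ℕP.*-assoc p (p ℕ.^ v) M₂) d)))

  Levels-size : ∀ {M p A B v M₂} .{{_ : ℕ.NonZero M}} (levA : Levels p A) (levB : Levels p B) n → Prime p →
    ¬ p ∣ M₂ → M ≡ p ℕ.^ v ℕ.* M₂ →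
    Tile M A B → total-weight p A levA 0 n ℕ.+ total-weight p B levB 0 n ℕ.≤ v
  Levels-size {M} {p} {A} {B} levA levB n pr p∤M₂ eq tile = ^-cancel-∣ pr p∤M₂
    (subst₂ _∣_ (sym (ℕP.^-distribˡ-+-* p (total-weight p A levA 0 n) (total-weight p B levB 0 n)))
      (trans (Tile-size M A B tile) eq)
      (ℕD.*-pres-∣ (size levA) (size levB)))
    where
    size : ∀ {A} (lev : Levels p A) → p ℕ.^ total-weight p A lev 0 n ∣ length A
    size {A} lev = ∣ℤ⇒∣ℕ (∣-cast (cnt-1 0ℤ A) (Levels-divide p A lev (prime≢0 pr) n 0 0ℤ))

  -- T1: a second condition at level j, or one beyond v, would make |A||B| divisible by p^(v+1).
  Lev-exclusive : ∀ {M p v M₂} j A B .{{_ : ℕ.NonZero M}} → Prime p → ¬ p ∣ M₂ → M ≡ p ℕ.^ v ℕ.* M₂ → Tile M A B →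
    Lev p j A → j ℕ.< v × ¬ Lev p j B
  Lev-exclusive {M} {p} {v} {M₂} j A B pr p∤M₂ eq tile levAj = j<v , λ levBj → clash (λ _ → levBj)
    where
    dich : ∀ i → i ℕ.< v → Lev p i A ⊎ Lev p i B
    dich i i<v = Lev-dichotomy i A B pr
      (ℕD.∣-trans (ℕD.∣-trans (^-mono-∣ p i<v) (ℕD.m∣m*n M₂)) (ℕD.∣-reflexive (sym eq))) tile
    -- Serves both conclusions. For j < v the argument is the second condition to be refuted; for j
    -- ≥ v it is vacuous, and the condition of `A` at level j is already one too many.
    clash : (j ℕ.< v → Lev p j B) → ⊥
    clash levBj = ℕP.<⇒≱ (total-weight-lower p A B levA levB (v ℕ.⊔ suc j) v j (ℕP.m≤m⊔n v (suc j))
      (ℕP.m≤n⊔m v (suc j)) weights)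
      (Levels-size {A = A} {B} levA levB (v ℕ.⊔ suc j) pr p∤M₂ eq tile)
      where
      left : ∀ {X Y : Set} → X ⊎ Y → Maybe X
      left (inj₁ l) = just l
      left (inj₂ _) = nothing
      right : ∀ {X Y : Set} → X ⊎ Y → Maybe Y
      right (inj₁ _) = nothing
      right (inj₂ l) = just l
      pickA : ∀ i → Dec (i ≡ j) → Dec (i ℕ.< v) → Maybe (Lev p i A)
      pickA i (yes refl) _         = just levAj
      pickA i (no _)     (no _)    = nothing
      pickA i (no _)     (yes i<v) = left (dich i i<v)
      pickB : ∀ i → Dec (i ≡ j) → Dec (i ℕ.< v) → Maybe (Lev p i B)
      pickB i (yes refl) (yes i<v) = just (levBj i<v)
      pickB i _          (no _)    = nothing
      pickB i (no _)     (yes i<v) = right (dich i i<v)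
      levA : Levels p A
      levA i = pickA i (i ℕP.≟ j) (i ℕP.<? v)
      levB : Levels p B
      levB i = pickB i (i ℕP.≟ j) (i ℕP.<? v)
      weights : ∀ i → 𝟙 (i ℕP.<? v) + 𝟙 (i ℕP.≟ j) ≤ + (weight (levA i) ℕ.+ weight (levB i))
      weights i = go (i ℕP.≟ j) (i ℕP.<? v)
        where
        one : ∀ {X Y : Set} (s : X ⊎ Y) → 1ℤ ≤ + (weight (left s) ℕ.+ weight (right s))
        one (inj₁ _) = ℤP.≤-refl
        one (inj₂ _) = ℤP.≤-refl
        go : ∀ d e → 𝟙 e + 𝟙 d ≤ + (weight (pickA i d e) ℕ.+ weight (pickB i d e))
        go (yes refl) (yes _)   = ℤP.≤-refl
        go (yes refl) (no _)    = ℤP.≤-refl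
        go (no _)     (no _)    = ℤP.≤-refl
        go (no _)     (yes i<v) = one (dich i i<v)
    j<v : j ℕ.< v
    j<v with j ℕP.<? v
    ... | yes h = h
    ... | no h  = ⊥-elim (clash λ j<v → ⊥-elim (h j<v))

  valuation : ∀ {p} → Prime p → ∀ M → M ≢ 0 → ∃ λ v → ∃ λ M₂ → M ≡ p ℕ.^ v ℕ.* M₂ × ¬ p ∣ M₂
  valuation {p} pr = <-rec _ go
    where
    go : ∀ M → (∀ {N} → N ℕ.< M → N ≢ 0 → ∃ λ v → ∃ λ M₂ → N ≡ p ℕ.^ v ℕ.* M₂ × ¬ p ∣ M₂) → M ≢ 0 → ∃ λ v →
      ∃ λ M₂ → M ≡ p ℕ.^ v ℕ.* M₂ × ¬ p ∣ M₂
    go M rec M≢0 with p ℕD.∣? M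
    ... | no p∤M = 0 , M , sym (ℕP.+-identityʳ M) , p∤M
    ... | yes (ℕD.divides N eq) with rec
      (subst (N ℕ.<_) (sym eq) (ℕP.m<m*n N p {{ℕ.≢-nonZero N≢0}} (ℕ.nonTrivial⇒n>1 p {{prime⇒nonTrivial pr}}))) N≢0
      where
      N≢0 : N ≢ 0
      N≢0 refl = M≢0 eq
    ... | v , M₂ , eq′ , h = suc v , M₂ , trans eq
      (trans (ℕP.*-comm N p) (trans (cong (p ℕ.*_) eq′) (sym (ℕP.*-assoc p (p ℕ.^ v) M₂)))) , h

  Lev-absent : ∀ {M p} j A B .{{_ : ℕ.NonZero M}} → Prime p → Tile M A B → Lev p j A → p ℕ.^ suc j ∣ M × ¬ Lev p j B
  Lev-absent {M} {p} j A B pr tile lev = conclude (valuation pr M (ℕ.≢-nonZero⁻¹ M))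
    where
    conclude : (∃ λ v → ∃ λ M₂ → M ≡ p ℕ.^ v ℕ.* M₂ × ¬ p ∣ M₂) → p ℕ.^ suc j ∣ M × ¬ Lev p j B
    conclude (v , M₂ , eq , h) =
      let (j<v , ¬levB) = Lev-exclusive {v = v} j A B pr h eq tile lev
      in subst (p ℕ.^ suc j ∣_) (sym eq) (ℕD.∣m⇒∣m*n M₂ (^-mono-∣ p j<v)) , ¬levB

  Lev⇒∣length : ∀ {p} j A → p ≢ 0 → Lev p j A → p ∣ length A
  Lev⇒∣length {p} j A p≢0 lev = ∣ℤ⇒∣ℕ (∣-cast (cnt-1 0ℤ A) (go j (λ x → ∣-cast (lev x) (∣m⇒∣m*n _ ∣ℤ-refl)) 0ℤ))
    where
    go : ∀ k → (∀ x → p ∣ℤ cnt (p ℕ.^ k) x A) → ∀ x → p ∣ℤ cnt 1 x A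
    go zero    h = h
    go (suc k) h = go k λ x → ∣-cast (sym
      (cnt-split p {{ℕ.≢-nonZero p≢0}} (p ℕ.^ k) (λ e → p≢0 (ℕP.m^n≡0⇒m≡0 p k e)) x A))
      (∑<-∣ p (λ i → cnt (p ℕ.^ suc k) (x + + i * + (p ℕ.^ k)) A) λ i → h _)

  -- With e levels of A below n, p^e |A ∩ class| ≤ |A|, while the remaining n + 1 - e levels belong to B,
  -- so that |B| is p^(n+1-e) times a multiple of every prime of M₁.
  class-bound : ∀ {p n M₁ M} A B .{{_ : ℕ.NonZero M}} → Prime p → ¬ p ∣ M₁ → M ≡ p ℕ.^ suc n ℕ.* M₁ →
    Tile M A B → Lev p n B →
    (∀ m → m ≢ 0 → (∀ q → Prime q → q ∣ M₁ → q ∣ m) → M₁ ℕ.< p ℕ.* m) →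
    (∀ q → Prime q → q ∣ M₁ → q ∣ length B) → ∀ x → cnt (p ℕ.^ n) x A < + p
  class-bound {p} {n} {M₁} {M} A B pr p∤M₁ eq tile levB small rad∣B x = ℤP.≰⇒> λ p≤c →
    ℕP.<⇒≱ (small b b≢0 rad∣b) (counting p≤c)
    where
    M≢0 : M ≢ 0
    M≢0 = ℕ.≢-nonZero⁻¹ M
    p≢0 = prime≢0 pr
    dich : ∀ i → i ℕ.< n → Lev p i A ⊎ Lev p i B
    dich i i<n = Lev-dichotomy i A B pr
      (subst (p ℕ.^ suc i ∣_) (sym eq) (ℕD.∣m⇒∣m*n M₁ (^-mono-∣ p (ℕP.m≤n⇒m≤1+n i<n)))) tile
    pickA : ∀ i → Dec (i ℕ.< n) → Maybe (Lev p i A)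
    pickA i (no _) = nothing
    pickA i (yes i<n) with dich i i<n
    ... | inj₁ l = just l
    ... | inj₂ _ = nothing
    pickB : ∀ i → Dec (i ℕ.< n) → Dec (i ≡ n) → Maybe (Lev p i B)
    pickB i _ (yes refl) = just levB
    pickB i (no _) (no _) = nothing
    pickB i (yes i<n) (no _) with dich i i<n
    ... | inj₁ _ = nothing
    ... | inj₂ l = just l
    lA : Levels p A
    lA i = pickA i (i ℕP.<? n)
    lB : Levels p B
    lB i = pickB i (i ℕP.<? n) (i ℕP.≟ n)
    weights : ∀ i → 𝟙 (i ℕP.<? n) + 𝟙 (i ℕP.≟ n) ≤ + (weight (lA i) ℕ.+ weight (lB i))
    weights i = go (i ℕP.<? n) (i ℕP.≟ n)
      where
      go : ∀ d e → 𝟙 d + 𝟙 e ≤ + (weight (pickA i d) ℕ.+ weight (pickB i d e))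
      go (no _)    (yes refl) = ℤP.≤-refl
      go (yes i<i) (yes refl) = ⊥-elim (ℕP.<-irrefl refl i<i)
      go (no _)    (no _)     = ℤP.≤-refl
      go (yes i<n) (no _) with dich i i<n
      ... | inj₁ _ = ℤP.≤-refl
      ... | inj₂ _ = ℤP.≤-refl
    e = total-weight p A lA 0 (suc n)
    f = total-weight p B lB 0 (suc n)
    e+f≡ : e ℕ.+ f ≡ suc n
    e+f≡ = ℕP.≤-antisym (Levels-size {A = A} {B} lA lB (suc n) pr p∤M₁ eq tile)
      (total-weight-lower p A B lA lB (suc n) n n (ℕP.n≤1+n n) ℕP.≤-refl weights)
    total-weight-last : ∀ (lev : Levels p A) k t → weight (lev (k ℕ.+ t)) ≡ 0 →
      total-weight p A lev k (suc t) ≡ total-weight p A lev k t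
    total-weight-last lev k zero    h =
      trans (ℕP.+-identityʳ _) (trans (cong (λ i → weight (lev i)) (sym (ℕP.+-identityʳ k))) h)
    total-weight-last lev k (suc t) h =
      cong (weight (lev k) ℕ.+_) (total-weight-last lev (suc k) t
      (trans (cong (λ i → weight (lev i)) (sym (ℕP.+-suc k t))) h))
    lA-n : weight (lA n) ≡ 0
    lA-n with n ℕP.<? n
    ... | no _ = refl
    ... | yes n<n = ⊥-elim (ℕP.<-irrefl refl n<n)
    -- Level n is not recorded for `A`, so all e levels lie below n and bound the count modulo p^n.
    A-bound : + (p ℕ.^ e) * cnt (p ℕ.^ n) x A ≤ + length A
    A-bound = ℤP.≤-trans (ℤP.≤-reflexive
      (cong₂ (λ u v → + (p ℕ.^ u) * cnt (p ℕ.^ v) x A) (total-weight-last lA 0 n lA-n) (sym (ℕP.+-identityʳ n))))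
      (ℤP.≤-trans (Levels-bound p A lA p≢0 n 0 x) (ℤP.≤-reflexive (cnt-1 x A)))
    B-divides : p ℕ.^ f ∣ length B
    B-divides = ∣ℤ⇒∣ℕ (∣-cast (cnt-1 0ℤ B) (Levels-divide p B lB p≢0 (suc n) 0 0ℤ))
    b = ℕD.quotient B-divides
    lengthB : length B ≡ b ℕ.* p ℕ.^ f
    lengthB = ℕD._∣_.equality B-divides
    size = Tile-size M A B tile
    b≢0 : b ≢ 0
    b≢0 b≡0 = M≢0 (trans (sym size) (trans (cong (length A ℕ.*_) (trans lengthB (cong (ℕ._* p ℕ.^ f) b≡0)))
      (ℕP.*-zeroʳ (length A))))
    -- The primes of `M₁` differ from p, so they divide the cofactor b of p^f in |B|; this makes b
    -- admissible in `small`.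
    rad∣b : ∀ q → Prime q → q ∣ M₁ → q ∣ b
    rad∣b q pq q∣M₁ with euclidsLemma b (p ℕ.^ f) pq (subst (q ∣_) lengthB (rad∣B q pq q∣M₁))
    ... | inj₁ h = h
    ... | inj₂ h = ⊥-elim (p∤M₁ (subst (_∣ M₁) (prime∣prime pq pr (prime∣^ p f pq h)) q∣M₁))
    -- A class with p elements gives p^e p ≤ |A|. Together with |B| = b p^f and e + f = n + 1 this
    -- yields p b ≤ `M₁`, against `small`.
    counting : + p ≤ cnt (p ℕ.^ n) x A → p ℕ.* b ℕ.≤ M₁
    counting p≤c = ℕP.*-cancelˡ-≤ (p ℕ.^ suc n) {{ℕP.m^n≢0 p (suc n) {{prime⇒nonZero pr}}}} (begin
        p ℕ.^ suc n ℕ.* (p ℕ.* b)              ≡⟨ cong (λ k → p ℕ.^ k ℕ.* (p ℕ.* b)) (sym e+f≡) ⟩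
        p ℕ.^ (e ℕ.+ f) ℕ.* (p ℕ.* b)          ≡⟨ cong (ℕ._* (p ℕ.* b)) (ℕP.^-distribˡ-+-* p e f) ⟩
        p ℕ.^ e ℕ.* p ℕ.^ f ℕ.* (p ℕ.* b)      ≡⟨ lem (p ℕ.^ e) (p ℕ.^ f) p b ⟩
        p ℕ.^ e ℕ.* p ℕ.* (b ℕ.* p ℕ.^ f)      ≡⟨ cong (p ℕ.^ e ℕ.* p ℕ.*_) (sym lengthB) ⟩
        p ℕ.^ e ℕ.* p ℕ.* length B             ≤⟨ ℕP.*-monoˡ-≤ (length B) pA ⟩
        length A ℕ.* length B                  ≡⟨ trans size eq ⟩
        p ℕ.^ suc n ℕ.* M₁                     ∎)
      where
      open ℕP.≤-Reasoning
      open import Data.Nat.Tactic.RingSolver using () renaming (solve-∀ to ℕ-solve-∀)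
      lem : ∀ u v p b → u ℕ.* v ℕ.* (p ℕ.* b) ≡ u ℕ.* p ℕ.* (b ℕ.* v)
      lem = ℕ-solve-∀
      pA : p ℕ.^ e ℕ.* p ℕ.≤ length A
      pA = ℤP.drop‿+≤+ (ℤP.≤-trans (ℤP.≤-reflexive (ℤP.pos-* (p ℕ.^ e) p))
        (ℤP.≤-trans (ℤP.*-monoˡ-≤-nonNeg (+ (p ℕ.^ e)) p≤c) A-bound))

  -- (T2) modulo M and decompositions into classes

  -- The predecessor occurs because `Lev p j` is the condition at p^(j+1); it is applied to
  -- exponents α ≥ 1.
  Condition : List ℤ → ℕ × ℕ → Set
  Condition A (p , α) = Lev p (ℕ.pred α) A

  -- Only prime powers dividing M are considered, so A matters only modulo M; by Lev-absent no others occur.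
  T2-mod : ℕ → List ℤ → Set
  T2-mod M A = ∀ ps → ps ≢ [] → All PrimePower ps → Unique (map proj₁ ps) →
    All (λ (p , α) → p ℕ.^ α ∣ M) ps → All (Condition A) ps → CC ps A

  extract : ∀ {q : ℕ} (ps : List (ℕ × ℕ)) → q ∈ map proj₁ ps → Unique (map proj₁ ps) →
    ∃ λ α → ∃ λ ps′ → ps ↭ (q , α) ∷ ps′ × Unique (q ∷ map proj₁ ps′)
  extract ((q , α) ∷ ps) (here refl) u = α , ps , Perm.refl , u
  extract (x ∷ ps) (there m) (x∉ ∷ u) with extract ps m u
  ... | α , ps′ , r , q∉ ∷ u′ = α , x ∷ ps′ , Perm.trans (Perm.prep x r) (Perm.swap x _ Perm.refl) ,
    (≢-sym (All.head q≢) ∷ q∉) ∷ (AllP.map⁺ (All.tail q≢) ∷ u′)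
    where
    q≢ = All-resp-↭ r (AllP.map⁻ x∉)

  class : (ℤ → ℕ) → ℕ → List ℤ → List ℤ
  class κ i B = filter (λ b → κ b ℕP.≟ i) B

  cnt-classes : ∀ κ n s y B → (∀ b → κ b ℕ.< n) → cnt s y B ≡ ∑< n (λ i → cnt s y (class κ i B))
  cnt-classes κ n s y B κ<n = sym (trans (∑<-cong n λ i _ → ∑ₗ-filter (λ b → κ b ℕP.≟ i) B _)
    (trans (sym (∑ₗ-∑<-swap B n _)) (∑ₗ-cong B λ b →
      trans (∑<-pick n (κ b) (κ<n b) λ i _ i≢κ → trans (cong (_* δ s (b - y)) (𝟙-no (κ b ℕP.≟ i) (i≢κ ∘ sym)))
        (ℤP.*-zeroˡ (δ s (b - y))))
        (trans (cong (_* δ s (b - y)) (𝟙-yes (κ b ℕP.≟ κ b) refl)) (ℤP.*-identityˡ _)))))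

  -- Cuboid values are additive in the set, so they may be tested on the classes of any finite
  -- labelling.
  Cub-classes : ∀ hs κ n s B → (∀ b → κ b ℕ.< n) →
    (∀ i → i ℕ.< n → ∀ x → Cub hs (λ y → cnt s y (class κ i B)) x ≡ 0ℤ) →
    ∀ x → Cub hs (λ y → cnt s y B) x ≡ 0ℤ
  Cub-classes hs κ n s B κ<n h x = trans (Cub-cong hs (λ y → cnt-classes κ n s y B κ<n) x) (Cub-∑< hs n _ h x)

  -- Slices modulo q and their quotients

  module Slice (q : ℕ) .{{q≢0 : ℕ.NonZero q}} where

    residue : ℤ → ℕ
    residue b = b %ℕ q

    slice : ℕ → List ℤ → List ℤ
    slice i B = class residue i B

    quot : ℕ → List ℤ → List ℤ
    quot i B = map (_/ℕ q) (slice i B)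

    ∈-slice : ∀ {i B b} → b ∈ slice i B → b ≡ + i + + q * (b /ℕ q)
    ∈-slice {i} {B} {b} m = trans (a≡a%ℕn+[a/ℕn]*n b q)
      (cong₂ _+_ (cong +_ (proj₂ (∈-filter⁻ (λ b → residue b ℕP.≟ i) {xs = B} m))) (ℤP.*-comm (b /ℕ q) (+ q)))

    slice-scale : ∀ i s z B → cnt (q ℕ.* s) (+ i + + q * z) (slice i B) ≡ cnt s z (quot i B)
    slice-scale i s z B = trans (∑ₗ-cong-∈ (slice i B) λ {b} m → δ-cong {q ℕ.* s} {s}
        (λ h → *-cancelˡ-∣ℤ q (ℕ.≢-nonZero⁻¹ q) (∣-cast (lem b m) h))
          (λ h → ∣-cast (sym (lem b m)) (*-monoʳ-∣ℤ q h)))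
      (sym (∑ₗ-map (_/ℕ q) (slice i B) _))
      where
      lem₀ : ∀ i q c z → (i + q * c) - (i + q * z) ≡ q * (c - z)
      lem₀ = solve-∀
      lem : ∀ b → b ∈ slice i B → b - (+ i + + q * z) ≡ + q * (b /ℕ q - z)
      lem b m = trans (cong (_- (+ i + + q * z)) (∈-slice {i} {B} m)) (lem₀ (+ i) (+ q) (b /ℕ q) z)

    slice-off : ∀ i s y B → q ∣ s → ¬ q ∣ℤ y - + i → cnt s y (slice i B) ≡ 0ℤ
    slice-off i s y B q∣s h = ∑ₗ-zero (slice i B) λ {b} m → δ-no λ k → h
      (∣-cast (lem b y (+ i)) (∣m∣n⇒∣m-n
        (subst (λ c → q ∣ℤ c - + i) (sym (∈-slice {i} {B} m))
        (∣-cast (lem₂ (+ i) (+ q) (b /ℕ q)) (∣-self (b /ℕ q)))) (∣ℤ-trans q∣s k)))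
      where
      lem : ∀ b y i → (b - i) - (b - y) ≡ y - i
      lem = solve-∀
      lem₂ : ∀ i q c → c * q ≡ i + q * c - i
      lem₂ = solve-∀

    whole-scale : ∀ i s z B → i ℕ.< q → cnt (q ℕ.* s) (+ i + + q * z) B ≡ cnt s z (quot i B)
    whole-scale i s z B i<q = trans (trans (cnt-classes residue q (q ℕ.* s) (+ i + + q * z) B (λ b → n%ℕd<d b q))
        (∑<-pick q i i<q λ j j<q j≢i → slice-off j (q ℕ.* s) _ B (ℕD.m∣m*n s) λ h → j≢i (sym (small-∣⇒≡ i<q j<q
          (∣-cast (lem (+ i) (+ q) z (+ j)) (∣m∣n⇒∣m-n h (∣-self z)))))))
      (slice-scale i s z B)
      where
      lem : ∀ i q z j → (i + q * z - j) - z * q ≡ i - j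
      lem = solve-∀

    -- In a representation of i + q x by q a + b the element b lies in slice i; subtracting i and
    -- dividing by q gives a representation modulo `N`.
    Tile-slice : ∀ {N A B} i → i ℕ.< q → Tile (q ℕ.* N) (map (+ q *_) A) B → Tile N A (quot i B)
    Tile-slice {N} {A} {B} i i<q t x =
      trans (∑ₗ-cong A λ a → sym (trans (cong (λ z → cnt (q ℕ.* N) z B) (lem (+ i) (+ q) x a))
      (whole-scale i N (x - a) B i<q)))
      (trans (sym (∑ₗ-map (+ q *_) A _)) (t (+ i + + q * x)))
      where
      lem : ∀ i q x a → (i + q * x) - q * a ≡ i + q * (x - a)
      lem = solve-∀

    -- All directions are multiples of q, so the vertices stay in one class modulo q. Outside the
    -- class of i the slice is not met; inside it y = i + q y′ turns the cuboid into one of the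
    -- quotient.
    Cub-slice : ∀ i qs hs hs′ B → Pointwise (λ h h′ → h ≡ + q * h′) hs hs′ →
      (∀ x → Cub hs′ (λ y → cnt (prod qs) y (quot i B)) x ≡ 0ℤ) →
      ∀ x → Cub hs (λ y → cnt (q ℕ.* prod qs) y (slice i B)) x ≡ 0ℤ
    Cub-slice i qs hs hs′ B eqs z x with + q ∣? (x - + i)
    ... | yes (divides x₀ e) = trans (Cub-transfer
      (λ y y′ → y ≡ + i + + q * y′) {λ y → cnt (q ℕ.* prod qs) y (slice i B)} {λ y → cnt (prod qs) y (quot i B)}
        (λ { y y′ refl → slice-scale i (prod qs) y′ B })
        (Pointwise.map (λ { {h} {h′} refl y y′ refl → lem (+ i) (+ q) y′ h′ }) eqs) x x₀
        (trans (lem₂ x (+ i)) (trans (cong (_+_ (+ i)) e) (cong (_+_ (+ i)) (ℤP.*-comm x₀ (+ q)))))) (z x₀)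
      where
      lem : ∀ i q y h → (i + q * y) - q * h ≡ i + q * (y - h)
      lem = solve-∀
      lem₂ : ∀ x i → x ≡ i + (x - i)
      lem₂ = solve-∀
    ... | no ¬h = trans (Cub-transfer (λ y y′ → ¬ q ∣ℤ y - + i) {λ y → cnt (q ℕ.* prod qs) y (slice i B)} {λ _ → 0ℤ}
        (λ y y′ ¬d → slice-off i (q ℕ.* prod qs) y B (ℕD.m∣m*n (prod qs)) ¬d)
        (Pointwise.map (λ { {h} {h′} refl y y′ ¬d d →
          ¬d (∣-cast (lem y (+ i) (+ q) h′) (∣m∣n⇒∣m+n d (∣-self h′))) }) eqs) x x ¬h) (Cub-0 hs′ (λ _ → refl) x)
      where
      lem : ∀ y i q h → (y - q * h - i) + h * q ≡ y - i
      lem = solve-∀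

    divide-directions : ∀ {s} (ps : List (ℕ × ℕ)) hs → Pointwise (λ pα h → q ℕ.* s ∣ℤ + proj₁ pα * h) ps hs →
      All (q ∣ℤ_) hs →
      ∃ λ hs′ → Pointwise (λ h h′ → h ≡ + q * h′) hs hs′ × Pointwise (λ pα h → s ∣ℤ + proj₁ pα * h) ps hs′
    divide-directions [] [] [] [] = [] , [] , []
    divide-directions {s} ((p , _) ∷ ps) (h ∷ hs) (d ∷ ds) (divides h′ refl ∷ es) with divide-directions ps hs ds es
    ... | hs′ , rs , ss = h′ ∷ hs′ , ℤP.*-comm h′ (+ q) ∷ rs ,
      *-cancelˡ-∣ℤ q (ℕ.≢-nonZero⁻¹ q) (∣-cast (lem (+ p) h′ (+ q)) d) ∷ ss
      where
      lem : ∀ p h q → p * (h * q) ≡ q * (p * h)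
      lem = solve-∀

  coprime-inverse : ∀ {q s} → Coprime q s → ∃ λ u → s ∣ℤ + q * u - 1ℤ
  coprime-inverse {q} {s} c with coprime-Bézout c
  ... | Bézout.+- x y eq = + x , divides (+ y)
    (trans (cong (_- 1ℤ) (trans (trans (ℤP.*-comm (+ q) (+ x)) (sym (ℤP.pos-* x q)))
    (trans (cong +_ (sym eq)) (trans (ℤP.pos-+ 1 (y ℕ.* s)) (cong (_+_ 1ℤ) (ℤP.pos-* y s)))))) (lem (+ y * + s)))
    where
    lem : ∀ w → 1ℤ + w - 1ℤ ≡ w
    lem = solve-∀
  ... | Bézout.-+ x y eq = - + x , divides (- + y)
    (trans (lem (+ x) (+ q)) (trans
    (cong -_ (trans (cong (_+_ 1ℤ) (sym (ℤP.pos-* x q)))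
    (trans (sym (ℤP.pos-+ 1 (x ℕ.* q))) (trans (cong +_ eq) (ℤP.pos-* y s))))) (lem₂ (+ y) (+ s))))
    where
    lem : ∀ x q → q * - x - 1ℤ ≡ - (1ℤ + x * q)
    lem = solve-∀
    lem₂ : ∀ y s → - (y * s) ≡ - y * s
    lem₂ = solve-∀

  -- For s coprime to q, y ↦ (y - i) / q modulo s carries the slice to its quotient.
  Cub-slice-coprime : ∀ q .{{_ : ℕ.NonZero q}} i ps hs B → Coprime q (prod ps) → CC ps (Slice.quot q i B) →
    Pointwise (λ pα h → prod ps ∣ℤ + proj₁ pα * h) ps hs → ∀ x →
      Cub hs (λ y → cnt (prod ps) y (Slice.slice q i B)) x ≡ 0ℤ
  Cub-slice-coprime q i ps hs B cop cc ds x with coprime-inverse cop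
  ... | u , inv = trans (Cub-transfer (λ y y′ → y′ ≡ u * (y - + i)) {λ y → cnt s y (slice i B)}
    {λ y → cnt s y (quot i B)} (λ { y _ refl → same y }) (scaled hs) x (u * (x - + i)) refl)
      (cc (map (u *_) hs) (scaled-directions ps hs ds) (u * (x - + i)))
    where
    open Slice q
    s = prod ps
    scaled : ∀ hs → Pointwise (λ h h′ → ∀ y y′ → y′ ≡ u * (y - + i) → y′ - h′ ≡ u * (y - h - + i)) hs
      (map (u *_) hs)
    scaled []       = []
    scaled (h ∷ hs) = (λ { y _ refl → lem u y (+ i) h }) ∷ scaled hs
      where
      lem : ∀ u y i h → u * (y - i) - u * h ≡ u * (y - h - i)
      lem = solve-∀
    scaled-directions : ∀ qs hs → Pointwise (λ pα h → s ∣ℤ + proj₁ pα * h) qs hs →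
      Pointwise (λ pα h → s ∣ℤ + proj₁ pα * h) qs (map (u *_) hs)
    scaled-directions [] [] [] = []
    scaled-directions ((p , _) ∷ qs) (h ∷ hs) (d ∷ ds) =
      ∣-cast (lem u (+ p) h) (∣n⇒∣m*n u d) ∷ scaled-directions qs hs ds
      where
      lem : ∀ u p h → u * (p * h) ≡ p * (u * h)
      lem = solve-∀
    same : ∀ y → cnt s y (slice i B) ≡ cnt s (u * (y - + i)) (quot i B)
    same y = trans (∑ₗ-cong-∈ (slice i B) λ {b} m → δ-cong {s} {s}
        (λ h → coprime-divisorℤ (b /ℕ q - u * (y - + i)) (Coprime-sym cop)
          (∣-cast (trans (lem (+ i) (+ q) (b /ℕ q) u y) refl)
          (∣m∣n⇒∣m-n (subst (λ c → s ∣ℤ c - y) (∈-slice {i} {B} m) h) (∣m⇒∣m*n (y - + i) inv))))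
        (λ h → subst (λ c → s ∣ℤ c - y) (sym (∈-slice {i} {B} m)) (∣-cast (lem₂ (+ i) (+ q) (b /ℕ q) u y)
          (∣m∣n⇒∣m+n (∣n⇒∣m*n (+ q) h) (∣m⇒∣m*n (y - + i) inv)))))
      (sym (∑ₗ-map (_/ℕ q) (slice i B) _))
      where
      lem : ∀ i q c u y → (i + q * c - y) - (q * u - 1ℤ) * (y - i) ≡ q * (c - u * (y - i))
      lem = solve-∀
      lem₂ : ∀ i q c u y → q * (c - u * (y - i)) + (q * u - 1ℤ) * (y - i) ≡ i + q * c - y
      lem₂ = solve-∀

  -- Reduction by a prime that does not divide |A|

  module SubgroupReduction {M N q : ℕ} (A B : List ℤ) .{{M≢0 : ℕ.NonZero M}} .{{N≢0 : ℕ.NonZero N}}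
    (pq : Prime q) (M≡ : M ≡ q ℕ.* N)
    (tile : Tile M A B) (q∤A : ¬ q ∣ length A) (T2N : ∀ A B → Tile N A B → T2-mod N A × T2-mod N B) where

    instance
      q≢0 : ℕ.NonZero q
      q≢0 = prime⇒nonZero pq

    open Slice q

    tile-quot : ∀ i → i ℕ.< q → Tile N A (quot i B)
    tile-quot i i<q = Tile-slice {N} {A} {B} i i<q (subst (λ K → Tile K (map (+ q *_) A) B) M≡
      (Tile-dilate M q A B (prime≢0 pq) (λ ℓ pℓ ℓ∣q ℓ∣A → q∤A (subst (_∣ length A) (prime∣prime pℓ pq ℓ∣q) ℓ∣A))
        tile))

    ∣N : ∀ {p} α → Prime p → p ≢ q → p ℕ.^ α ∣ M → p ℕ.^ α ∣ N
    ∣N {p} α pp p≢q d = coprime-divisor (prime^-coprime α pp (λ h → p≢q (prime∣prime pp pq h)))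
      (subst (p ℕ.^ α ∣_) M≡ d)

    A-not-q : ∀ {p α} → Condition A (p , α) → Prime p → p ≢ q
    A-not-q {p} {α} lev pp refl = q∤A (Lev⇒∣length (ℕ.pred α) A (prime≢0 pp) lev)

    -- A condition of `A` at a power of q would make q divide |A|. The powers of other primes that
    -- divide M divide `N` as well.
    T2-A : T2-mod M A
    T2-A ps ps≢[] gs u ds ls = proj₁ (T2N A (quot 0 B) (tile-quot 0 (ℕ.>-nonZero⁻¹ q))) ps ps≢[] gs u
      (All.tabulate λ { {p , α} m → ∣N α (proj₁ (All.lookup gs m))
        (A-not-q {α = α} (All.lookup ls m) (proj₁ (All.lookup gs m))) (All.lookup ds m) }) ls

    -- A satisfies no condition that B satisfies, so each quotient of B inherits them.
    inherit : ∀ {p} j i → Prime p → i ℕ.< q → p ℕ.^ suc j ∣ N → ¬ Lev p j A → Lev p j (quot i B)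
    inherit j i pp i<q d ¬lev = [ (λ l → ⊥-elim (¬lev l)) , id ]′
      (Lev-dichotomy j A (quot i B) pp d (tile-quot i i<q))

    inherit-∤ : ∀ ps i → i ℕ.< q → All PrimePower ps → All (q ≢_) (map proj₁ ps) →
      All (λ (p , α) → p ℕ.^ α ∣ M) ps → All (Condition B) ps →
      All (λ (p , α) → p ℕ.^ α ∣ N) ps × All (Condition (quot i B)) ps
    inherit-∤ [] i i<q [] [] [] [] = [] , []
    inherit-∤ ((p , suc j) ∷ ps) i i<q ((pp , _) ∷ gs) (q≢p ∷ q∉) (d ∷ ds)
      (l ∷ ls) with inherit-∤ ps i i<q gs q∉ ds ls
    ... | es , ms = ∣N (suc j) pp (q≢p ∘ sym) d ∷ es ,
      inherit j i pp i<q (∣N (suc j) pp (q≢p ∘ sym) d)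
        (proj₂ (Lev-absent j B A pp (Tile-comm {M} {A} {B} tile) l)) ∷ ms

    q∣directions : ∀ {s} (ps : List (ℕ × ℕ)) hs → All PrimePower ps → All (q ≢_) (map proj₁ ps) → q ∣ s →
      Pointwise (λ pα h → s ∣ℤ + proj₁ pα * h) ps hs → All (q ∣ℤ_) hs
    q∣directions [] [] _ _ _ [] = []
    q∣directions ((p , _) ∷ ps) (h ∷ hs) ((pp , _) ∷ gs) (q≢p ∷ q∉) q∣s (d ∷ ds) with euclidsLemmaℤ (+ p) h pq
      (∣ℤ-trans q∣s d)
    ... | inj₁ e = ⊥-elim (q≢p (prime∣prime pq pp (∣ℤ⇒∣ℕ e)))
    ... | inj₂ e = e ∷ q∣directions ps hs gs q∉ q∣s ds

    slices : ∀ hs s → (∀ i → i ℕ.< q → ∀ x → Cub hs (λ y → cnt s y (slice i B)) x ≡ 0ℤ) → ∀ x →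
      Cub hs (λ y → cnt s y B) x ≡ 0ℤ
    slices hs s = Cub-classes hs residue q s B (λ b → n%ℕd<d b q)

    T2-B-∤ : ∀ ps → ps ≢ [] → All PrimePower ps → Unique (map proj₁ ps) → All (q ≢_) (map proj₁ ps) →
      All (λ (p , α) → p ℕ.^ α ∣ M) ps → All (Condition B) ps → CC ps B
    T2-B-∤ ps ps≢[] gs u q∉ ds ls hs dirs = slices hs (prod ps) λ i i<q →
      Cub-slice-coprime q i ps hs B (prime-coprime pq (prime∤prod ps gs pq q∉))
      (let (es , ms) = inherit-∤ ps i i<q gs q∉ ds ls in proj₂ (T2N A (quot i B) (tile-quot i i<q)) ps ps≢[] gs u es ms) dirs

    -- Passing to the quotients lowers the exponent of q by one. From q^(j+2) this leaves q^(j+1),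
    -- where the quotients inherit a condition because `A` has none at powers of q. From q^1 nothing
    -- of q is left, and with a nonempty `ps` both terms of the difference in the direction of q
    -- vanish by themselves.
    T2-B-∣ : ∀ j ps → All PrimePower ps → Unique (q ∷ map proj₁ ps) → q ℕ.^ suc j ∣ M →
      All (λ (p , α) → p ℕ.^ α ∣ M) ps → Lev q j B → All (Condition B) ps → CC ((q , suc j) ∷ ps) B
    T2-B-∣ zero []           gs u d ds l ls = Lev⇒CC-single q 0 B (prime≢0 pq) l
    T2-B-∣ zero ps@(_ ∷ _) gs (q∉ ∷ u) d ds l ls (h ∷ hs) (dir ∷ dirs) x =
      cong₂ _-_ (zero-at (x - h)) (zero-at x)
      where
      s≡ : prod ((q , 1) ∷ ps) ≡ q ℕ.* prod ps
      s≡ = cong (ℕ._* prod ps) (ℕP.*-identityʳ q)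
      dirs′ : Pointwise (λ pα h → q ℕ.* prod ps ∣ℤ + proj₁ pα * h) ps hs
      dirs′ = Pointwise.map (λ {pα} {h} → subst (_∣ℤ + proj₁ pα * h) s≡) dirs
      zero-at : ∀ x → Cub hs (λ y → cnt (prod ((q , 1) ∷ ps)) y B) x ≡ 0ℤ
      zero-at = subst (λ s → ∀ x → Cub hs (λ y → cnt s y B) x ≡ 0ℤ) (sym s≡) (slices hs (q ℕ.* prod ps) λ i i<q →
        let (hs′ , eqs , dirs″) = divide-directions {prod ps} ps hs dirs′ (q∣directions ps hs gs q∉ (ℕD.m∣m*n (prod ps)) dirs′)
            (es , ms) = inherit-∤ ps i i<q gs q∉ ds ls
        in Cub-slice i ps hs hs′ B eqs (proj₂ (T2N A (quot i B) (tile-quot i i<q)) ps (λ ()) gs u es ms hs′ dirs″))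
    T2-B-∣ (suc j) ps gs (q∉ ∷ u) d ds l ls hs@(h ∷ hs₀) dirs =
      subst (λ s → ∀ x → Cub hs (λ y → cnt s y B) x ≡ 0ℤ) (sym s≡)
        (slices hs (q ℕ.* s′) λ i i<q →
          let (hs′ , eqs , dirs″) = divide-directions {s′} qs hs dirs′ (q∣h ∷ q∣directions ps hs₀ gs q∉ (ℕD.m∣m*n s′) (Pointwise.tail dirs′))
              (es , ms) = inherit-∤ ps i i<q gs q∉ ds ls
          in Cub-slice i qs hs hs′ B eqs (proj₂ (T2N A (quot i B) (tile-quot i i<q)) qs (λ ()) ((pq , s≤s z≤n) ∷ gs) (q∉ ∷ u) (q^∣N ∷ es)
            (inherit j i pq i<q q^∣N (λ lev → q∤A (Lev⇒∣length j A (prime≢0 pq) lev)) ∷ ms) hs′ dirs″))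
      where
      qs = (q , suc j) ∷ ps
      s′ = prod qs
      s≡ : prod ((q , suc (suc j)) ∷ ps) ≡ q ℕ.* s′
      s≡ = ℕP.*-assoc q (q ℕ.^ suc j) (prod ps)
      dirs′ : Pointwise (λ pα h → q ℕ.* s′ ∣ℤ + proj₁ pα * h) qs hs
      dirs′ = subst (λ s → Pointwise (λ pα h → s ∣ℤ + proj₁ pα * h) qs hs) s≡ (retype dirs)
        where
        retype : Pointwise (λ pα h → prod ((q , suc (suc j)) ∷ ps) ∣ℤ + proj₁ pα * h) ((q , suc (suc j)) ∷ ps) hs →
          Pointwise (λ pα h → prod ((q , suc (suc j)) ∷ ps) ∣ℤ + proj₁ pα * h) qs hs
        retype (d ∷ ds) = d ∷ ds
      q∣h : q ∣ℤ h
      q∣h = ∣ℤ-trans (ℕD.∣m⇒∣m*n (prod ps) (ℕD.m∣m*n (q ℕ.^ j)))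
        (*-cancelˡ-∣ℤ q (prime≢0 pq) (Pointwise.head dirs′))
      q^∣N : q ℕ.^ suc j ∣ N
      q^∣N = ℕD.*-cancelˡ-∣ q (subst (q ℕ.* q ℕ.^ suc j ∣_) M≡ d)

    T2-B : T2-mod M B
    T2-B ps ps≢[] gs u ds ls with Any.any? (q ℕP.≟_) (map proj₁ ps)
    ... | no q∉ = T2-B-∤ ps ps≢[] gs u (AllP.¬Any⇒All¬ _ q∉) ds ls
    ... | yes q∈ with extract ps q∈ u
    ... | zero , ps′ , r , u′ = ⊥-elim (absurd (proj₂ (All.head (All-resp-↭ r gs))))
      where
      absurd : ¬ 1 ℕ.≤ 0
      absurd ()
    ... | suc j , ps′ , r , u′ with All-resp-↭ r gs | All-resp-↭ r ds | All-resp-↭ r ls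
    ... | _ ∷ gs′ | d ∷ ds′ | l ∷ ls′ = CC-↭ {A = B} (Perm.↭-sym r) (T2-B-∣ j ps′ gs′ u′ d ds′ l ls′)

  T2-subgroup : ∀ {M N q} A B .{{_ : ℕ.NonZero M}} .{{_ : ℕ.NonZero N}} → Prime q → M ≡ q ℕ.* N → Tile M A B →
    ¬ q ∣ length A →
    (∀ A B → Tile N A B → T2-mod N A × T2-mod N B) → T2-mod M A × T2-mod M B
  T2-subgroup A B pq M≡ tile q∤A T2N = T2-A , T2-B
    where open SubgroupReduction A B pq M≡ tile q∤A T2N

  -- Splitting a tiling along a labelling of one factor

  ∑<-tight : ∀ n f c → (∀ i → i ℕ.< n → f i ≤ c) → ∑< n f ≡ + n * c → ∀ i → i ℕ.< n → f i ≡ c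
  ∑<-tight n f c h e i i<n = trans (lem (f i) c)
    (trans (cong (_-_ c) (zero-terms n (λ i → c - f i) (λ i i<n → ℤP.i≤j⇒0≤j-i (h i i<n)) total i i<n))
    (ℤP.+-identityʳ c))
    where
    lem : ∀ f c → f ≡ c - (c - f)
    lem = solve-∀
    total : ∑< n (λ i → c - f i) ≡ 0ℤ
    total = trans (∑<-+ n (λ _ → c) (λ i → - f i)) (trans (cong₂ _+_ (∑<-const n c)
      (trans (∑<-cong n λ i _ → sym (ℤP.-1*i≡-i (f i)))
        (trans (∑<-* n -1ℤ f) (trans (ℤP.-1*i≡-i _) (cong -_ e))))) (ℤP.+-inverseʳ (+ n * c)))
    zero-terms : ∀ n g → (∀ i → i ℕ.< n → 0ℤ ≤ g i) → ∑< n g ≡ 0ℤ → ∀ i → i ℕ.< n → g i ≡ 0ℤ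
    zero-terms (suc n) g h e = λ { zero _ → g0 ; (suc i) (s≤s i<n) → zero-terms n (g ∘ suc) h′ rest i i<n }
      where
      h′ : ∀ i → i ℕ.< n → 0ℤ ≤ g (suc i)
      h′ i i<n = h (suc i) (s≤s i<n)
      rest≥0 : 0ℤ ≤ ∑< n (g ∘ suc)
      rest≥0 = subst (_≤ ∑< n (g ∘ suc)) (∑<-zero n λ _ _ → refl) (∑<-mono n h′)
      g0 : g 0 ≡ 0ℤ
      g0 = ℤP.≤-antisym (subst₂ _≤_ (ℤP.+-identityʳ (g 0)) e (ℤP.+-monoʳ-≤ (g 0) rest≥0)) (h 0 (s≤s z≤n))
      rest : ∑< n (g ∘ suc) ≡ 0ℤ
      rest = trans (sym (ℤP.+-identityˡ _)) (trans (cong (_+ ∑< n (g ∘ suc)) (sym g0)) e)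

  cnt≤1⇒Unique : ∀ {M} A → (∀ x → cnt M x A ≤ 1ℤ) → Unique A
  cnt≤1⇒Unique []      h = []
  cnt≤1⇒Unique {M} (a ∷ A) h = All.tabulate distinct ∷ cnt≤1⇒Unique {M} A λ x → ℤP.≤-trans
      (ℤP.≤-trans (ℤP.≤-reflexive (sym (ℤP.+-identityˡ _))) (ℤP.+-monoˡ-≤ (cnt M x A) (𝟙≥0 (+ M ∣? (a - x))))) (h x)
    where
    distinct : ∀ {a′} → a′ ∈ A → a ≢ a′
    distinct m refl = 2≰1 (ℤP.≤-reflexive (sym (δ-yes a∣))) (cnt-member m a∣) (h a)
      where
      a∣ : M ∣ℤ a - a
      a∣ = ∣-cast (sym (ℤP.+-inverseʳ a)) ∣0

  -- For a fixed b in `B`, two entries of `A` in the class of x would represent x + b twice.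
  Tile-cnt≤1 : ∀ {M A B} → Tile M A B → ∀ x → cnt M x A ≤ 1ℤ
  Tile-cnt≤1 {M} {A} {B} t x with Tile-surjective {M} {A} {B} t 0ℤ
  ... | _ , b , _ , b∈ , _ = ℤP.≤-trans (∑ₗ-mono A λ {a} _ → below a) (ℤP.≤-reflexive (t (x + b)))
    where
    below : ∀ a → δ M (a - x) ≤ cnt M (x + b - a) B
    below a with + M ∣? (a - x)
    ... | yes h = cnt-member b∈ (∣-cast (lem a x b) h)
      where
      lem : ∀ a x b → a - x ≡ b - (x + b - a)
      lem = solve-∀
    ... | no _ = cnt≥0 M (x + b - a) B

  Tile-Unique : ∀ {M A B} → Tile M A B → Unique A
  Tile-Unique {M} {A} {B} t = cnt≤1⇒Unique {M} A (Tile-cnt≤1 {M} {A} {B} t)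

  -- The fibres of κ have |A||B_j| ≤ N each, and |A||B| = p N in total.
  Tile-classes : ∀ {M N p} A B κ .{{_ : ℕ.NonZero M}} .{{_ : ℕ.NonZero N}} → Tile M A B → M ≡ p ℕ.* N →
    (∀ b → κ b ℕ.< p) →
    (∀ {a a′ b b′} → a ∈ A → a′ ∈ A → b ∈ B → b′ ∈ B → κ b ≡ κ b′ → N ∣ℤ (a + b) - (a′ + b′) → a ≡ a′ × b ≡ b′) →
    ∀ j → j ℕ.< p → Tile N A (class κ j B)
  Tile-classes {M} {N} {p} A B κ tile M≡ κ<p inj j j<p x =
    trans (rep-shift N A (class κ j B) x (+ (x %ℕ N)) (∣-%ℕ x))
    (∑<-tight N (c j) 1ℤ (λ i _ → ≤1 j i)
      (trans (∑<-tight p T (+ N) T≤N total j j<p) (sym (ℤP.*-identityʳ (+ N)))) (x %ℕ N) (n%ℕd<d x N))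
    where
    uA = Tile-Unique {M} {A} {B} tile
    uB = Tile-Unique {M} {B} {A} (Tile-comm {M} {A} {B} tile)
    c : ℕ → ℕ → ℤ
    c j i = ∑ₗ A (λ a → cnt N (+ i - a) (class κ j B))
    T : ℕ → ℤ
    T j = ∑< N (c j)
    ≤1 : ∀ j i → c j i ≤ 1ℤ
    ≤1 j i = ∑ₗ≤1 (λ a → cnt N (+ i - a) (class κ j B)) uA
        (λ {a} a∈ → ∑ₗ≤1 (λ b → δ N (b - (+ i - a))) (UniqueP.filter⁺ (λ b → κ b ℕP.≟ j) uB) (λ _ → 𝟙≤1 _)
          λ {b} {b′} m m′ h h′ → proj₂ (inj a∈ a∈ (∈B m) (∈B m′) (trans (κ≡ m) (sym (κ≡ m′)))
            (collide a a b b′ (𝟙≢0 _ h) (𝟙≢0 _ h′))))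
        λ {a} {a′} a∈ a′∈ h h′ → let (b , m , k) = ∑ₗ≢0 (class κ j B) _ h ; (b′ , m′ , k′) = ∑ₗ≢0 (class κ j B) _ h′ in
          proj₁ (inj a∈ a′∈ (∈B m) (∈B m′) (trans (κ≡ m) (sym (κ≡ m′))) (collide a a′ b b′ (𝟙≢0 _ k) (𝟙≢0 _ k′)))
      where
      ∈B : ∀ {b} → b ∈ class κ j B → b ∈ B
      ∈B m = proj₁ (∈-filter⁻ (λ b → κ b ℕP.≟ j) m)
      κ≡ : ∀ {b} → b ∈ class κ j B → κ b ≡ j
      κ≡ m = proj₂ (∈-filter⁻ (λ b → κ b ℕP.≟ j) {xs = B} m)
      collide : ∀ a a′ b b′ → N ∣ℤ b - (+ i - a) → N ∣ℤ b′ - (+ i - a′) → N ∣ℤ (a + b) - (a′ + b′)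
      collide a a′ b b′ h h′ = ∣-cast (lem a a′ b b′ (+ i)) (∣m∣n⇒∣m-n h h′)
        where
        lem : ∀ a a′ b b′ i → (b - (i - a)) - (b′ - (i - a′)) ≡ (a + b) - (a′ + b′)
        lem = solve-∀
    T≤N : ∀ j → j ℕ.< p → T j ≤ + N
    T≤N j _ = ℤP.≤-trans (∑<-mono N λ i _ → ≤1 j i) (ℤP.≤-reflexive (trans (∑<-const N 1ℤ) (ℤP.*-identityʳ (+ N))))
    total : ∑< p T ≡ + p * + N
    total = trans (swap p N c) (trans
      (∑<-cong N λ i _ → trans (sym (∑ₗ-∑<-swap A p _)) (∑ₗ-cong A λ a → sym (cnt-classes κ p N (+ i - a) B κ<p)))
      (trans (Tile-total N A B) (trans (cong +_ (trans (Tile-size M A B tile) M≡)) (ℤP.pos-* p N))))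
      where
      swap : ∀ m n (f : ℕ → ℕ → ℤ) → ∑< m (λ i → ∑< n (f i)) ≡ ∑< n (λ j → ∑< m (λ i → f i j))
      swap zero    n f = sym (∑<-zero n λ _ _ → refl)
      swap (suc m) n f = trans (cong (_+_ (∑< n (f 0))) (swap m n (f ∘ suc))) (sym (∑<-+ n (f 0) _))

  -- Splitting of fibres in the p direction

  -- The equation `n ≡ suc k ℕ.+ i` records i < n together with the exponent k + 1 of the
  -- complementary power of p.
  prime-to-part : ∀ {p} n z → p ≢ 0 → ¬ p ℕ.^ n ∣ℤ z → ∃ λ i → ∃ λ k → ∃ λ u →
    n ≡ suc k ℕ.+ i × z ≡ + (p ℕ.^ i) * u × ¬ p ∣ℤ u
  prime-to-part zero z p≢0 h = ⊥-elim (h (∣-cast (ℤP.*-identityʳ z) (∣-self z)))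
  prime-to-part {p} (suc n) z p≢0 h with + p ∣? z
  ... | no p∤z = 0 , n , z , cong suc (sym (ℕP.+-identityʳ n)) , sym (ℤP.*-identityˡ z) , p∤z
  ... | yes (divides z′ refl) with prime-to-part n z′ p≢0 (λ d → h (∣-cast (ℤP.*-comm (+ p) z′) (*-monoʳ-∣ℤ p d)))
  ... | i , k , u , e , refl , p∤u = suc i , k , u , trans (cong suc e) (sym (ℕP.+-suc (suc k) i)) ,
    trans (lem (+ (p ℕ.^ i)) u (+ p)) (cong (_* u) (sym (ℤP.pos-* p (p ℕ.^ i)))) , p∤u
    where
    lem : ∀ P u p → P * u * p ≡ p * P * u
    lem = solve-∀

  module Splitting {p n M₁ M : ℕ} (A B : List ℤ) .{{M≢0 : ℕ.NonZero M}} (pr : Prime p) (p∤M₁ : ¬ p ∣ M₁)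
    (M≡ : M ≡ p ℕ.^ suc n ℕ.* M₁)
    (tile : Tile M A B) where

    P S N : ℕ
    P = p ℕ.^ n
    S = p ℕ.^ suc n
    N = P ℕ.* M₁

    S≡ : + S ≡ + p * + P
    S≡ = ℤP.pos-* p P

    coprime-S-M₁ : Coprime S M₁
    coprime-S-M₁ = prime^-coprime (suc n) pr p∤M₁

    -- A solution by the Chinese remainder theorem. Being 1 modulo `M₁`, the multiplier fixes all
    -- residues there, while modulo `S` it can be any prescribed unit.
    dilation : ∀ ρ → ¬ p ∣ℤ ρ → ∃ λ r → S ∣ℤ + r - ρ × M₁ ∣ℤ + r - 1ℤ × r ≢ 0 × (∀ ℓ → Prime ℓ → ℓ ∣ r → ¬ ℓ ∣ M)
    dilation ρ p∤ρ with coprime-inverse (Coprime-sym coprime-S-M₁)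
    ... | u , inv = r , S∣ , M₁∣ , r≢0 , good
      where
      ρ′ = 1ℤ + (ρ - 1ℤ) * (+ M₁ * u)
      r = ρ′ %ℕ M
      r≡ : ∀ {d} → d ∣ M → d ∣ℤ + r - ρ′
      r≡ d∣M = ∣-flip ρ′ (+ r) (∣ℤ-trans d∣M (∣-%ℕ ρ′))
      S∣ : S ∣ℤ + r - ρ
      S∣ = ∣-cast (lem (+ r) ρ (+ M₁) u)
        (∣m∣n⇒∣m+n (r≡ (subst (S ∣_) (sym M≡) (ℕD.m∣m*n M₁))) (∣n⇒∣m*n (ρ - 1ℤ) inv))
        where
        lem : ∀ r ρ m u → (r - (1ℤ + (ρ - 1ℤ) * (m * u))) + (ρ - 1ℤ) * (m * u - 1ℤ) ≡ r - ρ
        lem = solve-∀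
      M₁∣ : M₁ ∣ℤ + r - 1ℤ
      M₁∣ = ∣-cast (lem (+ r) ρ (+ M₁) u)
        (∣m∣n⇒∣m+n (r≡ (subst (M₁ ∣_) (sym M≡) (ℕD.n∣m*n S))) (∣-self ((ρ - 1ℤ) * u)))
        where
        lem : ∀ r ρ m u → (r - (1ℤ + (ρ - 1ℤ) * (m * u))) + (ρ - 1ℤ) * u * m ≡ r - 1ℤ
        lem = solve-∀
      p∤r : ¬ p ∣ r
      p∤r d = p∤ρ (∣-cast (lem (+ r) ρ) (∣m∣n⇒∣m-n (∣ℕ⇒∣ℤ d) (∣ℤ-trans (ℕD.m∣m*n P) S∣)))
        where
        lem : ∀ r ρ → r - (r - ρ) ≡ ρ
        lem = solve-∀
      r≢0 : r ≢ 0
      r≢0 e = p∤r (subst (p ∣_) (sym e) (p ℕD.∣0))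
      good : ∀ ℓ → Prime ℓ → ℓ ∣ r → ¬ ℓ ∣ M
      good ℓ pℓ ℓ∣r ℓ∣M = [ (λ d → p∤r (subst (_∣ r) (prime∣prime pℓ pr (prime∣^ p (suc n) pℓ d)) ℓ∣r))
        , (λ d → prime∣1 pℓ (∣ℤ⇒∣ℕ (∣-cast (lem (+ r)) (∣m∣n⇒∣m-n (∣ℕ⇒∣ℤ ℓ∣r) (∣ℤ-trans d M₁∣))))) ]′
        (euclidsLemma S M₁ pℓ (subst (ℓ ∣_) M≡ ℓ∣M))
        where
        lem : ∀ r → r - (r - 1ℤ) ≡ 1ℤ
        lem = solve-∀

    length∣M : ∀ {C D} → Tile M C D → length C ∣ M
    length∣M {C} {D} t = ℕD.divides (length D) (trans (sym (Tile-size M C D t)) (ℕP.*-comm (length C) (length D)))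

    -- Dilating A by v and B by -u modulo p^(n+1) would make the two sums collide.
    sands : ∀ i u v {a a′ b b′} → a ∈ A → a′ ∈ A → b ∈ B → b′ ∈ B → a - a′ ≡ + (p ℕ.^ i) * u →
      b - b′ ≡ + (p ℕ.^ i) * v →
      ¬ p ∣ℤ u → ¬ p ∣ℤ v → M₁ ∣ℤ (a - a′) + (b - b′) → ⊥
    sands i u v {a} {a′} {b} {b′} a∈ a′∈ b∈ b′∈ eu ev p∤u p∤v sum =
      collide (dilation v p∤v) (dilation (- u) (λ d → p∤u (∣-cast (ℤP.neg-involutive u) (∣m⇒∣-m d))))
      where
      collide : (∃ λ r → S ∣ℤ + r - v × M₁ ∣ℤ + r - 1ℤ × r ≢ 0 × (∀ ℓ → Prime ℓ → ℓ ∣ r → ¬ ℓ ∣ M)) →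
        (∃ λ r → S ∣ℤ + r - - u × M₁ ∣ℤ + r - 1ℤ × r ≢ 0 × (∀ ℓ → Prime ℓ → ℓ ∣ r → ¬ ℓ ∣ M)) → ⊥
      -- The collision of two sums in the dilated tiling forces a = a′, hence u = 0, although p does
      -- not divide u.
      collide (r , Sr , M₁r , r≢0 , gr) (t , St , M₁t , t≢0 , gt) = p∤u (subst (p ∣ℤ_) (sym u≡0) ∣0)
        where
        tileʳ : Tile M (map (+ r *_) A) B
        tileʳ = Tile-dilate M r A B r≢0 (λ ℓ pℓ d e → gr ℓ pℓ d (ℕD.∣-trans e (length∣M {A} {B} tile))) tile
        tileᵗ : Tile M (map (+ t *_) B) (map (+ r *_) A)
        tileᵗ = Tile-dilate M t B (map (+ r *_) A) t≢0
          (λ ℓ pℓ d e → gt ℓ pℓ d (ℕD.∣-trans e (length∣M {B} {A} (Tile-comm {M} {A} {B} tile))))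
          (Tile-comm {M} {map (+ r *_) A} {B} tileʳ)
        -- With r ≡ v and t ≡ -u the difference of the sums is v p^i u - u p^i v = 0 modulo `S`.
        S∣ : S ∣ℤ (+ t * b + + r * a) - (+ t * b′ + + r * a′)
        S∣ = ∣-cast (lem₁ (+ t) (+ r) u v a a′ b b′)
          (∣m∣n⇒∣m+n (∣m∣n⇒∣m+n (∣m⇒∣m*n (b - b′) St) (∣m⇒∣m*n (a - a′) Sr))
            (∣-cast (sym (trans (cong₂ (λ y z → v * z - u * y) ev eu) (lem₃ u v (+ (p ℕ.^ i))))) ∣0))
          where
          lem₁ : ∀ t r u v a a′ b b′ → (t - - u) * (b - b′) + (r - v) * (a - a′) +
            (v * (a - a′) - u * (b - b′)) ≡ (t * b + r * a) - (t * b′ + r * a′)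
          lem₁ = solve-∀
          lem₃ : ∀ u v P → v * (P * u) - u * (P * v) ≡ 0ℤ
          lem₃ = solve-∀
        M₁∣ : M₁ ∣ℤ (+ t * b + + r * a) - (+ t * b′ + + r * a′)
        M₁∣ = ∣-cast (lem (+ t) (+ r) a a′ b b′)
          (∣m∣n⇒∣m+n sum (∣m∣n⇒∣m+n (∣m⇒∣m*n (b - b′) M₁t) (∣m⇒∣m*n (a - a′) M₁r)))
          where
          lem : ∀ t r a a′ b b′ → ((a - a′) + (b - b′)) + ((t - 1ℤ) * (b - b′) + (r - 1ℤ) * (a - a′)) ≡
            (t * b + r * a) - (t * b′ + r * a′)
          lem = solve-∀
        ra≡ : + r * a ≡ + r * a′
        ra≡ = proj₂ (Tile-injective {M} {map (+ t *_) B} {map (+ r *_) A} tileᵗ (∈-map⁺ (+ t *_) b∈)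
          (∈-map⁺ (+ t *_) b′∈) (∈-map⁺ (+ r *_) a∈) (∈-map⁺ (+ r *_) a′∈)
          (subst (_∣ℤ (+ t * b + + r * a) - (+ t * b′ + + r * a′)) (sym M≡) (coprime-*∣ℤ coprime-S-M₁ S∣ M₁∣)))
        a≡a′ : a ≡ a′
        a≡a′ = ℤP.*-cancelˡ-≡ (+ r) a a′ {{ℕ.≢-nonZero r≢0}} ra≡
        u≡0 : u ≡ 0ℤ
        u≡0 = ℤP.*-cancelˡ-≡ (+ (p ℕ.^ i)) u 0ℤ {{ℕP.m^n≢0 p i {{prime⇒nonZero pr}}}}
          (trans (sym eu) (trans (ℤP.i≡j⇒i-j≡0 a≡a′) (sym (ℤP.*-zeroʳ (+ (p ℕ.^ i))))))

  -- Slabs with at most one layer modulo p^(n+1) in each class modulo p^n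

  module SlabReduction {p n M₁ M : ℕ} (A B : List ℤ) .{{M≢0 : ℕ.NonZero M}} (pr : Prime p) (p∤M₁ : ¬ p ∣ M₁)
    (M≡ : M ≡ p ℕ.^ suc n ℕ.* M₁)
    (tile : Tile M A B) (sparse : ∀ x → cnt (p ℕ.^ n) x A < + p) where

    open Splitting {p} {n} {M₁} {M} A B pr p∤M₁ M≡ tile

    instance
      p≢0 : ℕ.NonZero p
      p≢0 = prime⇒nonZero pr
      P≢0 : ℕ.NonZero P
      P≢0 = ℕP.m^n≢0 p n
      M₁≢0 : ℕ.NonZero M₁
      M₁≢0 = ℕ.≢-nonZero λ { refl → p∤M₁ (p ℕD.∣0) }
      N≢0 : ℕ.NonZero N
      N≢0 = ℕP.m*n≢0 P M₁

    M≡pN : M ≡ p ℕ.* N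
    M≡pN = trans M≡ (ℕP.*-assoc p P M₁)

    P∣S : P ∣ S
    P∣S = ℕD.n∣m*n p

    +N≡ : + N ≡ + P * + M₁
    +N≡ = ℤP.pos-* P M₁

    S∣P* : ∀ {y} → p ∣ℤ y → S ∣ℤ + P * y
    S∣P* {y} (divides y′ refl) = divides y′ (trans (lem (+ P) y′ (+ p)) (cong (y′ *_) (sym S≡)))
      where
      lem : ∀ P y p → P * (y * p) ≡ y * (p * P)
      lem = solve-∀

    -- Otherwise a - a′ and b - b′ have the same p-part, which sands excludes.
    same-p-part : ∀ {a a′ b b′} → a ∈ A → a′ ∈ A → b ∈ B → b′ ∈ B → N ∣ℤ (a - a′) + (b - b′) → P ∣ℤ a - a′
    same-p-part {a} {a′} {b} {b′} a∈ a′∈ b∈ b′∈ (divides w eq) = decide (+ P ∣? (a - a′))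
      where
      decide : Dec (P ∣ℤ a - a′) → P ∣ℤ a - a′
      decide (yes h) = h
      decide (no h)  = conflict (prime-to-part n (a - a′) (prime≢0 pr) h)
        where
        conflict : (∃ λ i → ∃ λ k → ∃ λ u → n ≡ suc k ℕ.+ i × a - a′ ≡ + (p ℕ.^ i) * u × ¬ p ∣ℤ u) → P ∣ℤ a - a′
        conflict (i , k , u , n≡ , eu , p∤u) = ⊥-elim (sands i u (+ p * z - u) a∈ a′∈ b∈ b′∈ eu ev p∤u
            (λ d → p∤u (∣-cast (lem₂ (+ p) z u) (∣m∣n⇒∣m-n (∣m⇒∣m*n z ∣ℤ-refl) d)))
            (∣ℤ-trans (ℕD.n∣m*n P) (divides w eq)))
          where
          -- Since p^(i+1) divides `N`, the difference b - b′ is p^i times p z - u, which is prime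
          -- to p like u.
          z = w * + (p ℕ.^ k) * + M₁
          P≡ : + P ≡ + (p ℕ.^ i) * (+ p * + (p ℕ.^ k))
          P≡ = trans (cong (λ m → + (p ℕ.^ m)) n≡)
            (trans (cong +_ (ℕP.^-distribˡ-+-* p (suc k) i)) (trans (ℤP.pos-* (p ℕ.^ suc k) (p ℕ.^ i))
            (trans (ℤP.*-comm (+ (p ℕ.^ suc k)) (+ (p ℕ.^ i))) (cong (_*_ (+ (p ℕ.^ i))) (ℤP.pos-* p (p ℕ.^ k))))))
          lem : ∀ x y → y ≡ (x + y) - x
          lem = solve-∀
          lem₁ : ∀ w I p K m u → w * (I * (p * K) * m) - I * u ≡ I * (p * (w * K * m) - u)
          lem₁ = solve-∀
          lem₂ : ∀ p z u → p * z - (p * z - u) ≡ u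
          lem₂ = solve-∀
          ev : b - b′ ≡ + (p ℕ.^ i) * (+ p * z - u)
          ev = trans (lem (a - a′) (b - b′))
            (trans (cong₂ _-_ (trans eq (cong (w *_) (trans +N≡ (cong (_* + M₁) P≡)))) eu)
            (lem₁ w (+ (p ℕ.^ i)) (+ p) (+ (p ℕ.^ k)) (+ M₁) u))

    other-part : ∀ x y → P ∣ℤ x → N ∣ℤ x + y → P ∣ℤ y
    other-part x y h d = ∣-cast (x+y-x≡y x y) (∣m∣n⇒∣m-n (∣ℤ-trans (ℕD.m∣m*n M₁) d) h)

    -- Split a fibre at a + b: if A contributed the p-part once, A contributes it for the whole
    -- fibre, giving p elements of A in one class modulo p^n.
    module Fibre {a a′ b b′} (a∈ : a ∈ A) (a′∈ : a′ ∈ A) (b∈ : b ∈ B) (b′∈ : b′ ∈ B) (u v : ℤ)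
      (eu : a - a′ ≡ + P * u) (ev : b - b′ ≡ + P * (v * + p)) (p∤u : ¬ p ∣ℤ u) (sum : N ∣ℤ (a - a′) + (b - b′)) where

      point : ∀ k → ∃ λ a₀ → a₀ ∈ A × S ∣ℤ a₀ - (a + k * + N)
      point k = from (Tile-surjective {M} {A} {B} tile (a + b + k * + N))
        where
        from : (∃ λ a₀ → ∃ λ b₀ → a₀ ∈ A × b₀ ∈ B × M ∣ℤ (a₀ + b₀) - (a + b + k * + N)) → ∃ λ a₀ →
          a₀ ∈ A × S ∣ℤ a₀ - (a + k * + N)
        from (a₀ , b₀ , a₀∈ , b₀∈ , d) = a₀ , a₀∈ , ∣-cast (lem a b a₀ b₀ (k * + N))
          (∣m∣n⇒∣m-n (∣ℤ-trans (subst (S ∣_) (sym M≡) (ℕD.m∣m*n M₁)) d) S∣b)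
          where
          lem : ∀ a b a₀ b₀ w → ((a₀ + b₀) - (a + b + w)) - (b₀ - b) ≡ a₀ - (a + w)
          lem = solve-∀
          d′ : N ∣ℤ (a₀ - a) + (b₀ - b)
          d′ = ∣-cast (lem′ a b a₀ b₀ (k * + N))
            (∣m∣n⇒∣m+n (∣ℤ-trans (subst (N ∣_) (sym M≡pN) (ℕD.n∣m*n p)) d) (∣-self k))
            where
            lem′ : ∀ a b a₀ b₀ w → ((a₀ + b₀) - (a + b + w)) + w ≡ (a₀ - a) + (b₀ - b)
            lem′ = solve-∀
          M₁∣N : M₁ ∣ N
          M₁∣N = ℕD.n∣m*n P
          S∣b : S ∣ℤ b₀ - b
          S∣b = go (same-p-part a₀∈ a∈ b₀∈ b∈ d′)
            where
            go : P ∣ℤ a₀ - a → S ∣ℤ b₀ - b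
            go h@(divides x ex) = go′ (other-part (a₀ - a) (b₀ - b) h d′)
              where
              ex′ : a₀ - a ≡ + P * x
              ex′ = trans ex (ℤP.*-comm x (+ P))
              go′ : P ∣ℤ b₀ - b → S ∣ℤ b₀ - b
              go′ (divides y ey) = cases (+ p ∣? y) (+ p ∣? x)
                where
                ey′ : b₀ - b ≡ + P * y
                ey′ = trans ey (ℤP.*-comm y (+ P))
                cases : Dec (p ∣ℤ y) → Dec (p ∣ℤ x) → S ∣ℤ b₀ - b
                cases (yes p∣y) _ = ∣-cast (sym ey′) (S∣P* p∣y)
                cases (no p∤y) (no p∤x) = ⊥-elim (sands n x y a₀∈ a∈ b₀∈ b∈ ex′ ey′ p∤x p∤y (∣ℤ-trans M₁∣N d′))
                -- Compared with a and b, only the second summand has moved modulo `S`. Compared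
                -- with a′ and b′ both have moved, and `sands` applies to that pair.
                cases (no p∤y) (yes p∣x) = ⊥-elim (sands n (x + u) (y + v * + p) a₀∈ a′∈ b₀∈ b′∈
                    (trans (lem₁ a₀ a a′) (trans (cong₂ _+_ ex′ eu) (sym (ℤP.*-distribˡ-+ (+ P) x u))))
                    (trans (lem₁ b₀ b b′) (trans (cong₂ _+_ ey′ ev) (sym (ℤP.*-distribˡ-+ (+ P) y (v * + p)))))
                    (λ h → p∤u (∣-cast (x+y-x≡y x u) (∣m∣n⇒∣m-n h p∣x)))
                    (λ h → p∤y (∣-cast (lem₃ y (v * + p)) (∣m∣n⇒∣m-n h (∣-self v))))
                    (∣ℤ-trans M₁∣N (∣-cast (lem₄ a₀ a a′ b₀ b b′) (∣m∣n⇒∣m+n d′ sum))))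
                  where
                  lem₁ : ∀ x y z → x - z ≡ (x - y) + (y - z)
                  lem₁ = solve-∀
                  lem₃ : ∀ y w → (y + w) - w ≡ y
                  lem₃ = solve-∀
                  lem₄ : ∀ a₀ a a′ b₀ b b′ → ((a₀ - a) + (b₀ - b)) + ((a - a′) + (b - b′)) ≡ (a₀ - a′) + (b₀ - b′)
                  lem₄ = solve-∀

      crowded : + p ≤ cnt P a A
      crowded = crowd (coprime-inverse (Coprime-sym (prime-coprime pr p∤M₁)))
        where
        crowd : (∃ λ w → p ∣ℤ + M₁ * w - 1ℤ) → + p ≤ cnt P a A
        -- With w inverse to `M₁` modulo p, the fibre point with k = j w satisfies k `N` ≡ j `P`
        -- modulo `S`, so its summand in `A` lies in the j-th layer of the class of a.
        crowd (w , inv) = ℤP.≤-trans (ℤP.≤-reflexive (sym (trans (∑<-const p 1ℤ) (ℤP.*-identityʳ (+ p)))))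
          (ℤP.≤-trans (∑<-mono p λ j _ → hit j) (ℤP.≤-reflexive (sym (cnt-split p P (ℕ.≢-nonZero⁻¹ P) a A))))
          where
          hit : ∀ j → 1ℤ ≤ cnt S (a + + j * + P) A
          hit j = let (a₀ , a₀∈ , d) = point (+ j * w) in
            cnt-member a₀∈ (∣-cast (trans (cong (λ N → a₀ - (a + + j * w * N) + + P * (+ j * (+ M₁ * w - 1ℤ)))
              +N≡) (lem a₀ a (+ j) w (+ P) (+ M₁)))
              (∣m∣n⇒∣m+n d (S∣P* (∣n⇒∣m*n (+ j) inv))))
            where
            lem : ∀ a₀ a j w P m → a₀ - (a + j * w * (P * m)) + P * (j * (m * w - 1ℤ)) ≡ a₀ - (a + j * P)
            lem = solve-∀

    -- Within each class modulo `P`, a key distinguishes the layers modulo `S`. The labels in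
    -- different classes are unrelated, which leaves room to change a slab in a single class.
    Key : (ℤ → ℕ) → Set
    Key κ = ∀ b b′ → P ∣ℤ b - b′ → κ b ≡ κ b′ → S ∣ℤ b - b′

    -- Both differences are divisible by `P`, and the key makes b - b′ divisible by `S`. If a - a′
    -- were not, the fibre would crowd p elements of `A` into one class; so both sums agree modulo
    -- M.
    pair-injective : ∀ κ → Key κ → ∀ {a a′ b b′} → a ∈ A → a′ ∈ A → b ∈ B → b′ ∈ B → κ b ≡ κ b′ →
      N ∣ℤ (a + b) - (a′ + b′) → a ≡ a′ × b ≡ b′
    pair-injective κ key {a} {a′} {b} {b′} a∈ a′∈ b∈ b′∈ κ≡ d = go (same-p-part a∈ a′∈ b∈ b′∈ d′)
      where
      regroup : ∀ a a′ b b′ → (a + b) - (a′ + b′) ≡ (a - a′) + (b - b′)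
      regroup = solve-∀
      d′ : N ∣ℤ (a - a′) + (b - b′)
      d′ = ∣-cast (regroup a a′ b b′) d
      go : P ∣ℤ a - a′ → a ≡ a′ × b ≡ b′
      go h@(divides u eu) = go′ (key b b′ (other-part (a - a′) (b - b′) h d′) κ≡)
        where
        go′ : S ∣ℤ b - b′ → a ≡ a′ × b ≡ b′
        go′ S∣b@(divides v ev) = cases (+ p ∣? u)
          where
          cases : Dec (p ∣ℤ u) → a ≡ a′ × b ≡ b′
          cases (yes p∣u) = Tile-injective {M} {A} {B} tile a∈ a′∈ b∈ b′∈ (subst (_∣ℤ (a + b) - (a′ + b′)) (sym M≡)
            (coprime-*∣ℤ coprime-S-M₁ (∣-cast (sym (regroup a a′ b b′))
              (∣m∣n⇒∣m+n (∣-cast (trans (ℤP.*-comm (+ P) u) (sym eu)) (S∣P* p∣u)) S∣b))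
              (∣ℤ-trans (ℕD.n∣m*n P) d)))
          cases (no p∤u) = ⊥-elim (ℤP.<⇒≱ (sparse a) (Fibre.crowded a∈ a′∈ b∈ b′∈ u v (trans eu (ℤP.*-comm u (+ P)))
            (trans ev (trans (cong (v *_) S≡) (lem v (+ p) (+ P)))) p∤u d′))
            where
            lem : ∀ v p P → v * (p * P) ≡ P * (v * p)
            lem = solve-∀

    Tile-slab : ∀ κ → Key κ → (∀ b → κ b ℕ.< p) → ∀ j → j ℕ.< p → Tile N A (class κ j B)
    Tile-slab κ key κ<p = Tile-classes {M} {N} {p} A B κ tile M≡pN κ<p (pair-injective κ key)

    -- The base p digit of index n, the standard key.
    digit : ℤ → ℕ
    digit b = (b /ℕ P) %ℕ p

    digit<p : ∀ b → digit b ℕ.< p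
    digit<p b = n%ℕd<d (b /ℕ P) p

    quotient-difference : ∀ b b′ → P ∣ℤ b - b′ → b - b′ ≡ + P * (b /ℕ P - b′ /ℕ P)
    quotient-difference b b′ h = trans (cong₂ _-_ (a≡a%ℕn+[a/ℕn]*n b P) (a≡a%ℕn+[a/ℕn]*n b′ P))
      (trans (cong (λ r → (+ r + b /ℕ P * + P) - (+ (b′ %ℕ P) + b′ /ℕ P * + P)) same)
        (lem (+ (b′ %ℕ P)) (b /ℕ P) (b′ /ℕ P) (+ P)))
      where
      same : b %ℕ P ≡ b′ %ℕ P
      same = small-∣⇒≡ (n%ℕd<d b P) (n%ℕd<d b′ P)
        (∣-chain (+ (b %ℕ P)) b (+ (b′ %ℕ P)) (∣-flip b (+ (b %ℕ P)) (∣-%ℕ b))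
        (∣-chain b b′ (+ (b′ %ℕ P)) h (∣-%ℕ b′)))
      lem : ∀ r x y P → (r + x * P) - (r + y * P) ≡ P * (x - y)
      lem = solve-∀

    digit-key : Key digit
    digit-key b b′ h e = ∣-cast (sym (quotient-difference b b′ h))
      (S∣P* (∣-chain (b /ℕ P) (+ digit b) (b′ /ℕ P) (∣-%ℕ (b /ℕ P))
      (subst (λ r → p ∣ℤ + r - b′ /ℕ P) (sym e) (∣-flip (b′ /ℕ P) (+ digit b′) (∣-%ℕ (b′ /ℕ P))))))

    digit-cong : ∀ b b′ → S ∣ℤ b - b′ → digit b ≡ digit b′
    digit-cong b b′ h = small-∣⇒≡ (digit<p b) (digit<p b′)
      (∣-chain (+ digit b) (b /ℕ P) (+ digit b′) (∣-flip (b /ℕ P) (+ digit b) (∣-%ℕ (b /ℕ P)))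
      (∣-chain (b /ℕ P) (b′ /ℕ P) (+ digit b′)
        (*-cancelˡ-∣ℤ P (ℕ.≢-nonZero⁻¹ P)
        (subst₂ _∣ℤ_ (ℕP.*-comm p P) (quotient-difference b b′ (∣ℤ-trans P∣S h)) h)) (∣-%ℕ (b′ /ℕ P))))

  -- Lifting (T2) from slabs

  module SlabT2 {p n M₁ M : ℕ} (A B : List ℤ) .{{M≢0 : ℕ.NonZero M}} (pr : Prime p) (p∤M₁ : ¬ p ∣ M₁)
    (M≡ : M ≡ p ℕ.^ suc n ℕ.* M₁)
    (tile : Tile M A B) (sparse : ∀ x → cnt (p ℕ.^ n) x A < + p) (levB : Lev p n B)
    (T2N : ∀ A B → Tile (p ℕ.^ n ℕ.* M₁) A B → T2-mod (p ℕ.^ n ℕ.* M₁) A × T2-mod (p ℕ.^ n ℕ.* M₁) B) where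

    open Splitting {p} {n} {M₁} {M} A B pr p∤M₁ M≡ tile using (P; S; N; S≡; coprime-S-M₁)
    open SlabReduction {p} {n} {M₁} {M} A B pr p∤M₁ M≡ tile sparse

    tileᵗ : Tile M B A
    tileᵗ = Tile-comm {M} {A} {B} tile

    ∣N : ∀ {q} α → Prime q → q ℕ.^ α ∣ M → (q ≡ p → α ≢ suc n) → q ℕ.^ α ∣ N
    ∣N {q} α pq d α≢ = decide (q ℕP.≟ p)
      where
      decide : Dec (q ≡ p) → q ℕ.^ α ∣ N
      decide (no q≢p) = coprime-divisor (prime^-coprime α pq (λ h → q≢p (prime∣prime pq pr h)))
        (subst (q ℕ.^ α ∣_) M≡pN d)
      decide (yes refl) = ℕD.∣m⇒∣m*n M₁ (^-mono-∣ p α≤n)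
        where
        α≤n : α ℕ.≤ n
        α≤n = ℕP.≤-pred (ℕP.≤∧≢⇒< (^-cancel-∣ {v = suc n} pr p∤M₁ (subst (p ℕ.^ α ∣_) M≡ d)) (α≢ refl))

    -- The only prime power dividing M but not `N` is p^(n+1), where the condition belongs to `B`
    -- and hence not to `A`.
    T2-A : T2-mod M A
    T2-A ps ps≢[] gs u ds ls = proj₁ (T2N A (class digit 0 B)
      (Tile-slab digit digit-key digit<p 0 (ℕ.>-nonZero⁻¹ p))) ps ps≢[] gs u
      (All.tabulate λ { {q , α} m → ∣N α (proj₁ (All.lookup gs m)) (All.lookup ds m)
        (λ q≡p α≡ → excluded q≡p α≡ (All.lookup ls m)) }) ls
      where
      excluded : ∀ {q α} → q ≡ p → α ≡ suc n → Condition A (q , α) → ⊥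
      excluded refl refl lev = proj₂ (Lev-absent n A B pr tile lev) levB

    module _ (κ : ℤ → ℕ) (key : Key κ) (κ<p : ∀ b → κ b ℕ.< p) where

      -- The slab tiles with `A` modulo `N`, and `A` has no condition that `B` has, so the dichotomy
      -- leaves it to the slab.
      inherit : ∀ ps j → j ℕ.< p → All PrimePower ps → All (λ (q , α) → q ℕ.^ α ∣ N) ps → All (Condition B) ps →
        All (Condition (class κ j B)) ps
      inherit [] j j<p [] [] [] = []
      inherit ((q , suc i) ∷ ps) j j<p ((pq , _) ∷ gs) (d ∷ ds) (l ∷ ls) =
        [ (λ k → ⊥-elim (proj₂ (Lev-absent i B A pq tileᵗ l) k)) , id ]′
          (Lev-dichotomy i A (class κ j B) pq d (Tile-slab κ key κ<p j j<p)) ∷ inherit ps j j<p gs ds ls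

      CC-slab : ∀ ps j → j ℕ.< p → ps ≢ [] → All PrimePower ps → Unique (map proj₁ ps) →
        All (λ (q , α) → q ℕ.^ α ∣ N) ps → All (Condition B) ps → CC ps (class κ j B)
      CC-slab ps j j<p ps≢[] gs u ds ls =
        proj₂ (T2N A (class κ j B) (Tile-slab κ key κ<p j j<p)) ps ps≢[] gs u ds (inherit ps j j<p gs ds ls)

    T2-B-low : ∀ ps → ps ≢ [] → All PrimePower ps → Unique (map proj₁ ps) → All (λ (q , α) → q ℕ.^ α ∣ N) ps →
      All (Condition B) ps → CC ps B
    T2-B-low ps ps≢[] gs u ds ls hs dirs = Cub-classes hs digit p (prod ps) B digit<p λ j j<p →
      CC-slab digit digit-key digit<p ps j j<p ps≢[] gs u ds ls hs dirs

    -- Changing the slab in the single class of x modulo P exchanges the classes of x and x - h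
    -- modulo S, so these have the same cuboid values.
    module Exchange (x h : ℤ) (P∣h : P ∣ℤ h) where

      layer : ℤ → List ℤ
      layer z = filter (λ b → + S ∣? (b - z)) B

      -- Shifting by h inside the class of x modulo `P` makes the label `digit x` select the layer
      -- of x - h there in place of the layer of x.
      key′ : ℤ → ℕ
      key′ b with + P ∣? (b - x)
      ... | yes _ = digit (b + h)
      ... | no _  = digit b

      key′-in : ∀ b → P ∣ℤ b - x → key′ b ≡ digit (b + h)
      key′-in b d with + P ∣? (b - x)
      ... | yes _ = refl
      ... | no ¬d = ⊥-elim (¬d d)

      key′-out : ∀ b → ¬ P ∣ℤ b - x → key′ b ≡ digit b
      key′-out b ¬d with + P ∣? (b - x)
      ... | yes d = ⊥-elim (¬d d)
      ... | no _  = refl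

      key′<p : ∀ b → key′ b ℕ.< p
      key′<p b with + P ∣? (b - x)
      ... | yes _ = digit<p (b + h)
      ... | no _  = digit<p b

      key′-key : Key key′
      key′-key b b′ d e = decide (+ P ∣? (b - x))
        where
        lem : ∀ b b′ h → b - b′ ≡ (b + h) - (b′ + h)
        lem = solve-∀
        decide : Dec (P ∣ℤ b - x) → S ∣ℤ b - b′
        decide (yes k) = ∣-cast (sym (lem b b′ h)) (digit-key (b + h) (b′ + h) (∣-cast (lem b b′ h) d)
          (trans (sym (key′-in b k)) (trans e (key′-in b′ (∣-chain b′ b x (∣-flip b b′ d) k)))))
        decide (no ¬k) = digit-key b b′ d
          (trans (sym (key′-out b ¬k)) (trans e (key′-out b′ λ k → ¬k (∣-chain b b′ x d k))))

      -- In the class of x modulo `P` the two slabs are the layers of x and of x - h; elsewhere they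
      -- coincide and both layers are empty.
      exchange : ∀ b → 𝟙 (digit b ℕP.≟ digit x) + 𝟙 (+ S ∣? (b - (x - h))) ≡ 𝟙 (key′ b ℕP.≟ digit x) + 𝟙
        (+ S ∣? (b - x))
      exchange b = decide (+ P ∣? (b - x))
        where
        lem : ∀ b x h → b - (x - h) ≡ (b + h) - x
        lem = solve-∀
        lem₂ : ∀ b x h → (b - (x - h)) - h ≡ b - x
        lem₂ = solve-∀
        lem₃ : ∀ b x h → (b - x) + h ≡ (b + h) - x
        lem₃ = solve-∀
        decide : Dec (P ∣ℤ b - x) → _
        decide (yes k) = trans (ℤP.+-comm (𝟙 (digit b ℕP.≟ digit x)) _) (cong₂ _+_
          (𝟙-cong (+ S ∣? (b - (x - h))) (key′ b ℕP.≟ digit x)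
            (λ d → trans (key′-in b k) (digit-cong (b + h) x (∣-cast (lem b x h) d)))
            (λ e → ∣-cast (sym (lem b x h)) (digit-key (b + h) x (∣-cast (lem₃ b x h) (∣m∣n⇒∣m+n k P∣h))
              (trans (sym (key′-in b k)) e))))
          (𝟙-cong (digit b ℕP.≟ digit x) (+ S ∣? (b - x)) (digit-key b x k) (digit-cong b x)))
        decide (no ¬k) = cong₂ _+_ (𝟙-cong (digit b ℕP.≟ digit x) (key′ b ℕP.≟ digit x) (trans (key′-out b ¬k))
          (trans (sym (key′-out b ¬k))))
          (trans (𝟙-no (+ S ∣? (b - (x - h))) (λ d → ¬k (∣-cast (lem₂ b x h) (∣m∣n⇒∣m-n (∣ℤ-trans P∣S d) P∣h))))
            (sym (𝟙-no (+ S ∣? (b - x)) (λ d → ¬k (∣ℤ-trans P∣S d)))))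

      cnt-exchange : ∀ Q y → cnt Q y (class digit (digit x) B) + cnt Q y (layer (x - h)) ≡ cnt Q y
        (class key′ (digit x) B) + cnt Q y (layer x)
      cnt-exchange Q y = trans (cong₂ _+_ (∑ₗ-filter (λ b → digit b ℕP.≟ digit x) B w)
        (∑ₗ-filter (λ b → + S ∣? (b - (x - h))) B w))
        (trans (sym (∑ₗ-+ B (λ b → i₁ b * w b) (λ b → i₂ b * w b)))
          (trans (∑ₗ-cong B λ b → trans (sym (ℤP.*-distribʳ-+ (w b) (i₁ b) (i₂ b)))
            (trans (cong (_* w b) (exchange b)) (ℤP.*-distribʳ-+ (w b) (i₃ b) (i₄ b))))
          (trans (∑ₗ-+ B (λ b → i₃ b * w b) (λ b → i₄ b * w b))
            (sym (cong₂ _+_ (∑ₗ-filter (λ b → key′ b ℕP.≟ digit x) B w) (∑ₗ-filter (λ b → + S ∣? (b - x)) B w))))))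
        where
        w i₁ i₂ i₃ i₄ : ℤ → ℤ
        w b = δ Q (b - y)
        i₁ b = 𝟙 (digit b ℕP.≟ digit x)
        i₂ b = 𝟙 (+ S ∣? (b - (x - h)))
        i₃ b = 𝟙 (key′ b ℕP.≟ digit x)
        i₄ b = 𝟙 (+ S ∣? (b - x))

    -- Directions divisible by `S` keep every vertex in the class of x modulo `S`, where counting
    -- `B` modulo `S` Q means counting the layer modulo Q.
    Cub-layer : ∀ {Q} x h P∣h hs → Coprime S Q → All (S ∣ℤ_) hs →
      Cub hs (λ y → cnt (S ℕ.* Q) y B) x ≡ Cub hs (λ y → cnt Q y (Exchange.layer x h P∣h x)) x
    Cub-layer {Q} x h P∣h hs cop S∣hs =
      Cub-transfer (λ y y′ → y ≡ y′ × S ∣ℤ y - x) {λ y → cnt (S ℕ.* Q) y B} {λ y → cnt Q y (layer x)}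
      (λ { y _ (refl , d) → same y d })
        (shifts S∣hs) x x (refl , ∣-cast (sym (ℤP.+-inverseʳ x)) ∣0)
      where
      open Exchange x h P∣h
      shifts : ∀ {hs} → All (S ∣ℤ_) hs →
        Pointwise (λ h h′ → ∀ y y′ → y ≡ y′ × S ∣ℤ y - x → y - h ≡ y′ - h′ × S ∣ℤ y - h - x) hs hs
      shifts []       = []
      shifts {k ∷ _} (d ∷ ds) = (λ { y _ (refl , e) → refl , ∣-cast (lem y x k) (∣m∣n⇒∣m-n e d) }) ∷ shifts ds
        where
        lem : ∀ y x k → (y - x) - k ≡ y - k - x
        lem = solve-∀
      same : ∀ y → S ∣ℤ y - x → cnt (S ℕ.* Q) y B ≡ cnt Q y (layer x)
      same y d = trans (∑ₗ-cong B pointwise) (sym (∑ₗ-filter (λ b → + S ∣? (b - x)) B (λ b → δ Q (b - y))))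
        where
        pointwise : ∀ b → δ (S ℕ.* Q) (b - y) ≡ 𝟙 (+ S ∣? (b - x)) * δ Q (b - y)
        pointwise b with + S ∣? (b - x)
        ... | yes e = trans (δ-cong {S ℕ.* Q} {Q} {b - y} {b - y} (∣ℤ-trans (ℕD.n∣m*n S))
          (λ k → coprime-*∣ℤ cop (∣-chain b x y e (∣-flip y x d)) k)) (sym (ℤP.*-identityˡ _))
        ... | no ¬e = trans (δ-no (λ k → ¬e (∣-chain b y x (∣ℤ-trans (ℕD.m∣m*n Q) k) d)))
          (sym (ℤP.*-zeroˡ (δ Q (b - y))))

    -- The direction of p satisfies `P` Q | h: translation by h changes the layer within a class
    -- modulo `P` but no residue modulo Q. The two terms are thus cuboids of two layers at the same
    -- point, and they agree because the two slabs that differ by these layers have vanishing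
    -- cuboids.
    T2-B-top : ∀ ps → All PrimePower ps → Unique (p ∷ map proj₁ ps) → All (λ (q , α) → q ℕ.^ α ∣ N) ps →
      All (Condition B) ps → CC ((p , suc n) ∷ ps) B
    T2-B-top [] gs u ds ls = Lev⇒CC-single p n B (prime≢0 pr) levB
    T2-B-top ps@(_ ∷ _) gs (p∉ ∷ u) ds ls (h ∷ hs) (dir ∷ dirs) x = ℤP.i≡j⇒i-j≡0 (begin
        Cub hs (λ y → cnt (S ℕ.* Q) y B) (x - h)          ≡⟨ Cub-layer (x - h) h P∣h hs cop S∣hs ⟩
        Cub hs (λ y → cnt Q y (layer (x - h))) (x - h)    ≡⟨ Cub-periodic hs (λ y → cnt Q y (layer (x - h))) h
          (λ y → cnt-shift Q (y - h) y (layer (x - h)) (∣-cast (lem y h) (∣m⇒∣-m Q∣h))) x ⟩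
        Cub hs (λ y → cnt Q y (layer (x - h))) x          ≡⟨ layers-agree ⟩
        Cub hs (λ y → cnt Q y (layer x)) x                ≡⟨ sym (Cub-layer x h P∣h hs cop S∣hs) ⟩
        Cub hs (λ y → cnt (S ℕ.* Q) y B) x                ∎)
      where
      open ≡-Reasoning
      Q = prod ps
      cop : Coprime S Q
      cop = prime^-coprime (suc n) pr (prime∤prod ps gs pr p∉)
      PQ∣h : P ℕ.* Q ∣ℤ h
      PQ∣h = *-cancelˡ-∣ℤ p (prime≢0 pr) (subst (_∣ℤ + p * h) (ℕP.*-assoc p P Q) dir)
      P∣h : P ∣ℤ h
      P∣h = ∣ℤ-trans (ℕD.m∣m*n Q) PQ∣h
      Q∣h : Q ∣ℤ h
      Q∣h = ∣ℤ-trans (ℕD.n∣m*n P) PQ∣h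
      open Exchange x h P∣h
      lem : ∀ y h → - h ≡ y - h - y
      lem = solve-∀
      S∣directions : ∀ (ps : List (ℕ × ℕ)) {hs} → All PrimePower ps → All (p ≢_) (map proj₁ ps) →
        Pointwise (λ pα h → S ℕ.* Q ∣ℤ + proj₁ pα * h) ps hs → All (S ∣ℤ_) hs
      S∣directions [] [] [] [] = []
      S∣directions ((q , _) ∷ ps) {h ∷ _} ((pq , _) ∷ gs) (p≢q ∷ p∉) (d ∷ ds) =
        coprime-divisorℤ h (prime^-coprime (suc n) pr (λ k → p≢q (prime∣prime pr pq k)))
          (∣ℤ-trans (ℕD.m∣m*n Q) d) ∷ S∣directions ps gs p∉ ds
      S∣hs : All (S ∣ℤ_) hs
      S∣hs = S∣directions ps gs p∉ dirs
      Qdirs : Pointwise (λ pα h → Q ∣ℤ + proj₁ pα * h) ps hs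
      Qdirs = Pointwise.map (∣ℤ-trans (ℕD.n∣m*n S)) dirs
      layers-agree : Cub hs (λ y → cnt Q y (layer (x - h))) x ≡ Cub hs (λ y → cnt Q y (layer x)) x
      layers-agree = begin
        Cub hs (λ y → cnt Q y (layer (x - h))) x
          ≡⟨ sym (trans (cong (_+ Cub hs (λ y → cnt Q y (layer (x - h))) x)
            (CC-slab digit digit-key digit<p ps (digit x) (digit<p x) (λ ()) gs u ds ls hs Qdirs x))
            (ℤP.+-identityˡ _)) ⟩
        Cub hs (λ y → cnt Q y (class digit (digit x) B)) x + Cub hs (λ y → cnt Q y (layer (x - h))) x
          ≡⟨ sym (Cub-+ hs (λ y → cnt Q y (class digit (digit x) B)) (λ y → cnt Q y (layer (x - h))) x) ⟩
        Cub hs (λ y → cnt Q y (class digit (digit x) B) + cnt Q y (layer (x - h))) x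
          ≡⟨ Cub-cong hs (cnt-exchange Q) x ⟩
        Cub hs (λ y → cnt Q y (class key′ (digit x) B) + cnt Q y (layer x)) x
          ≡⟨ Cub-+ hs (λ y → cnt Q y (class key′ (digit x) B)) (λ y → cnt Q y (layer x)) x ⟩
        Cub hs (λ y → cnt Q y (class key′ (digit x) B)) x + Cub hs (λ y → cnt Q y (layer x)) x
          ≡⟨ trans (cong (_+ Cub hs (λ y → cnt Q y (layer x)) x)
            (CC-slab key′ key′-key key′<p ps (digit x) (digit<p x) (λ ()) gs u ds ls hs Qdirs x))
            (ℤP.+-identityˡ _) ⟩
        Cub hs (λ y → cnt Q y (layer x)) x ∎

    all-∣N : ∀ ps → All PrimePower ps → All (λ (q , α) → q ℕ.^ α ∣ M) ps →
      All (λ (q , α) → q ≡ p → α ≢ suc n) ps → All (λ (q , α) → q ℕ.^ α ∣ N) ps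
    all-∣N [] [] [] [] = []
    all-∣N ((q , α) ∷ ps) ((pq , _) ∷ gs) (d ∷ ds) (k ∷ ks) = ∣N α pq d k ∷ all-∣N ps gs ds ks

    avoid : ∀ (ps : List (ℕ × ℕ)) → All (p ≢_) (map proj₁ ps) → All (λ (q , α) → q ≡ p → α ≢ suc n) ps
    avoid []       []         = []
    avoid (_ ∷ ps) (p≢q ∷ p∉) = (λ q≡p _ → p≢q (sym q≡p)) ∷ avoid ps p∉

    T2-B : T2-mod M B
    T2-B ps ps≢[] gs u ds ls = decide (Any.any? (p ℕP.≟_) (map proj₁ ps))
      where
      decide : Dec (p ∈ map proj₁ ps) → CC ps B
      decide (no p∉) = T2-B-low ps ps≢[] gs u (all-∣N ps gs ds (avoid ps (AllP.¬Any⇒All¬ _ p∉))) ls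
      decide (yes p∈) = split (extract ps p∈ u)
        where
        split : (∃ λ α → ∃ λ ps′ → ps ↭ (p , α) ∷ ps′ × Unique (p ∷ map proj₁ ps′)) → CC ps B
        split (α , ps′ , r , p∉ ∷ u′) = CC-↭ {A = B} (Perm.↭-sym r) (level (α ℕP.≟ suc n))
          where
          gs′ = All-resp-↭ r gs
          ds′ = All-resp-↭ r ds
          ls′ = All-resp-↭ r ls
          level : Dec (α ≡ suc n) → CC ((p , α) ∷ ps′) B
          level (yes refl) = T2-B-top ps′ (All.tail gs′) (p∉ ∷ u′)
            (all-∣N ps′ (All.tail gs′) (All.tail ds′) (avoid ps′ p∉)) (All.tail ls′)
          level (no α≢) = T2-B-low ((p , α) ∷ ps′) (λ ()) gs′ (p∉ ∷ u′)
            (all-∣N ((p , α) ∷ ps′) gs′ ds′ ((λ _ → α≢) ∷ avoid ps′ p∉)) ls′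

  -- The induction on M

  -- With m = rad M₁ this is D(M₁) < p; in this form it passes to divisors of M₁ at once.
  Small : ℕ → ℕ → Set
  Small p M₁ = ∀ m → m ≢ 0 → (∀ q → Prime q → q ∣ M₁ → q ∣ m) → M₁ ℕ.< p ℕ.* m

  T2-all : ℕ → Set
  T2-all M = ∀ A B → Tile M A B → T2-mod M A × T2-mod M B

  -- If m is a multiple of all primes of `N`, then q m is one for q `N`; the resulting inequality is
  -- divided by q.
  Small-divide : ∀ {p q N} → Prime q → Small p (q ℕ.* N) → Small p N
  Small-divide {p} {q} {N} pq small m m≢0 rad∣m = ℕP.*-cancelˡ-< q N (p ℕ.* m) (subst (q ℕ.* N ℕ.<_) (lem p q m)
      (small (q ℕ.* m) (λ e → [ prime≢0 pq , m≢0 ]′ (ℕP.m*n≡0⇒m≡0∨n≡0 q e))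
        λ ℓ pℓ d → [ (λ d → ℕD.∣m⇒∣m*n m d) , (λ d → ℕD.∣n⇒∣m*n q (rad∣m ℓ pℓ d)) ]′ (euclidsLemma q N pℓ d)))
    where
    lem : ∀ p q m → p ℕ.* (q ℕ.* m) ≡ q ℕ.* (p ℕ.* m)
    lem p q m = trans (sym (ℕP.*-assoc p q m)) (trans (cong (ℕ._* m) (ℕP.*-comm p q)) (ℕP.*-assoc q p m))

  missing-prime? : ∀ M₁ → M₁ ≢ 0 → ∀ n → (∃ λ q → Prime q × q ∣ M₁ × ¬ q ∣ n) ⊎ (∀ q → Prime q → q ∣ M₁ → q ∣ n)
  missing-prime? M₁ M₁≢0 n with ℕP.anyUpTo? (λ q → prime? q ×-dec (q ℕD.∣? M₁) ×-dec ¬? (q ℕD.∣? n)) (suc M₁)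
  ... | yes (q , _ , h) = inj₁ (q , h)
  ... | no none = inj₂ λ q pq q∣M₁ → decidable-stable (q ℕD.∣? n) λ q∤n →
    none (q , s≤s (ℕD.∣⇒≤ {{ℕ.≢-nonZero M₁≢0}} q∣M₁) , pq , q∣M₁ , q∤n)

  slab-step : ∀ {p n M₁ M} A B .{{_ : ℕ.NonZero M}} → Prime p → ¬ p ∣ M₁ → M ≡ p ℕ.^ suc n ℕ.* M₁ → Small p M₁ →
    (∀ q → Prime q → q ∣ M₁ → q ∣ length B) →
    Tile M A B → Lev p n B → T2-all (p ℕ.^ n ℕ.* M₁) → T2-mod M A × T2-mod M B
  slab-step {p} {n} {M₁} {M} A B pr p∤M₁ M≡ small rad∣B tile levB T2N = T2-A , T2-B
    where open SlabT2 {p} {n} {M₁} {M} A B pr p∤M₁ M≡ tile (class-bound {p} {n} {M₁} {M} A B pr p∤M₁ M≡ tile levB small rad∣B) levB T2N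

  -- Both n and `M₁` vary in the induction: the subgroup step divides `M₁` by a prime, the slab step
  -- lowers n. At n = 0 the modulus is `M₁` itself, and the hypothesis on its divisors applies.
  T2-tiling : ∀ p → Prime p → ∀ M n M₁ .{{_ : ℕ.NonZero M}} → M ≡ p ℕ.^ n ℕ.* M₁ → ¬ p ∣ M₁ →
    (∀ M′ .{{_ : ℕ.NonZero M′}} → M′ ∣ M₁ → T2-all M′) → Small p M₁ → T2-all M
  T2-tiling p pr = λ M n M₁ {{M≢0}} → <-rec Goal step M n M₁ (ℕ.≢-nonZero⁻¹ M {{M≢0}})
    where
    Goal : ℕ → Set
    Goal M = ∀ n M₁ → M ≢ 0 → M ≡ p ℕ.^ n ℕ.* M₁ → ¬ p ∣ M₁ →
      (∀ M′ .{{_ : ℕ.NonZero M′}} → M′ ∣ M₁ → T2-all M′) → Small p M₁ → T2-all M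
    step : ∀ M → (∀ {N} → N ℕ.< M → Goal N) → Goal M
    step M rec zero M₁ M≢0 M≡ p∤M₁ T2′ small =
      T2′ M {{ℕ.≢-nonZero M≢0}} (ℕD.∣-reflexive (trans M≡ (ℕP.+-identityʳ M₁)))
    step M rec (suc n) M₁ M≢0 M≡ p∤M₁ T2′ small A B tile =
      try (missing-prime? M₁ M₁≢0 (length A)) (missing-prime? M₁ M₁≢0 (length B))
      where
      instance
        M-nonZero : ℕ.NonZero M
        M-nonZero = ℕ.≢-nonZero M≢0
      M₁≢0 : M₁ ≢ 0
      M₁≢0 e = p∤M₁ (subst (p ∣_) (sym e) (p ℕD.∣0))
      tileᵗ : Tile M B A
      tileᵗ = Tile-comm {M} {A} {B} tile
      swap : ∀ {X Y : Set} → X × Y → Y × X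
      swap (x , y) = y , x
      smaller : ∀ q N → Prime q → M ≡ q ℕ.* N → N ≢ 0 × N ℕ.< M
      smaller q N pq e = N≢0 , subst (N ℕ.<_) (trans (ℕP.*-comm N q) (sym e))
        (ℕP.m<m*n N q {{ℕ.≢-nonZero N≢0}} (ℕ.nonTrivial⇒n>1 q {{prime⇒nonTrivial pq}}))
        where
        N≢0 : N ≢ 0
        N≢0 N≡0 = M≢0 (trans e (trans (cong (q ℕ.*_) N≡0) (ℕP.*-zeroʳ q)))
      subgroup : ∀ q A B → Prime q → q ∣ M₁ → ¬ q ∣ length A → Tile M A B → T2-mod M A × T2-mod M B
      subgroup q A B pq (ℕD.divides M₂ M₁≡) q∤A tile =
        T2-subgroup A B {{M-nonZero}} {{ℕ.≢-nonZero N≢0}} pq M≡′ tile q∤A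
          (rec N<M (suc n) M₂ N≢0 refl (λ d → p∤M₁ (subst (p ∣_) (sym M₁≡′) (ℕD.∣n⇒∣m*n q d)))
            (λ M′ d → T2′ M′ (ℕD.∣-trans d (ℕD.divides q M₁≡′)))
              (Small-divide {p} {q} {M₂} pq (subst (Small p) M₁≡′ small)))
        where
        N = p ℕ.^ suc n ℕ.* M₂
        M₁≡′ : M₁ ≡ q ℕ.* M₂
        M₁≡′ = trans M₁≡ (ℕP.*-comm M₂ q)
        M≡′ : M ≡ q ℕ.* N
        M≡′ = trans M≡ (trans (cong (p ℕ.^ suc n ℕ.*_) M₁≡′) (trans (sym (ℕP.*-assoc (p ℕ.^ suc n) q M₂))
          (trans (cong (ℕ._* M₂) (ℕP.*-comm (p ℕ.^ suc n) q)) (ℕP.*-assoc q (p ℕ.^ suc n) M₂))))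
        N≢0 = proj₁ (smaller q N pq M≡′)
        N<M = proj₂ (smaller q N pq M≡′)
      T2N : T2-all (p ℕ.^ n ℕ.* M₁)
      T2N = let (N≢0 , N<M) = smaller p (p ℕ.^ n ℕ.* M₁) pr (trans M≡ (ℕP.*-assoc p (p ℕ.^ n) M₁)) in rec N<M n M₁ N≢0 refl p∤M₁ T2′ small
      try : (∃ λ q → Prime q × q ∣ M₁ × ¬ q ∣ length A) ⊎ (∀ q → Prime q → q ∣ M₁ → q ∣ length A) →
        (∃ λ q → Prime q × q ∣ M₁ × ¬ q ∣ length B) ⊎ (∀ q → Prime q → q ∣ M₁ → q ∣ length B) →
          T2-mod M A × T2-mod M B
      try (inj₁ (q , pq , q∣M₁ , q∤A)) _ = subgroup q A B pq q∣M₁ q∤A tile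
      try _ (inj₁ (q , pq , q∣M₁ , q∤B)) = swap (subgroup q B A pq q∣M₁ q∤B tileᵗ)
      try (inj₂ rad∣A) (inj₂ rad∣B) = [
        (λ levA → swap (slab-step {p} {n} {M₁} {M} B A pr p∤M₁ M≡ small rad∣A tileᵗ levA T2N))
        , (λ levB → slab-step {p} {n} {M₁} {M} A B pr p∤M₁ M≡ small rad∣B tile levB T2N) ]′
        (Lev-dichotomy n A B pr (subst (p ℕ.^ suc n ∣_) (sym M≡) (ℕD.m∣m*n M₁)) tile)

  -- From mask polynomials to class counts

  ∣P⇒∣ᴾ : ∀ {P F} → P ∣P F → P ∣ᴾ F
  ∣P⇒∣ᴾ (Q , e) = divides Q (mk e)

  ∣ᴾ⇒∣P : ∀ {P F} → P ∣ᴾ F → P ∣P F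
  ∣ᴾ⇒∣P (divides Q e) = Q , at e

  elements : ∀ {n} → ℕ → Vec Bool n → List ℤ
  elements k []          = []
  elements k (true ∷ v)  = + k ∷ elements (suc k) v
  elements k (false ∷ v) = elements (suc k) v

  bit : Bool → ℤ
  bit b = if b then 1ℤ else 0ℤ

  -- The mask starts in degree 0 while its elements start at k, whence the shift of x.
  np-mask : ∀ s {n} k (v : Subset n) x → np s (mask v) (x - + k) ≡ cnt s x (elements k v)
  np-mask s k []          x = refl
  np-mask s k (true ∷ v)  x = cong₂ _+_ (trans (ℤP.*-identityˡ (δ s (0ℤ - (x - + k)))) (cong (δ s) (lem x (+ k))))
    (trans (cong (np s (mask v)) (trans (lem₂ x (+ k)) (cong (_-_ x) (sym (ℤP.pos-+ 1 k)))))
      (np-mask s (suc k) v x))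
    where
    lem : ∀ x k → 0ℤ - (x - k) ≡ k - x
    lem = solve-∀
    lem₂ : ∀ x k → x - k - 1ℤ ≡ x - (1ℤ + k)
    lem₂ = solve-∀
  np-mask s k (false ∷ v) x = trans (cong (_+ np s (mask v) (x - + k - 1ℤ)) (ℤP.*-zeroˡ (δ s (0ℤ - (x - + k)))))
    (trans (ℤP.+-identityˡ _)
    (trans (cong (np s (mask v)) (trans (lem₂ x (+ k)) (cong (_-_ x) (sym (ℤP.pos-+ 1 k)))))
      (np-mask s (suc k) v x)))
    where
    lem₂ : ∀ x k → x - k - 1ℤ ≡ x - (1ℤ + k)
    lem₂ = solve-∀

  ∈⇒∈elements : ∀ {n} k {v : Subset n} {i} → i ∈ˢ v → + (k ℕ.+ toℕ i) ∈ elements k v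
  ∈⇒∈elements k {true ∷ v} here = here (cong +_ (ℕP.+-identityʳ k))
  ∈⇒∈elements k {true ∷ v} {Fin.suc i} (there m) =
    there (subst (λ z → + z ∈ elements (suc k) v) (sym (ℕP.+-suc k (toℕ i))) (∈⇒∈elements (suc k) m))
  ∈⇒∈elements k {false ∷ v} {Fin.suc i} (there m) =
    subst (λ z → + z ∈ elements (suc k) v) (sym (ℕP.+-suc k (toℕ i))) (∈⇒∈elements (suc k) m)

  ∈elements⇒∈ : ∀ {n} k {v : Subset n} {z} → z ∈ elements k v → ∃ λ i → i ∈ˢ v × z ≡ + (k ℕ.+ toℕ i)
  ∈elements⇒∈ k {true ∷ v} (here refl) = Fin.zero , here , cong +_ (sym (ℕP.+-identityʳ k))
  ∈elements⇒∈ k {true ∷ v} (there m) with ∈elements⇒∈ (suc k) m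
  ... | i , i∈ , e = Fin.suc i , there i∈ , trans e (cong +_ (sym (ℕP.+-suc k (toℕ i))))
  ∈elements⇒∈ k {false ∷ v} m with ∈elements⇒∈ (suc k) m
  ... | i , i∈ , e = Fin.suc i , there i∈ , trans e (cong +_ (sym (ℕP.+-suc k (toℕ i))))

  elements-Unique : ∀ {n} k (v : Subset n) → Unique (elements k v)
  elements-Unique k []          = []
  elements-Unique k (true ∷ v)  = All.tabulate (λ m e → let (i , _ , e′) = ∈elements⇒∈ (suc k) {v} m in
    ℕP.m≢1+m+n k (ℤP.+-injective (trans e e′))) ∷ elements-Unique (suc k) v
  elements-Unique k (false ∷ v) = elements-Unique (suc k) v

  Φ∣mask⇒CC : ∀ {n} (A : Subset n) ps → All PrimePower ps → Φ (prod ps) ∣P mask A → CC ps (elements 0 A)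
  Φ∣mask⇒CC A ps gs d hs dirs x = trans
    (Cub-cong hs (λ y → sym (trans (cong (np (prod ps) (mask A)) (sym (ℤP.+-identityʳ y)))
    (np-mask (prod ps) 0 A y))) x)
    (Φ∣⇒Cuboid ps (mask A) gs (∣P⇒∣ᴾ d) hs dirs x)

  CC⇒Φ∣mask : ∀ {n} (A : Subset n) ps → All PrimePower ps → CC ps (elements 0 A) → Φ (prod ps) ∣P mask A
  CC⇒Φ∣mask A ps gs c = ∣ᴾ⇒∣P (Cuboid⇒Φ∣ ps (mask A) gs λ hs dirs x →
    trans (Cub-cong hs (λ y → trans (cong (np (prod ps) (mask A)) (sym (ℤP.+-identityʳ y)))
      (np-mask (prod ps) 0 A y)) x) (c hs dirs x))

  Φ∣mask⇒Lev : ∀ {n} (A : Subset n) {p} j → Prime p → Φ (p ℕ.^ suc j) ∣P mask A → Lev p j (elements 0 A)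
  Φ∣mask⇒Lev A {p} j pr d = CC-single⇒Lev p j (elements 0 A) (prime≢0 pr)
    (Φ∣mask⇒CC A ((p , suc j) ∷ []) ((pr , s≤s z≤n) ∷ [])
      (subst (λ s → Φ s ∣P mask A) (sym (ℕP.*-identityʳ (p ℕ.^ suc j))) d))

  Lev⇒Φ∣mask : ∀ {n} (A : Subset n) {p} j → Prime p → Lev p j (elements 0 A) → Φ (p ℕ.^ suc j) ∣P mask A
  Lev⇒Φ∣mask A {p} j pr l = subst (λ s → Φ s ∣P mask A) (ℕP.*-identityʳ (p ℕ.^ suc j))
    (CC⇒Φ∣mask A ((p , suc j) ∷ []) ((pr , s≤s z≤n) ∷ []) (Lev⇒CC-single p j (elements 0 A) (prime≢0 pr) l))

  product≡prod : ∀ {f : ℕ × ℕ → ℕ} → (∀ p α → f (p , α) ≡ p ℕ.^ α) → ∀ ps → product (map f ps) ≡ prod ps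
  product≡prod h []             = refl
  product≡prod h ((p , α) ∷ ps) = cong₂ ℕ._*_ (h p α) (product≡prod h ps)

  -- Tilings by subsets and by lists

  %≡⇒∣ : ∀ {N} .{{_ : ℕ.NonZero N}} n {x} → n % N ≡ x → N ∣ℤ + n - + x
  %≡⇒∣ n refl = ∣-%ℕ (+ n)

  ∣⇒%≡ : ∀ {N} .{{_ : ℕ.NonZero N}} n {x} → x ℕ.< N → N ∣ℤ + n - + x → n % N ≡ x
  ∣⇒%≡ {N} n {x} x<N h = small-∣⇒≡ (n%ℕd<d (+ n) N) x<N
    (∣-chain (+ (n % N)) (+ n) (+ x) (∣-flip (+ n) (+ (n % N)) (∣-%ℕ (+ n))) h)

  Tiling⇒Tile : ∀ {N} .{{_ : ℕ.NonZero N}} (A B : Subset N) → Tiling N A B → Tile N (elements 0 A) (elements 0 B)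
  Tiling⇒Tile {N} A B t x = ℤP.≤-antisym
      (∑ₗ≤1 (λ a → cnt N (x - a) Bs) (elements-Unique 0 A)
        (λ {a} a∈ → ∑ₗ≤1 (λ b → δ N (b - (x - a))) (elements-Unique 0 B) (λ _ → 𝟙≤1 _) λ b∈ b′∈ h h′ →
          proj₂ (unique a∈ a∈ b∈ b′∈ (𝟙≢0 _ h) (𝟙≢0 _ h′)))
        λ a∈ a′∈ h h′ → let (b , b∈ , k) = ∑ₗ≢0 Bs _ h ; (b′ , b′∈ , k′) = ∑ₗ≢0 Bs _ h′ in proj₁ (unique a∈ a′∈ b∈ b′∈ (𝟙≢0 _ k) (𝟙≢0 _ k′)))
      (exists (proj₁ (t r)))
    where
    As = elements 0 A
    Bs = elements 0 B
    r : Fin N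
    r = fromℕ< (n%ℕd<d x N)
    r≡ : toℕ r ≡ x %ℕ N
    r≡ = toℕ-fromℕ< (n%ℕd<d x N)
    x∣r : N ∣ℤ x - + toℕ r
    x∣r = subst (λ k → N ∣ℤ x - + k) (sym r≡) (∣-%ℕ x)
    regroup : ∀ a b x → (a + b) - x ≡ b - (x - a)
    regroup = solve-∀
    exists : (∃ λ (a : Fin N) → ∃ λ (b : Fin N) → a ∈ˢ A × b ∈ˢ B × (toℕ a ℕ.+ toℕ b) % N ≡ toℕ r) →
      1ℤ ≤ ∑ₗ As (λ a → cnt N (x - a) Bs)
    exists (a , b , a∈ , b∈ , e) = ℤP.≤-trans (cnt-member (∈⇒∈elements 0 b∈) (∣-cast (regroup (+ toℕ a) (+ toℕ b) x)
        (∣-chain (+ toℕ a + + toℕ b) (+ toℕ r) x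
          (∣-cast (cong (_- + toℕ r) (ℤP.pos-+ (toℕ a) (toℕ b))) (%≡⇒∣ (toℕ a ℕ.+ toℕ b) e))
          (∣-flip x (+ toℕ r) x∣r))))
      (∑ₗ-≥-term (λ a → cnt N (x - a) Bs) (λ a → cnt≥0 N (x - a) Bs) (∈⇒∈elements 0 a∈))
    unique : ∀ {a a′ b b′} → a ∈ As → a′ ∈ As → b ∈ Bs → b′ ∈ Bs → N ∣ℤ b - (x - a) → N ∣ℤ b′ - (x - a′) →
      a ≡ a′ × b ≡ b′
    unique {a} {a′} {b} {b′} a∈ a′∈ b∈ b′∈ h h′ = same (∈elements⇒∈ 0 a∈) (∈elements⇒∈ 0 a′∈) (∈elements⇒∈ 0 b∈)
      (∈elements⇒∈ 0 b′∈)
      where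
      hits : ∀ {a b} (i j : Fin N) → a ≡ + toℕ i → b ≡ + toℕ j → N ∣ℤ b - (x - a) → (toℕ i ℕ.+ toℕ j) % N ≡ toℕ r
      hits i j refl refl h = ∣⇒%≡ (toℕ i ℕ.+ toℕ j) (toℕ<n r)
        (∣-cast (cong (_- + toℕ r) (sym (ℤP.pos-+ (toℕ i) (toℕ j))))
        (∣-chain (+ toℕ i + + toℕ j) x (+ toℕ r) (∣-cast (sym (regroup (+ toℕ i) (+ toℕ j) x)) h) x∣r))
      same : (∃ λ i → i ∈ˢ A × a ≡ + toℕ i) → (∃ λ i → i ∈ˢ A × a′ ≡ + toℕ i) → (∃ λ j → j ∈ˢ B × b ≡ + toℕ j) →
        (∃ λ j → j ∈ˢ B × b′ ≡ + toℕ j) → a ≡ a′ × b ≡ b′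
      same (i , i∈ , ea) (i′ , i′∈ , ea′) (j , j∈ , eb) (j′ , j′∈ , eb′) =
        let (e , f) = proj₂ (t r) i j i′ j′ i∈ j∈ i′∈ j′∈ (hits i j ea eb h) (hits i′ j′ ea′ eb′ h′)
        in trans ea (trans (cong (λ i → + toℕ i) e) (sym ea′)) , trans eb (trans (cong (λ i → + toℕ i) f) (sym eb′))

  -- The way back from lists to subsets, since the hypothesis on the divisors of `M₁` concerns
  -- tilings by subsets.
  residues : ∀ N → List ℤ → Subset N
  residues N A = tabulate λ i → does (1ℤ ℤP.≤? cnt N (+ toℕ i) A)

  ∈residues⁺ : ∀ {N A a} {i : Fin N} → a ∈ A → N ∣ℤ a - + toℕ i → i ∈ˢ residues N A
  ∈residues⁺ {N} {A} {a} {i} a∈ h =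
    lookup⇒[]= i (residues N A) (trans (lookup∘tabulate _ i)
    (dec-true (1ℤ ℤP.≤? cnt N (+ toℕ i) A) (cnt-member a∈ h)))

  ∈residues⁻ : ∀ {N A} {i : Fin N} → i ∈ˢ residues N A → ∃ λ a → a ∈ A × N ∣ℤ a - + toℕ i
  ∈residues⁻ {N} {A} {i} m = let (a , a∈ , h) = ∑ₗ≢0 A _ nonzero in a , a∈ , 𝟙≢0 _ h
    where
    positive : 1ℤ ≤ cnt N (+ toℕ i) A
    positive = does⇒ (1ℤ ℤP.≤? cnt N (+ toℕ i) A) (trans (sym (lookup∘tabulate _ i)) ([]=⇒lookup m))
      where
      does⇒ : ∀ {P : Set} (d : Dec P) → does d ≡ true → P
      does⇒ (yes p) _ = p
    nonzero : cnt N (+ toℕ i) A ≢ 0ℤ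
    nonzero e with subst (1ℤ ≤_) e positive
    ... | +≤+ ()

  Tile⇒Tiling : ∀ {N} .{{_ : ℕ.NonZero N}} A B → Tile N A B → Tiling N (residues N A) (residues N B)
  Tile⇒Tiling {N} A B t x = exists (Tile-surjective {N} {A} {B} t (+ toℕ x)) , unique
    where
    res : ℤ → Fin N
    res z = fromℕ< (n%ℕd<d z N)
    res∣ : ∀ z → N ∣ℤ z - + toℕ (res z)
    res∣ z = subst (λ k → N ∣ℤ z - + k) (sym (toℕ-fromℕ< (n%ℕd<d z N))) (∣-%ℕ z)
    regroup : ∀ a b i j x → ((a + b) - x) - ((a - i) + (b - j)) ≡ (i + j) - x
    regroup = solve-∀
    exists : (∃ λ a → ∃ λ b → a ∈ A × b ∈ B × N ∣ℤ (a + b) - + toℕ x) → _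
    exists (a , b , a∈ , b∈ , h) = res a , res b , ∈residues⁺ a∈ (res∣ a) , ∈residues⁺ b∈ (res∣ b) ,
      ∣⇒%≡ (toℕ (res a) ℕ.+ toℕ (res b)) (toℕ<n x)
        (∣-cast (trans (regroup a b (+ toℕ (res a)) (+ toℕ (res b)) (+ toℕ x))
        (cong (_- + toℕ x) (sym (ℤP.pos-+ (toℕ (res a)) (toℕ (res b))))))
        (∣m∣n⇒∣m-n h (∣m∣n⇒∣m+n (res∣ a) (res∣ b))))
    unique : ∀ i j i′ j′ → i ∈ˢ residues N A → j ∈ˢ residues N B → i′ ∈ˢ residues N A → j′ ∈ˢ residues N B →
      (toℕ i ℕ.+ toℕ j) % N ≡ toℕ x → (toℕ i′ ℕ.+ toℕ j′) % N ≡ toℕ x → i ≡ i′ × j ≡ j′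
    unique i j i′ j′ i∈ j∈ i′∈ j′∈ e e′ with ∈residues⁻ {N} {A} i∈ | ∈residues⁻ {N} {B} j∈ | ∈residues⁻ {N} {A}
      i′∈ | ∈residues⁻ {N} {B} j′∈
    ... | a , a∈ , ha | b , b∈ , hb | a′ , a′∈ , ha′ | b′ , b′∈ , hb′ =
      same a a′ ha ha′ (proj₁ eqs) , same b b′ hb hb′ (proj₂ eqs)
      where
      lem : ∀ a b i j x → ((i + j) - x) + ((a - i) + (b - j)) ≡ (a + b) - x
      lem = solve-∀
      at-x : ∀ a b (i j : Fin N) → N ∣ℤ a - + toℕ i → N ∣ℤ b - + toℕ j →
        (toℕ i ℕ.+ toℕ j) % N ≡ toℕ x → N ∣ℤ (a + b) - + toℕ x
      at-x a b i j h k e = ∣-cast (lem a b (+ toℕ i) (+ toℕ j) (+ toℕ x))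
        (∣m∣n⇒∣m+n (∣-cast (cong (_- + toℕ x) (ℤP.pos-+ (toℕ i) (toℕ j))) (%≡⇒∣ (toℕ i ℕ.+ toℕ j) e))
        (∣m∣n⇒∣m+n h k))
      eqs : a ≡ a′ × b ≡ b′
      eqs = Tile-injective {N} {A} {B} t a∈ a′∈ b∈ b′∈
        (∣-chain (a + b) (+ toℕ x) (a′ + b′) (at-x a b i j ha hb e)
        (∣-flip (a′ + b′) (+ toℕ x) (at-x a′ b′ i′ j′ ha′ hb′ e′)))
      same : ∀ a a′ {i i′ : Fin N} → N ∣ℤ a - + toℕ i → N ∣ℤ a′ - + toℕ i′ → a ≡ a′ → i ≡ i′
      same a _ {i} {i′} h h′ refl = toℕ-injective
        (small-∣⇒≡ (toℕ<n i) (toℕ<n i′) (∣-chain (+ toℕ i) a (+ toℕ i′) (∣-flip a (+ toℕ i) h) h′))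

  cnt-elements-tabulate : ∀ s x n k (F : ℕ → Bool) →
    cnt s x (elements k (tabulate {n = n} λ i → F (k ℕ.+ toℕ i))) ≡ ∑< n
    (λ i → bit (F (k ℕ.+ i)) * δ s (+ (k ℕ.+ i) - x))
  cnt-elements-tabulate s x zero    k F = refl
  cnt-elements-tabulate s x (suc n) k F =
    trans (head (F (k ℕ.+ 0)) refl) (cong (_+_ (bit (F (k ℕ.+ 0)) * δ s (+ (k ℕ.+ 0) - x)))
      (trans (cong (λ v → cnt s x (elements (suc k) v)) (tabulate-cong {n = n} λ i → cong F (ℕP.+-suc k (toℕ i))))
        (trans (cnt-elements-tabulate s x n (suc k) F)
          (∑<-cong n λ i _ → cong (λ m → bit (F m) * δ s (+ m - x)) (sym (ℕP.+-suc k i))))))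
    where
    rest = tabulate {n = n} λ i → F (k ℕ.+ suc (toℕ i))
    head : ∀ b → F (k ℕ.+ 0) ≡ b → cnt s x (elements k (b ∷ rest)) ≡ bit b * δ s (+ (k ℕ.+ 0) - x) + cnt s x
      (elements (suc k) rest)
    head true  e = cong (_+ cnt s x (elements (suc k) rest))
      (trans (cong (λ m → δ s (+ m - x)) (sym (ℕP.+-identityʳ k))) (sym (ℤP.*-identityˡ _)))
    head false e = sym (trans (cong (_+ cnt s x (elements (suc k) rest)) (ℤP.*-zeroˡ (δ s (+ (k ℕ.+ 0) - x))))
      (ℤP.+-identityˡ _))

  -- In a tiling each class modulo `N` meets `A` at most once, so forgetting multiplicities loses
  -- nothing; a class modulo s is a union of classes modulo `N`.
  cnt-residues : ∀ {N} .{{_ : ℕ.NonZero N}} A B → Tile N A B → ∀ s x → s ∣ N →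
    cnt s x (elements 0 (residues N A)) ≡ cnt s x A
  cnt-residues {N} A B t s x s∣N = trans (cnt-elements-tabulate s x N 0 (λ i → does (1ℤ ℤP.≤? cnt N (+ i) A)))
    (trans (∑<-cong N λ i _ → trans (cong (_* δ s (+ i - x)) (bit≡ i))
      (trans (ℤP.*-comm (cnt N (+ i) A) (δ s (+ i - x))) (sym (∑ₗ-* A (δ s (+ i - x)) _))))
    (trans (sym (∑ₗ-∑<-swap A N _)) (∑ₗ-cong A λ a → trans (∑<-cong N λ i _ → move a i)
      (trans (∑<-* N (δ s (a - x)) (λ i → δ N (a - + i)))
        (trans (cong (δ s (a - x) *_) (∑<-δ N a)) (ℤP.*-identityʳ _))))))
    where
    bit≡ : ∀ i → bit (does (1ℤ ℤP.≤? cnt N (+ i) A)) ≡ cnt N (+ i) A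
    bit≡ i with 1ℤ ℤP.≤? cnt N (+ i) A
    ... | yes h = ℤP.≤-antisym h (Tile-cnt≤1 {N} {A} {B} t (+ i))
    ... | no ¬h = ℤP.≤-antisym (cnt≥0 N (+ i) A) (≤0 ¬h (cnt≥0 N (+ i) A))
      where
      ≤0 : ∀ {z} → ¬ 1ℤ ≤ z → 0ℤ ≤ z → z ≤ 0ℤ
      ≤0 {+ zero}  _ _ = ℤP.≤-refl
      ≤0 {+ suc n} h _ = ⊥-elim (h (+≤+ (s≤s z≤n)))
    lem : ∀ a i x → (i - x) - (a - x) ≡ i - a
    lem = solve-∀
    move : ∀ a i → δ s (+ i - x) * δ N (a - + i) ≡ δ s (a - x) * δ N (a - + i)
    move a i with + N ∣? (a - + i)
    ... | yes h = cong (_* 1ℤ) (δ-shift s (+ i - x) (a - x)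
      (∣-cast (sym (lem a (+ i) x)) (∣ℤ-trans s∣N (∣-flip a (+ i) h))))
    ... | no _  = trans (ℤP.*-zeroʳ (δ s (+ i - x))) (sym (ℤP.*-zeroʳ (δ s (a - x))))

  T2⇒T2-mod : ∀ {N} .{{_ : ℕ.NonZero N}} A B → Tile N A B → T2 (residues N A) → T2-mod N A
  T2⇒T2-mod {N} A B t t2 ps ps≢[] gs u ds ls hs dirs x =
    trans (Cub-cong hs (λ y → sym (cnt-residues A B t (prod ps) y (prod-∣ ps gs u ds))) x)
      (Φ∣mask⇒CC R ps gs (subst (λ s → Φ s ∣P mask R) (product≡prod (λ _ _ → refl) ps)
        (t2 ps ps≢[] u (conditions ps gs ds ls))) hs dirs x)
    where
    R = residues N A
    conditions : ∀ ps → All PrimePower ps → All (λ (p , α) → p ℕ.^ α ∣ N) ps → All (Condition A) ps →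
      All _ ps
    conditions [] [] [] [] = []
    conditions ((p , suc j) ∷ ps) ((pr , 1≤α) ∷ gs) (d ∷ ds) (l ∷ ls) = (pr , 1≤α , Lev⇒Φ∣mask R j pr λ x →
      trans (cong (+ p *_) (cnt-residues A B t (p ℕ.^ suc j) x d))
        (trans (l x) (sym (cnt-residues A B t (p ℕ.^ j) x (ℕD.∣-trans (ℕD.n∣m*n p) d))))) ∷ conditions ps gs ds ls

  -- By `Lev-absent` every prime power at which `A` satisfies a condition divides `N`, so the
  -- restriction built into `T2-mod` excludes none.
  T2-mod⇒T2 : ∀ {N} .{{_ : ℕ.NonZero N}} (A B : Subset N) → Tile N (elements 0 A) (elements 0 B) →
    T2-mod N (elements 0 A) → T2 A
  T2-mod⇒T2 {N} A B t t2 ps ps≢[] u cs = subst (λ s → Φ s ∣P mask A) (sym (product≡prod (λ _ _ → refl) ps))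
      (CC⇒Φ∣mask A ps (All.map (λ (pr , h , _) → pr , h) cs)
        (t2 ps ps≢[] (All.map (λ (pr , h , _) → pr , h) cs) u (All.map (λ c → proj₁ (level c)) cs)
        (All.map (λ c → proj₂ (level c)) cs)))
    where
    level : ∀ {pα : ℕ × ℕ} → Prime (proj₁ pα) × 1 ℕ.≤ proj₂ pα × (Φ (proj₁ pα ℕ.^ proj₂ pα) ∣P mask A) →
      (proj₁ pα ℕ.^ proj₂ pα ∣ N) × Condition (elements 0 A) pα
    level {p , suc j} (pr , _ , d) = proj₁ (Lev-absent j (elements 0 A) (elements 0 B) pr t l) , l
      where l = Φ∣mask⇒Lev A j pr d

  -- The radical and the size of p

  distinct-primes-∣ : ∀ {m} ls → All Prime ls → Unique ls → All (_∣ m) ls → product ls ∣ m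
  distinct-primes-∣ {m} [] [] [] [] = ℕD.1∣ m
  distinct-primes-∣ (ℓ ∷ ls) (pr ∷ prs) (ℓ∉ ∷ u) (d ∷ ds) =
    coprime-*∣ (prime-coprime pr (λ h → All.lookup ℓ∉ (factorisationHasAllPrimeFactors pr h prs) refl)) d
    (distinct-primes-∣ ls prs u ds)

  -- The quotient bound says `M₁` < p rad `M₁`, and rad `M₁`, a product of distinct primes dividing
  -- m, divides m.
  D<⇒Small : ∀ p M₁ → D M₁ ℕ.< p → Small p M₁
  D<⇒Small p M₁ D<p m m≢0 rad∣m = ℕP.<-≤-trans M₁<p*rad (ℕP.*-monoʳ-≤ p (ℕD.∣⇒≤ {{ℕ.≢-nonZero m≢0}} rad∣))
    where
    instance
      rad≢0 : ℕ.NonZero (rad M₁)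
      rad≢0 = rad-nonZero M₁
    M₁<p*rad : M₁ ℕ.< p ℕ.* rad M₁
    M₁<p*rad = ℕP.≰⇒> λ h → ℕP.<⇒≱ D<p (subst (ℕ._≤ M₁ / rad M₁) (m*n/n≡m p (rad M₁)) (/-monoˡ-≤ (rad M₁) h))
    member : ∀ {q} → q ∈ primeDivisors M₁ → Prime q × q ∣ M₁
    member m = proj₂ (∈-filter⁻ (λ p → prime? p ×-dec (p ℕD.∣? M₁)) {xs = upTo (suc M₁)} m)
    rad∣ : rad M₁ ∣ m
    rad∣ = distinct-primes-∣ (primeDivisors M₁) (All.tabulate λ k → proj₁ (member k))
      (UniqueP.filter⁺ (λ p → prime? p ×-dec (p ℕD.∣? M₁)) (UniqueP.upTo⁺ (suc M₁)))
      (All.tabulate λ {q} k → rad∣m q (proj₁ (member k)) (proj₂ (member k)))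

open import Data.Nat using (ℕ; _^_; _*_; _<_; NonZero)
open import Data.Nat.Divisibility using (_∣_)
open import Data.Nat.Primality using (Prime)
open import Data.Fin.Subset using (Subset)
open import Data.Product using (_×_; _,_)
open import Relation.Nullary using (¬_)
open import Relation.Binary.PropositionalEquality using (_≡_)
open Tilings

theorem1p2 : ∀ (p₁ n₁ M₁ : ℕ) → Prime p₁ → ¬ (p₁ ∣ M₁) →
    (∀ (M′ : ℕ) .{{_ : NonZero M′}} → M′ ∣ M₁ →
    ∀ (A′ B′ : Subset M′) → Tiling M′ A′ B′ → T2 A′ × T2 B′) →
    D M₁ < p₁ →
    ∀ (M : ℕ) .{{_ : NonZero M}} → M ≡ p₁ ^ n₁ * M₁ →
    ∀ (A B : Subset M) → Tiling M A B → T2 A × T2 B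
theorem1p2 p₁ n₁ M₁ pr p∤M₁ T2′ D<p M M≡ A B t =
  let (tA , tB) = T2-tiling p₁ pr M n₁ M₁ M≡ p∤M₁ lists (D<⇒Small p₁ M₁ D<p) (elements 0 A) (elements 0 B) tile
  in T2-mod⇒T2 A B tile tA , T2-mod⇒T2 B A (Tile-comm {M} {elements 0 A} {elements 0 B} tile) tB
  where
  tile = Tiling⇒Tile A B t
  lists : ∀ M′ .{{_ : NonZero M′}} → M′ ∣ M₁ → T2-all M′
  lists M′ d A′ B′ t′ =
    let (tA , tB) = T2′ M′ d (residues M′ A′) (residues M′ B′) (Tile⇒Tiling A′ B′ t′) in
    T2⇒T2-mod A′ B′ t′ tA , T2⇒T2-mod B′ A′ (Tile-comm {M′} {A′} {B′} t′) tB
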